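{- For all integers $a\geq 2$ and all $n\geq 124$, \[\mathrm{ex}_{\Pi}\Bigl(n, 5, \tbinom{5}{2}a +5\Bigr) = \Pi_{2,1}(a,n).\]
   Context: A multigraph is a pair $G=(V,w)$ where $V$ is a finite set and $w:\binom{V}{2}\to\mathbb{Z}_{\geq 0}$. For $X\subseteq V$ write $e(G[X])=\sum_{xy\in\binom{X}{2}}w(xy)$ and $P(G)=\prod_{xy\in\binom{V}{2}}w(xy)$. Given integers $s\geq 2$, $q\geq 0$, $\mathcal{F}(n,s,q)$ denotes the set of multigraphs on vertex set $[n]=\{1,\dots,n\}$ in which every $s$-set $X$ of vertices satisfies $e(G[X])\leq q$, and $\mathrm{ex}_{\Pi}(n,s,q)=\max\{P(G): G\in\mathcal{F}(n,s,q)\}$. For positive integers $a,r$, $d\in\{0,\dots,a-1\}$ and $n$, $\mathcal{T}_{r,d}(a,n)$ is the set of multigraphs $G$ on $[n]$ whose vertex set can be partitioned into $r$ parts $V_0,\dots,V_{r-1}$ such that all pairs inside $V_0$ have multiplicity $a-d$, all pairs inside $V_i$ ($1\le i\le r-1$) have multiplicity $a$, and all other pairs have multiplicity $a+1$. $\Pi_{r,d}(a,n)=\max\{P(G):G\in\mathcal{T}_{r,d}(a,n)\}$. -}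

module Defs where

open import Data.Nat using (ℕ; zero; suc; _+_; _*_; _∸_; _≤_)
open import Data.Nat.ListAction using (sum; product)
open import Data.Fin using (Fin; zero; suc; toℕ; _<_; _≟_)
open import Data.Fin.Subset using (Subset; _∈_; ∣_∣)
open import Data.Fin.Subset.Properties using (_∈?_)
open import Data.List using (List; tabulate)
open import Data.Product using (Σ; ∃; _×_)
open import Relation.Binary.PropositionalEquality using (_≡_)
open import Relation.Nullary using (does)
open import Data.Bool using (Bool; true; false; if_then_else_; _∧_)

-- A multigraph on [n] = Fin n.  The weight of the pair {i,j} (i < j) is
-- w i j; only the values with toℕ i < toℕ j are ever consulted.
Multigraph : ℕ → Set
Multigraph n = Fin n → Fin n → ℕ

ΣPairs : (n : ℕ) → (Fin n → Fin n → ℕ) → ℕ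
ΣPairs zero    f = 0
ΣPairs (suc n) f = sum (tabulate (λ (j : Fin n) → f zero (suc j)))
                 + ΣPairs n (λ i j → f (suc i) (suc j))

ΠPairs : (n : ℕ) → (Fin n → Fin n → ℕ) → ℕ
ΠPairs zero    f = 1
ΠPairs (suc n) f = product (tabulate (λ (j : Fin n) → f zero (suc j)))
                 * ΠPairs n (λ i j → f (suc i) (suc j))

P : {n : ℕ} → Multigraph n → ℕ
P {n} w = ΠPairs n w

eIn : {n : ℕ} → Multigraph n → Subset n → ℕ
eIn {n} w X = ΣPairs n (λ i j → if does (i ∈? X) ∧ does (j ∈? X) then w i j else 0)

InF : (n s q : ℕ) → Multigraph n → Set
InF n s q w = (X : Subset n) → ∣ X ∣ ≡ s → eIn w X ≤ q

-- 𝓣_{r,d}(a,n): there is a partition c : [n] → {0,…,r-1} (parts may be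
-- empty) such that pairs inside V_0 have weight a-d, pairs inside V_k
-- (k ≥ 1) have weight a, and all other pairs weight a+1.
multT : {r : ℕ} → (a d : ℕ) → Fin r → Fin r → ℕ
multT a d zero    zero    = a ∸ d
multT a d zero    (suc _) = suc a
multT a d (suc k) zero    = suc a
multT a d (suc k) (suc l) = if does (k ≟ l) then a else suc a

InT : (r d a n : ℕ) → Multigraph n → Set
InT r d a n w = Σ (Fin n → Fin r) λ c →
  (i j : Fin n) → i < j → w i j ≡ multT a d (c i) (c j)

IsMaxP : {n : ℕ} → (Multigraph n → Set) → ℕ → Set
IsMaxP {n} S m = (Σ (Multigraph n) λ w → S w × P w ≡ m)
               × ((w : Multigraph n) → S w → P w ≤ m)

{-# OPTIONS --safe #-}
module Submission where

-- Write α = log ((a+1)/a) and β = log (a/(a-1)); then α ≤ β ≤ 7α/4.  A "star" has m centres and l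
-- leaves, with weights a-1 between centres, a between leaves and a+1 otherwise, so Π_{2,1}(a,n) is
-- the largest product of a star with m + l = n.
--
-- First let every 4-set carry at most 6a+3.  The product is at most that of an optimal star for n ≥ 6,
-- by induction on n.  Triples above 3a+2 and pairs above a+1 are removed at a profit, because every
-- other vertex sends little weight to them.  Otherwise all weights may be raised to at least a-1, and
-- a weight a-1 allows Zykov symmetrisation, so that weight a-1 may be taken to be transitive.  Let m
-- be the number of centres of an optimal star on n-1 vertices.  A vertex whose row product is at most
-- (a+1)^m a^(n-1-m) is removed.  If there is none and some class C of weight a-1 has more than m
-- vertices, then all pairs leaving C have weight a+1 and the graph is dominated by a star.  If all
-- classes have at most m vertices, counting second neighbourhoods gives n ≥ 5m, against n ≤ 4m+1.
--
-- Now let every 5-set carry at most 10a+5.  Either all 4-sets carry at most 6a+3, or some 4-set carries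
-- more; then every other vertex sends at most 4a+1 to it and it is removed.  Compared with the optimal
-- star, such a removal costs at most α, and gains at least α once n ≥ 33.  Averaging bounds the initial
-- deficit at 5 ≤ n ≤ 8, and the accumulated deficit is used up long before n = 124.

open import Defs
open import Algebra.Structures using (IsCommutativeMonoid)
open import Data.Bool using (Bool; true; false; _∧_; _∨_; not; if_then_else_) renaming (_≟_ to _≟ᵇ_)
open import Data.Bool.Properties using (∨-zeroʳ)
open import Data.Empty using (⊥)
open import Data.Fin using (Fin; zero; suc; punchIn; punchOut; _↑ˡ_; _↑ʳ_; toℕ; splitAt) renaming (_<_ to _<ᶠ_; _<?_ to _<ᶠ?_; _≟_ to _≟ᶠ_)
open import Data.Fin.Patterns using (0F; 1F; 2F; 3F; 4F; 5F)
open import Data.Fin.Properties using (punchIn-injective; punchInᵢ≢i; punchIn-punchOut; punchOut-injective; ↑ˡ-injective; ↑ʳ-injective; splitAt-↑ˡ; splitAt-↑ʳ; any?; all?)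
import Data.Fin.Properties as Fin
open import Data.Fin.Subset using (Subset; ∣_∣; inside; outside)
open import Data.Fin.Subset.Properties using (_∈?_)
open import Data.List using (foldr; tabulate)
open import Data.List.Properties using (tabulate-cong)
open import Data.Nat
open import Data.Nat.Combinatorics using (_C_)
open import Data.Nat.Induction using (<-rec)
open import Data.Nat.ListAction using (sum; product)
open import Data.Nat.Properties
open import Data.Nat.Tactic.RingSolver using (solve-∀)
open import Data.Product using (Σ; ∃; ∃₂; _×_; _,_; proj₁; proj₂)
open import Data.Sum using (_⊎_; inj₁; inj₂)
open import Data.Vec using (Vec; []; _∷_; lookup)
import Data.Vec as Vec
open import Data.Vec.Properties using (lookup∘tabulate)
open import Function using (_∘_; id)
open import Function.Definitions using (Injective)
open import Relation.Binary using (tri<; tri≈; tri>; Tri)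
open import Relation.Binary.PropositionalEquality
open import Relation.Nullary using (¬_; Dec; yes; no; does; contradiction)
import Relation.Nullary.Decidable as Dec

-- Logarithms never occur: an estimate log π ≤ log S + e α is multiplied out to π a^e ≤ S q^e, and
-- errors are counted in units of α. The best number of centres depends on β/α, hence on `a`, and is
-- never computed. Optimality is used only by comparing one more leaf with one more centre, which
-- already yields m + l ≤ 4 m. Weights are not bounded a priori, so products are bounded by sums
-- through the chord of the logarithm over [a, a + 1].
--
-- Small cases shape the two inductions. For 4-sets the star bound fails on five vertices, so the
-- exact statement starts at six, by a separate argument, and removals that may land on four or five
-- vertices work with slack one. For 5-sets, deleting a dense 4-set and regrowing one centre and
-- three leaves on a star with m centres is worth (2 m - 1) α - m β. From β ≤ 2 α this is only at
-- least -α; from β ≤ 7 α / 4 it is at least α, but only once m ≥ 8. So the induction loses while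
-- stars are small, and a large n repays the loss.

private
  variable
    n k r : ℕ

-- Products and sums over pairs

∏ ∑ : (Fin n → ℕ) → ℕ
∏ f = product (tabulate f)
∑ f = sum (tabulate f)

Inj : (Fin k → Fin n) → Set
Inj x = Injective _≡_ _≡_ x

Symmetric : {A : Set} → (Fin n → Fin n → A) → Set
Symmetric w = ∀ i j → w i j ≡ w j i

-- Deleting an arbitrary vertex instead of `zero` is a matter of reordering, so one argument for a
-- commutative monoid serves both sums and products. Symmetry enters because the pair of `zero` and
-- `suc u` is read in the other order.
module Removal
  (_∙_ : ℕ → ℕ → ℕ) (ε : ℕ) (isCM : IsCommutativeMonoid _≡_ _∙_ ε)
  (pairs : ∀ n → (Fin n → Fin n → ℕ) → ℕ)
  (pairs-suc : ∀ n f → pairs (suc n) f ≡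
     (foldr _∙_ ε (tabulate (λ j → f zero (suc j))) ∙ pairs n (λ i j → f (suc i) (suc j))))
  where

  open IsCommutativeMonoid isCM using (assoc; comm)
  open ≡-Reasoning

  fold : (Fin n → ℕ) → ℕ
  fold f = foldr _∙_ ε (tabulate f)

  swap : ∀ x y z → (x ∙ (y ∙ z)) ≡ (y ∙ (x ∙ z))
  swap x y z = begin
    x ∙ (y ∙ z) ≡⟨ assoc x y z ⟨
    (x ∙ y) ∙ z ≡⟨ cong (_∙ z) (comm x y) ⟩
    (y ∙ x) ∙ z ≡⟨ assoc y x z ⟩
    y ∙ (x ∙ z) ∎

  interchange : ∀ x y z t → ((x ∙ y) ∙ (z ∙ t)) ≡ ((x ∙ z) ∙ (y ∙ t))
  interchange x y z t = begin
    (x ∙ y) ∙ (z ∙ t) ≡⟨ assoc x y (z ∙ t) ⟩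
    x ∙ (y ∙ (z ∙ t)) ≡⟨ cong (x ∙_) (swap y z t) ⟩
    x ∙ (z ∙ (y ∙ t)) ≡⟨ assoc x z (y ∙ t) ⟨
    (x ∙ z) ∙ (y ∙ t) ∎

  fold-punchIn : (u : Fin (suc n)) (f : Fin (suc n) → ℕ) →
    fold f ≡ (f u ∙ fold (f ∘ punchIn u))
  fold-punchIn zero f = refl
  fold-punchIn {suc n} (suc u) f = begin
    f zero ∙ fold (f ∘ suc)                                ≡⟨ cong (f zero ∙_) (fold-punchIn u (f ∘ suc)) ⟩
    f zero ∙ (f (suc u) ∙ fold (f ∘ suc ∘ punchIn u))      ≡⟨ swap _ _ _ ⟩
    f (suc u) ∙ fold (f ∘ punchIn (suc u))                 ∎

  pairs-punchIn : (w : Fin (suc n) → Fin (suc n) → ℕ) → Symmetric w → ∀ u →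
    pairs (suc n) w ≡ (fold (λ j → w u (punchIn u j)) ∙ pairs n (λ i j → w (punchIn u i) (punchIn u j)))
  pairs-punchIn w s zero = pairs-suc _ w
  pairs-punchIn {suc n} w s (suc u) = begin
    pairs (suc (suc n)) w
      ≡⟨ pairs-suc _ w ⟩
    fold (λ j → w zero (suc j)) ∙ pairs (suc n) w₁
      ≡⟨ cong₂ _∙_ (fold-punchIn u (λ j → w zero (suc j))) (pairs-punchIn w₁ (λ i j → s (suc i) (suc j)) u) ⟩
    (w zero (suc u) ∙ R₀) ∙ (fold (λ j → w₁ u (punchIn u j)) ∙ Q)
      ≡⟨ cong (λ z → (z ∙ R₀) ∙ (fold (λ j → w₁ u (punchIn u j)) ∙ Q)) (s zero (suc u)) ⟩
    (w (suc u) zero ∙ R₀) ∙ (fold (λ j → w₁ u (punchIn u j)) ∙ Q)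
      ≡⟨ interchange _ _ _ _ ⟩
    (w (suc u) zero ∙ fold (λ j → w₁ u (punchIn u j))) ∙ (R₀ ∙ Q)
      ≡⟨ cong (fold (λ j → w (suc u) (punchIn (suc u) j)) ∙_) (pairs-suc _ (λ i j → w (punchIn (suc u) i) (punchIn (suc u) j))) ⟨
    fold (λ j → w (suc u) (punchIn (suc u) j)) ∙ pairs (suc n) (λ i j → w (punchIn (suc u) i) (punchIn (suc u) j)) ∎
    where
    w₁ : Fin (suc n) → Fin (suc n) → ℕ
    w₁ i j = w (suc i) (suc j)
    R₀ Q : ℕ
    R₀ = fold (λ j → w zero (suc (punchIn u j)))
    Q = pairs n (λ i j → w₁ (punchIn u i) (punchIn u j))

open Removal _*_ 1 *-1-isCommutativeMonoid ΠPairs (λ _ _ → refl)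
  using () renaming (fold-punchIn to ∏-punchIn; pairs-punchIn to ΠPairs-punchIn; interchange to *-interchange)
open Removal _+_ 0 +-0-isCommutativeMonoid ΣPairs (λ _ _ → refl)
  using () renaming (fold-punchIn to ∑-punchIn; pairs-punchIn to ΣPairs-punchIn; interchange to +-interchange)

∏-mono : {f g : Fin n → ℕ} → (∀ i → f i ≤ g i) → ∏ f ≤ ∏ g
∏-mono {zero}  h = ≤-refl
∏-mono {suc n} h = *-mono-≤ (h zero) (∏-mono (h ∘ suc))

∑-mono : {f g : Fin n → ℕ} → (∀ i → f i ≤ g i) → ∑ f ≤ ∑ g
∑-mono {zero}  h = ≤-refl
∑-mono {suc n} h = +-mono-≤ (h zero) (∑-mono (h ∘ suc))

∏-cong : {f g : Fin n → ℕ} → (∀ i → f i ≡ g i) → ∏ f ≡ ∏ g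
∏-cong h = cong product (tabulate-cong h)

∑-cong : {f g : Fin n → ℕ} → (∀ i → f i ≡ g i) → ∑ f ≡ ∑ g
∑-cong h = cong sum (tabulate-cong h)

∏-* : (f g : Fin n → ℕ) → ∏ (λ i → f i * g i) ≡ ∏ f * ∏ g
∏-* {zero}  f g = refl
∏-* {suc n} f g = trans (cong (f zero * g zero *_) (∏-* (f ∘ suc) (g ∘ suc)))
  (*-interchange (f zero) (g zero) _ _)

∑-+ : (f g : Fin n → ℕ) → ∑ (λ i → f i + g i) ≡ ∑ f + ∑ g
∑-+ {zero}  f g = refl
∑-+ {suc n} f g = trans (cong (f zero + g zero +_) (∑-+ (f ∘ suc) (g ∘ suc)))
  (+-interchange (f zero) (g zero) _ _)

∏-const : ∀ n x → ∏ {n} (λ _ → x) ≡ x ^ n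
∏-const zero    x = refl
∏-const (suc n) x = cong (x *_) (∏-const n x)

∑-const : ∀ n x → ∑ {n} (λ _ → x) ≡ n * x
∑-const zero    x = refl
∑-const (suc n) x = cong (x +_) (∑-const n x)

∏-↑ : ∀ k (f : Fin (k + r) → ℕ) → ∏ f ≡ ∏ (λ i → f (i ↑ˡ r)) * ∏ (λ j → f (k ↑ʳ j))
∏-↑ zero f = sym (*-identityˡ _)
∏-↑ (suc k) f = trans (cong (f zero *_) (∏-↑ k (f ∘ suc))) (sym (*-assoc (f zero) _ _))

∏-pos : {f : Fin n → ℕ} → (∀ i → 0 < f i) → 0 < ∏ f
∏-pos {zero}  h = s≤s z≤n
∏-pos {suc n} h = *-mono-≤ (h zero) (∏-pos (h ∘ suc))

ΠPairs-mono : {f g : Fin n → Fin n → ℕ} → (∀ i j → i <ᶠ j → f i j ≤ g i j) →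
  ΠPairs n f ≤ ΠPairs n g
ΠPairs-mono {zero}  h = ≤-refl
ΠPairs-mono {suc n} h = *-mono-≤ (∏-mono (λ j → h zero (suc j) (s≤s z≤n)))
  (ΠPairs-mono (λ i j i<j → h (suc i) (suc j) (s≤s i<j)))

ΠPairs-cong : {f g : Fin n → Fin n → ℕ} → (∀ i j → i <ᶠ j → f i j ≡ g i j) →
  ΠPairs n f ≡ ΠPairs n g
ΠPairs-cong h = ≤-antisym (ΠPairs-mono (λ i j i<j → ≤-reflexive (h i j i<j)))
  (ΠPairs-mono (λ i j i<j → ≤-reflexive (sym (h i j i<j))))

ΣPairs-cong-< : {f g : Fin n → Fin n → ℕ} → (∀ i j → i <ᶠ j → f i j ≡ g i j) → ΣPairs n f ≡ ΣPairs n g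
ΣPairs-cong-< {zero}  h = refl
ΣPairs-cong-< {suc n} h = cong₂ _+_ (∑-cong (λ j → h zero (suc j) (s≤s z≤n)))
  (ΣPairs-cong-< (λ i j i<j → h (suc i) (suc j) (s≤s i<j)))

ΣPairs-cong : {f g : Fin n → Fin n → ℕ} → (∀ i j → f i j ≡ g i j) → ΣPairs n f ≡ ΣPairs n g
ΣPairs-cong h = ΣPairs-cong-< (λ i j _ → h i j)

ΠPairs-pos : {f : Fin n → Fin n → ℕ} → (∀ i j → 0 < f i j) → 0 < ΠPairs n f
ΠPairs-pos {zero}  h = s≤s z≤n
ΠPairs-pos {suc n} h = *-mono-≤ (∏-pos (λ j → h zero (suc j))) (ΠPairs-pos (λ i j → h (suc i) (suc j)))

ΠPairs-↑ : ∀ k (w : Fin (k + r) → Fin (k + r) → ℕ) → Symmetric w →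
  ΠPairs (k + r) w ≡ ΠPairs k (λ i j → w (i ↑ˡ r) (j ↑ˡ r))
    * (∏ (λ j → ∏ (λ i → w (k ↑ʳ j) (i ↑ˡ r))) * ΠPairs r (λ i j → w (k ↑ʳ i) (k ↑ʳ j)))
ΠPairs-↑ {r} zero w s = begin
  ΠPairs r w ≡⟨ *-identityˡ _ ⟨
  1 * ΠPairs r w ≡⟨ cong (_* ΠPairs r w) (trans (∏-const r 1) (^-zeroˡ r)) ⟨
  ∏ {r} (λ _ → 1) * ΠPairs r w ≡⟨ *-identityˡ _ ⟨
  1 * (∏ {r} (λ _ → 1) * ΠPairs r w) ∎
  where open ≡-Reasoning
ΠPairs-↑ {r} (suc k) w s = begin
  ∏ (λ j → w zero (suc j)) * ΠPairs (k + r) w₁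
    ≡⟨ cong₂ _*_ (∏-↑ k (λ j → w zero (suc j))) (ΠPairs-↑ k w₁ (λ i j → s (suc i) (suc j))) ⟩
  (A * ∏ (λ j → w zero (suc (k ↑ʳ j)))) * (B * (K * D))
    ≡⟨ cong (λ z → (A * z) * (B * (K * D))) (∏-cong (λ j → s zero (suc (k ↑ʳ j)))) ⟩
  (A * A′) * (B * (K * D))
    ≡⟨ rearrange A A′ B K D ⟩
  (A * B) * ((A′ * K) * D)
    ≡⟨ cong (λ z → (A * B) * (z * D)) (∏-* (λ j → w (suc (k ↑ʳ j)) zero) (λ j → ∏ (λ i → w₁ (k ↑ʳ j) (i ↑ˡ r)))) ⟨
  (A * B) * (∏ (λ j → ∏ (λ i → w (suc (k ↑ʳ j)) (i ↑ˡ r))) * D) ∎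
  where
  open ≡-Reasoning
  w₁ : Fin (k + r) → Fin (k + r) → ℕ
  w₁ i j = w (suc i) (suc j)
  A A′ B K D : ℕ
  A = ∏ (λ i → w zero (suc (i ↑ˡ r)))
  A′ = ∏ (λ j → w (suc (k ↑ʳ j)) zero)
  B = ΠPairs k (λ i j → w₁ (i ↑ˡ r) (j ↑ˡ r))
  K = ∏ (λ j → ∏ (λ i → w₁ (k ↑ʳ j) (i ↑ˡ r)))
  D = ΠPairs r (λ i j → w₁ (k ↑ʳ i) (k ↑ʳ j))
  rearrange : ∀ A A′ B K D → (A * A′) * (B * (K * D)) ≡ (A * B) * ((A′ * K) * D)
  rearrange = solve-∀

-- A permutation that moves the chosen vertices to the front, where `ΠPairs-↑` can cut them off as a
-- block. It is built from successive `punchIn`s, so its invariance reduces to deleting one vertex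
-- at a time.
record Relabelling (x : Fin k → Fin (k + r)) : Set where
  field
    to : Fin (k + r) → Fin (k + r)
    to-injective : Inj to
    to-extends : ∀ i → to (i ↑ˡ r) ≡ x i
    ∏-to : ∀ f → ∏ (f ∘ to) ≡ ∏ f
    ΠPairs-to : ∀ w → Symmetric w → ΠPairs (k + r) (λ i j → w (to i) (to j)) ≡ ΠPairs (k + r) w

relabel : ∀ k {r} (x : Fin k → Fin (k + r)) → Inj x → Relabelling {k} {r} x
relabel zero x _ = record
  { to = id ; to-injective = id ; to-extends = λ () ; ∏-to = λ _ → refl ; ΠPairs-to = λ _ _ → refl }
relabel (suc k) {r} x inj = record
  { to = to′
  ; to-injective = λ {i} {j} → to′-injective i j
  ; to-extends = λ { zero → refl ; (suc i) → trans (cong (punchIn u) (R.to-extends i)) (punchIn-punchOut (apart i)) }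
  ; ∏-to = λ f → trans (cong (f u *_) (R.∏-to (f ∘ punchIn u))) (sym (∏-punchIn u f))
  ; ΠPairs-to = λ w s → trans
      (cong₂ _*_ (R.∏-to (λ j → w u (punchIn u j))) (R.ΠPairs-to (λ i j → w (punchIn u i) (punchIn u j)) (λ i j → s _ _)))
      (sym (ΠPairs-punchIn w s u))
  }
  where
  u : Fin (suc (k + r))
  u = x zero
  apart : ∀ i → u ≢ x (suc i)
  apart i eq with () ← inj eq
  x′ : Fin k → Fin (k + r)
  x′ i = punchOut (apart i)
  module R = Relabelling (relabel k x′ (λ {i} {j} eq → Fin.suc-injective (inj (punchOut-injective (apart i) (apart j) eq))))
  to′ : Fin (suc (k + r)) → Fin (suc (k + r))
  to′ zero    = u
  to′ (suc i) = punchIn u (R.to i)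
  to′-injective : ∀ i j → to′ i ≡ to′ j → i ≡ j
  to′-injective zero    zero    eq = refl
  to′-injective zero    (suc j) eq = contradiction (sym eq) (punchInᵢ≢i u (R.to j))
  to′-injective (suc i) zero    eq = contradiction eq (punchInᵢ≢i u (R.to i))
  to′-injective (suc i) (suc j) eq = cong suc (R.to-injective (punchIn-injective u _ _ eq))

handshake : (w : Fin (suc n) → Fin (suc n) → ℕ) → Symmetric w →
  ∑ (λ u → ∑ (λ j → w u (punchIn u j))) ≡ 2 * ΣPairs (suc n) w
handshake {zero}  w s = refl
handshake {suc n} w s = begin
  R + ∑ (λ u → w (suc u) zero + ∑ (λ j → w (suc u) (suc (punchIn u j))))
    ≡⟨ cong (R +_) (∑-+ (λ u → w (suc u) zero) (λ u → ∑ (λ j → w (suc u) (suc (punchIn u j))))) ⟩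
  R + (∑ (λ u → w (suc u) zero) + ∑ (λ u → ∑ (λ j → w (suc u) (suc (punchIn u j)))))
    ≡⟨ cong (R +_) (cong₂ _+_ (∑-cong (λ u → s (suc u) zero)) (handshake (λ i j → w (suc i) (suc j)) (λ i j → s (suc i) (suc j)))) ⟩
  R + (R + 2 * E) ≡⟨ double R E ⟩
  2 * (R + E) ∎
  where
  open ≡-Reasoning
  R E : ℕ
  R = ∑ (λ j → w zero (suc j))
  E = ΣPairs (suc n) (λ i j → w (suc i) (suc j))
  double : ∀ R E → R + (R + 2 * E) ≡ 2 * (R + E)
  double = solve-∀

-- Each deletion splits the total into the degree of `u` and a part that is at most `B`. The degrees
-- sum to twice the total, so every pair survives in all but two deletions.
averaging : ∀ {n} (w : Fin (suc (suc n)) → Fin (suc (suc n)) → ℕ) → Symmetric w → ∀ B →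
  (∀ u → ΣPairs (suc n) (λ i j → w (punchIn u i) (punchIn u j)) ≤ B) →
  n * ΣPairs (suc (suc n)) w ≤ suc (suc n) * B
averaging {n} w s B h = +-cancelˡ-≤ (2 * E) _ _ (begin
  2 * E + n * E                  ≡⟨ *-distribʳ-+ E 2 n ⟨
  suc (suc n) * E                ≡⟨ ∑-const (suc (suc n)) E ⟨
  ∑ {suc (suc n)} (λ _ → E)      ≤⟨ ∑-mono (λ u → ≤-trans (≤-reflexive (ΣPairs-punchIn w s u)) (+-monoʳ-≤ (deg u) (h u))) ⟩
  ∑ (λ u → deg u + B)            ≡⟨ ∑-+ deg (λ _ → B) ⟩
  ∑ deg + ∑ {suc (suc n)} (λ _ → B) ≡⟨ cong₂ _+_ (handshake w s) (∑-const (suc (suc n)) B) ⟩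
  2 * E + suc (suc n) * B        ∎)
  where
  open ≤-Reasoning
  E : ℕ
  E = ΣPairs (suc (suc n)) w
  deg : Fin (suc (suc n)) → ℕ
  deg u = ∑ (λ j → w u (punchIn u j))

-- Sparse multigraphs and dense tuples

-- Injections replace subsets: the condition restricts to a subgraph by composition, and a violating
-- set comes already enumerated.
Sparse : ∀ s q → Multigraph n → Set
Sparse {n} s q w = (x : Fin s → Fin n) → Inj x → ΣPairs s (λ i j → w (x i) (x j)) ≤ q

Sparse-∘ : ∀ {s q} {w : Multigraph n} (e : Fin k → Fin n) → Inj e → Sparse s q w → Sparse s q (λ i j → w (e i) (e j))
Sparse-∘ e e-inj c x x-inj = c (e ∘ x) (x-inj ∘ e-inj)

anyVec? : ∀ s {P : Vec (Fin n) s → Set} → (∀ v → Dec (P v)) → Dec (∃ P)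
anyVec? zero    P? = Dec.map′ (λ h → [] , h) (λ { ([] , h) → h }) (P? [])
anyVec? (suc s) P? = Dec.map′ (λ { (x , v , h) → x ∷ v , h }) (λ { (x ∷ v , h) → x , v , h })
  (any? (λ x → anyVec? s (λ v → P? (x ∷ v))))

inj? : (x : Fin k → Fin n) → Dec (∀ i j → x i ≡ x j → i ≡ j)
inj? x = all? (λ i → all? (λ j → (x i ≟ᶠ x j) Dec.→-dec (i ≟ᶠ j)))

-- The case distinction is made by searching all `s`-tuples, represented by vectors so that they can
-- be enumerated.
dense⊎Sparse : ∀ s q (w : Multigraph n) →
  (∃ λ (x : Fin s → Fin n) → Inj x × q < ΣPairs s (λ i j → w (x i) (x j))) ⊎ Sparse s q w
dense⊎Sparse s q w with anyVec? s (λ v → inj? (lookup v) Dec.×-dec (q <? ΣPairs s (λ i j → w (lookup v i) (lookup v j))))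
... | yes (v , inj , h) = inj₁ (lookup v , inj _ _ , h)
... | no none = inj₂ λ x x-inj → ≮⇒≥ λ h → none
  (Vec.tabulate x
  , (λ i j eq → x-inj (trans (sym (lookup∘tabulate x i)) (trans eq (lookup∘tabulate x j))))
  , subst (q <_) (ΣPairs-cong (λ i j → sym (cong₂ w (lookup∘tabulate x i) (lookup∘tabulate x j)))) h)

tri : ℕ → ℕ
tri zero    = 0
tri (suc k) = k + tri k

argmax : (f : ℕ → ℕ) → ∀ n → ∃ λ k → k ≤ n × (∀ j → j ≤ n → f j ≤ f k)
argmax f zero = 0 , z≤n , λ { zero _ → ≤-refl }
argmax f (suc n) with argmax f n
... | k , k≤n , max with f (suc n) ≤? f k
...   | yes le = k , m≤n⇒m≤1+n k≤n , λ j j≤ → case j≤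
  where
  case : ∀ {j} → j ≤ suc n → f j ≤ f k
  case {j} j≤ with m≤n⇒m<n∨m≡n j≤
  ... | inj₁ j<  = max j (s≤s⁻¹ j<)
  ... | inj₂ refl = le
...   | no nle = suc n , ≤-refl , λ j j≤ → case j≤
  where
  case : ∀ {j} → j ≤ suc n → f j ≤ f (suc n)
  case {j} j≤ with m≤n⇒m<n∨m≡n j≤
  ... | inj₁ j<  = ≤-trans (max j (s≤s⁻¹ j<)) (<⇒≤ (≰⇒> nle))
  ... | inj₂ refl = ≤-refl

-- Labelled graphs

⟦_⟧ : Bool → ℕ
⟦ true ⟧  = 1
⟦ false ⟧ = 0

# : (Fin n → Bool) → ℕ
# f = ∑ (λ i → ⟦ f i ⟧)

#-cover : (f g h : Fin n → Bool) → (∀ i → h i ≡ true → f i ≡ true ⊎ g i ≡ true) → # h ≤ # f + # g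
#-cover f g h cover = ≤-trans (∑-mono step) (≤-reflexive (∑-+ (⟦_⟧ ∘ f) (⟦_⟧ ∘ g)))
  where
  step : ∀ i → ⟦ h i ⟧ ≤ ⟦ f i ⟧ + ⟦ g i ⟧
  step i with h i | f i | g i | cover i
  ... | false | _     | _     | _ = z≤n
  ... | true  | true  | _     | _ = s≤s z≤n
  ... | true  | false | true  | _ = s≤s z≤n
  ... | true  | false | false | c with c refl
  ...   | inj₁ ()
  ...   | inj₂ ()

#-disjoint : (f g h : Fin n → Bool) → (∀ i → f i ≡ true → h i ≡ true) → (∀ i → g i ≡ true → h i ≡ true) →
  (∀ i → f i ≡ true → g i ≢ true) → # f + # g ≤ # h
#-disjoint f g h f⇒h g⇒h disj = ≤-trans (≤-reflexive (sym (∑-+ (⟦_⟧ ∘ f) (⟦_⟧ ∘ g)))) (∑-mono step)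
  where
  step : ∀ i → ⟦ f i ⟧ + ⟦ g i ⟧ ≤ ⟦ h i ⟧
  step i with f i | g i | h i | f⇒h i | g⇒h i | disj i
  ... | false | false | _     | _ | _ | _ = z≤n
  ... | true  | true  | _     | _ | _ | d = contradiction refl (d refl)
  ... | true  | false | true  | _ | _ | _ = ≤-refl
  ... | false | true  | true  | _ | _ | _ = ≤-refl
  ... | true  | false | false | i₁ | _ | _ with () ← i₁ refl
  ... | false | true  | false | _ | i₂ | _ with () ← i₂ refl

#-all : ∀ n → # {n} (λ _ → true) ≡ n
#-all n = trans (∑-const n 1) (*-identityʳ n)

#-pos : (f : Fin n → Bool) → ∀ i → f i ≡ true → 1 ≤ # f
#-pos f zero    eq rewrite eq = s≤s z≤n
#-pos f (suc i) eq = ≤-trans (#-pos (f ∘ suc) i eq) (m≤n+m _ _)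

#-zero : (f : Fin n → Bool) → (∀ i → f i ≢ true) → # f ≡ 0
#-zero {n} f none = trans (∑-cong empty) (trans (∑-const n 0) (*-zeroʳ n))
  where
  empty : ∀ i → ⟦ f i ⟧ ≡ 0
  empty i with f i | none i
  ... | true  | f≢ = contradiction refl f≢
  ... | false | _  = refl

data Label : Set where
  neg nul pos : Label

isNeg isNul isPos : Label → Bool
isNeg neg = true
isNeg _   = false
isNul nul = true
isNul _   = false
isPos pos = true
isPos _   = false

isPos⇒ : ∀ {L} → isPos L ≡ true → L ≡ pos
isPos⇒ {pos} _ = refl

_≟ᴸ_ : (L L′ : Label) → Dec (L ≡ L′)
neg ≟ᴸ neg = yes refl
neg ≟ᴸ nul = no λ ()
neg ≟ᴸ pos = no λ ()
nul ≟ᴸ neg = no λ ()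
nul ≟ᴸ nul = yes refl
nul ≟ᴸ pos = no λ ()
pos ≟ᴸ neg = no λ ()
pos ≟ᴸ nul = no λ ()
pos ≟ᴸ pos = yes refl

neg? : (L : Label) → Dec (L ≡ neg)
neg? = _≟ᴸ neg

Labelling : ℕ → Set
Labelling n = Fin n → Fin n → Label

#neg #nul #pos : Labelling n → Fin n → ℕ
#neg ℓ v = # (isNeg ∘ ℓ v)
#nul ℓ v = # (isNul ∘ ℓ v)
#pos ℓ v = # (isPos ∘ ℓ v)

#-labels : (g : Fin n → Label) → # (isPos ∘ g) + # (isNeg ∘ g) + # (isNul ∘ g) ≡ n
#-labels {n} g = begin
  # (isPos ∘ g) + # (isNeg ∘ g) + # (isNul ∘ g) ≡⟨ cong (_+ # (isNul ∘ g)) (∑-+ _ (⟦_⟧ ∘ isNeg ∘ g)) ⟨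
  ∑ (λ i → ⟦ isPos (g i) ⟧ + ⟦ isNeg (g i) ⟧) + # (isNul ∘ g) ≡⟨ ∑-+ _ (⟦_⟧ ∘ isNul ∘ g) ⟨
  ∑ (λ i → ⟦ isPos (g i) ⟧ + ⟦ isNeg (g i) ⟧ + ⟦ isNul (g i) ⟧) ≡⟨ ∑-cong (λ i → one (g i)) ⟩
  ∑ {n} (λ _ → 1) ≡⟨ #-all n ⟩
  n ∎
  where
  open ≡-Reasoning
  one : ∀ L → ⟦ isPos L ⟧ + ⟦ isNeg L ⟧ + ⟦ isNul L ⟧ ≡ 1
  one neg = refl
  one nul = refl
  one pos = refl

-- The labels neg, nul, pos stand for the weights a - 1, a, a + 1.  Labelling
-- the diagonal neg makes the four conditions stable under arbitrary pullbacks.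
record Admissible (ℓ : Labelling n) : Set where
  field
    symmetric : Symmetric ℓ
    diagonal  : ∀ i → ℓ i i ≡ neg
    triangle  : ∀ x y z → ℓ x y ≡ pos → ℓ y z ≡ pos → ℓ x z ≢ pos
    square    : ∀ v x y z → ℓ v y ≡ pos → ℓ v z ≡ pos → ℓ x y ≡ pos → ℓ x z ≡ pos → ℓ v x ≢ neg → ℓ y z ≡ neg

Transitive : Labelling n → Set
Transitive ℓ = ∀ u v x → ℓ u v ≡ neg → ℓ v x ≡ neg → ℓ u x ≡ neg

pullback : ∀ {k} {ℓ : Labelling n} (π : Fin k → Fin n) → Admissible ℓ → Admissible (λ x y → ℓ (π x) (π y))
pullback π adm = record
  { symmetric = λ i j → symmetric (π i) (π j)
  ; diagonal  = λ i → diagonal (π i)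
  ; triangle  = λ x y z → triangle (π x) (π y) (π z)
  ; square    = λ v x y z → square (π v) (π x) (π y) (π z)
  }
  where open Admissible adm

redirect : Fin n → Fin n → Fin n → Fin n
redirect u v x = if does (x ≟ᶠ u) then v else x

redirect-≡ : (u v : Fin n) → redirect u v u ≡ v
redirect-≡ u v with u ≟ᶠ u
... | yes _  = refl
... | no u≢u = contradiction refl u≢u

redirect-≢ : (u v x : Fin n) → x ≢ u → redirect u v x ≡ x
redirect-≢ u v x x≢u with x ≟ᶠ u
... | yes x≡u = contradiction x≡u x≢u
... | no _    = refl

-- Counting second neighbourhoods

module Packing {n} (ℓ : Labelling n) (adm : Admissible ℓ) (m c : ℕ)
  (#neg≤ : ∀ u → #neg ℓ u ≤ c) (#pos≥ : ∀ u → m + #neg ℓ u ≤ #pos ℓ u) (v : Fin n) where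

  open Admissible adm

  -- The greedily chosen vertices of Y, d in number, are pairwise joined by nul,
  -- so their pos-neighbourhoods are disjoint outside the neg-class of v.
  greedy : ∀ k (Y : Fin n → Bool) → # Y ≤ k → (∀ y → Y y ≡ true → ℓ v y ≡ pos) →
    ∃₂ λ d (U : Fin n → Bool) → # Y ≤ d * c × # Y + d * m ≤ # U + d * c ×
      (∀ x → U x ≡ true → ℓ v x ≢ neg × ∃ λ y → Y y ≡ true × ℓ y x ≡ pos)
  greedy k Y Y≤k Y⇒pos with any? (λ y → Y y ≟ᵇ true)
  ... | no none = 0 , (λ _ → false) , ≤-reflexive (#-zero Y (λ y eq → none (y , eq))) ,
    ≤-trans (≤-reflexive (trans (+-identityʳ _) (#-zero Y (λ y eq → none (y , eq))))) z≤n , λ _ ()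
  greedy zero Y Y≤k Y⇒pos | yes (y , Yy) = contradiction (≤-trans (#-pos Y y Yy) Y≤k) λ ()
  greedy (suc k) Y Y≤k Y⇒pos | yes (y , Yy) = extend′ (greedy k Y′ (s≤s⁻¹ (≤-trans smaller Y≤k)) (λ x eq → Y⇒pos x (Y′⇒Y x eq)))
    where
    Y′ N : Fin n → Bool
    Y′ x = Y x ∧ not (isNeg (ℓ y x))
    N x = isPos (ℓ y x) ∧ not (isNeg (ℓ v x))
    ∧-true : ∀ s t → s ∧ t ≡ true → s ≡ true × t ≡ true
    ∧-true true true _ = refl , refl
    not-neg : ∀ L → not (isNeg L) ≡ true → L ≢ neg
    not-neg nul _ ()
    not-neg pos _ ()
    Y′⇒Y : ∀ x → Y′ x ≡ true → Y x ≡ true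
    Y′⇒Y x eq = proj₁ (∧-true (Y x) _ eq)
    -- The diagonal label `neg` removes `y` itself from `Y′`, which is what consumes the fuel `k`.
    smaller : suc (# Y′) ≤ # Y
    smaller = ≤-trans (+-monoˡ-≤ (# Y′) (#-pos (λ x → does (x ≟ᶠ y)) y (Dec.dec-true (y ≟ᶠ y) refl)))
      (#-disjoint (λ x → does (x ≟ᶠ y)) Y′ Y only-y Y′⇒Y λ x x≡y Y′x →
        not-neg _ (proj₂ (∧-true (Y x) _ Y′x)) (subst (λ z → ℓ y z ≡ neg) (sym (is-y x x≡y)) (diagonal y)))
      where
      is-y : ∀ x → does (x ≟ᶠ y) ≡ true → x ≡ y
      is-y x eq with x ≟ᶠ y
      ... | yes x≡y = x≡y
      only-y : ∀ x → does (x ≟ᶠ y) ≡ true → Y x ≡ true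
      only-y x eq = subst (λ z → Y z ≡ true) (sym (is-y x eq)) Yy
    Y≤ : # Y ≤ # Y′ + #neg ℓ y
    Y≤ = #-cover Y′ (isNeg ∘ ℓ y) Y split
      where
      split : ∀ x → Y x ≡ true → Y′ x ≡ true ⊎ isNeg (ℓ y x) ≡ true
      split x eq rewrite eq with isNeg (ℓ y x)
      ... | true  = inj₂ refl
      ... | false = inj₁ refl
    pos≤ : #pos ℓ y ≤ # N + #neg ℓ v
    pos≤ = #-cover N (isNeg ∘ ℓ v) (isPos ∘ ℓ y) split
      where
      split : ∀ x → isPos (ℓ y x) ≡ true → N x ≡ true ⊎ isNeg (ℓ v x) ≡ true
      split x eq rewrite eq with isNeg (ℓ v x)
      ... | true  = inj₂ refl
      ... | false = inj₁ refl
    extend′ : (∃₂ λ d (U : Fin n → Bool) → # Y′ ≤ d * c × # Y′ + d * m ≤ # U + d * c ×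
        (∀ x → U x ≡ true → ℓ v x ≢ neg × ∃ λ y → Y′ y ≡ true × ℓ y x ≡ pos)) →
      ∃₂ λ d (U : Fin n → Bool) → # Y ≤ d * c × # Y + d * m ≤ # U + d * c ×
        (∀ x → U x ≡ true → ℓ v x ≢ neg × ∃ λ y → Y y ≡ true × ℓ y x ≡ pos)
    extend′ (d , U , h₁ , h₂ , h₃) = suc d , U′ , bound₁ , bound₂ , bound₃
      where
      U′ : Fin n → Bool
      U′ x = U x ∨ N x
      bound₁ : # Y ≤ suc d * c
      bound₁ = ≤-trans Y≤ (≤-trans (+-mono-≤ h₁ (#neg≤ y)) (≤-reflexive (+-comm (d * c) c)))
      -- A common pos-neighbour `x` of `y` and `y′` forms with `v` a 4-cycle of pos pairs whose
      -- diagonal `v x` is not neg. Then `square` makes `y y′` neg, but the neg-class of `y` was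
      -- deleted from `Y`.
      disjoint : ∀ x → U x ≡ true → N x ≢ true
      disjoint x Ux Nx with h₃ x Ux
      ... | vx≢neg , y′ , Y′y′ , y′x = not-neg (ℓ y y′) (proj₂ (∧-true (Y y′) _ Y′y′))
        (square v x y y′ (Y⇒pos y Yy) (Y⇒pos y′ (Y′⇒Y y′ Y′y′))
          (trans (symmetric x y) (isPos⇒ (proj₁ (∧-true (isPos (ℓ y x)) _ Nx)))) (trans (symmetric x y′) y′x) vx≢neg)
      U+N : # U + # N ≤ # U′
      U+N = #-disjoint U N U′ (λ x eq → cong (_∨ N x) eq) (λ x eq → trans (cong (U x ∨_) eq) (∨-zeroʳ (U x))) disjoint
      bound₂ : # Y + suc d * m ≤ # U′ + suc d * c
      bound₂ = begin
        # Y + (m + d * m)                     ≤⟨ +-monoˡ-≤ _ Y≤ ⟩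
        # Y′ + #neg ℓ y + (m + d * m)         ≡⟨ eq₁ (# Y′) (#neg ℓ y) m (d * m) ⟩
        (# Y′ + d * m) + (m + #neg ℓ y)       ≤⟨ +-mono-≤ h₂ (≤-trans (#pos≥ y) (≤-trans pos≤ (+-monoʳ-≤ (# N) (#neg≤ v)))) ⟩
        (# U + d * c) + (# N + c)             ≡⟨ eq₂ (# U) (d * c) (# N) c ⟩
        (# U + # N) + (c + d * c)             ≤⟨ +-monoˡ-≤ _ U+N ⟩
        # U′ + (c + d * c)                    ∎
        where
        open ≤-Reasoning
        eq₁ : ∀ x y z t → x + y + (z + t) ≡ (x + t) + (z + y)
        eq₁ = solve-∀
        eq₂ : ∀ x y z t → (x + y) + (z + t) ≡ (x + z) + (t + y)
        eq₂ = solve-∀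
      bound₃ : ∀ x → U′ x ≡ true → ℓ v x ≢ neg × ∃ λ y → Y y ≡ true × ℓ y x ≡ pos
      bound₃ x eq with U x in Ux | eq
      ... | true  | _  = let vx , y′ , Y′y′ , y′x = h₃ x Ux in vx , y′ , Y′⇒Y y′ Y′y′ , y′x
      ... | false | Nx = not-neg (ℓ v x) (proj₂ (∧-true _ _ Nx)) , y , Yy , isPos⇒ (proj₁ (∧-true (isPos (ℓ y x)) _ Nx))

  -- `U` consists of second neighbours of `v`: by `triangle` it avoids the pos-neighbours of `v`,
  -- and by construction its neg-class. The three disjoint sets fit into `n` vertices.
  packing : ∃ λ d → #pos ℓ v ≤ d * c × #neg ℓ v + 2 * #pos ℓ v + d * m ≤ n + d * c
  packing with greedy (#pos ℓ v) (isPos ∘ ℓ v) ≤-refl (λ y → isPos⇒)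
  ... | d , U , h₁ , h₂ , h₃ = d , h₁ , (begin
    #neg ℓ v + 2 * N + d * m      ≡⟨ eq₁ (#neg ℓ v) N (d * m) ⟩
    (#neg ℓ v + N) + (N + d * m)  ≤⟨ +-monoʳ-≤ (#neg ℓ v + N) h₂ ⟩
    (#neg ℓ v + N) + (# U + d * c) ≡⟨ +-assoc (#neg ℓ v + N) (# U) _ ⟨
    (#neg ℓ v + N + # U) + d * c  ≤⟨ +-monoˡ-≤ (d * c) all ⟩
    n + d * c                     ∎)
    where
    open ≤-Reasoning
    N : ℕ
    N = #pos ℓ v
    eq₁ : ∀ x y z → x + 2 * y + z ≡ (x + y) + (y + z)
    eq₁ = solve-∀
    V : Fin n → Bool
    V x = isNeg (ℓ v x) ∨ isPos (ℓ v x)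
    V⇒ : ∀ x → V x ≡ true → ℓ v x ≡ neg ⊎ ℓ v x ≡ pos
    V⇒ x eq with ℓ v x
    ... | neg = inj₁ refl
    ... | pos = inj₂ refl
    disjoint : ∀ x → V x ≡ true → U x ≢ true
    disjoint x Vx Ux with V⇒ x Vx | h₃ x Ux
    ... | inj₁ vx | vx≢ , _ = vx≢ vx
    ... | inj₂ vx | _ , y , vy , yx = triangle v y x (isPos⇒ vy) yx vx
    neg+pos : #neg ℓ v + N ≤ # V
    neg+pos = #-disjoint (isNeg ∘ ℓ v) (isPos ∘ ℓ v) V (λ x → left (ℓ v x)) (λ x → right (ℓ v x)) (λ x → both (ℓ v x))
      where
      left : ∀ L → isNeg L ≡ true → isNeg L ∨ isPos L ≡ true
      left neg _ = refl
      right : ∀ L → isPos L ≡ true → isNeg L ∨ isPos L ≡ true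
      right pos _ = refl
      both : ∀ L → isNeg L ≡ true → isPos L ≢ true
      both neg _ ()
    all : #neg ℓ v + N + # U ≤ n
    all = ≤-trans (+-monoˡ-≤ (# U) neg+pos) (≤-trans (#-disjoint V U (λ _ → true) (λ _ _ → refl) (λ _ _ → refl) disjoint) (≤-reflexive (#-all n)))

_◂_ : ∀ {k} → Fin n → (Fin k → Fin n) → Fin (suc k) → Fin n
(x ◂ f) zero    = x
(x ◂ f) (suc i) = f i

infixr 5 _◂_

◂-injective : ∀ {k} {x : Fin n} {f : Fin k → Fin n} → (∀ i → x ≢ f i) → Inj f → Inj (x ◂ f)
◂-injective x∉ f-inj {zero}  {zero}  _  = refl
◂-injective x∉ f-inj {zero}  {suc j} eq = contradiction eq (x∉ j)
◂-injective x∉ f-inj {suc i} {zero}  eq = contradiction (sym eq) (x∉ i)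
◂-injective x∉ f-inj {suc i} {suc j} eq = cong suc (f-inj eq)

⟨⟩ : Fin 0 → Fin n
⟨⟩ ()

⟨⟩-injective : Inj (⟨⟩ {n})
⟨⟩-injective {_} {()}

maximal : (f : Fin (suc n) → ℕ) → ∃ λ v → ∀ u → f u ≤ f v
maximal {zero} f = zero , λ { zero → ≤-refl }
maximal {suc n} f with maximal (f ∘ suc)
... | v , max with f zero ≤? f (suc v)
...   | yes le = suc v , λ { zero → le ; (suc u) → max u }
...   | no nle = zero , λ { zero → ≤-refl ; (suc u) → ≤-trans (max u) (<⇒≤ (≰⇒> nle)) }

-- Fewer than two chosen vertices contradict m + c ≤ N ≤ d c. With d = 2 this forces m = c, and then
-- c + 2 N ≤ n gives 5 m ≤ n. With d ≥ 3 the term d (m - c) is at least 3 (m - c), and c + 2 (m + c)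
-- + 3 (m - c) = 5 m.
packing-arithmetic : ∀ d c m N n → 1 ≤ m → c ≤ m → m + c ≤ N → N ≤ d * c → c + 2 * N + d * m ≤ n + d * c → 5 * m ≤ n
packing-arithmetic zero c m N n 1≤m c≤m N≥ N≤ h = contradiction (≤-trans 1≤m (≤-trans (m≤m+n m c) (≤-trans N≥ N≤))) λ ()
packing-arithmetic (suc zero) c m N n 1≤m c≤m N≥ N≤ h =
  contradiction (≤-trans (+-monoˡ-≤ c 1≤m) (≤-trans N≥ (≤-trans N≤ (≤-reflexive (+-identityʳ c))))) (<-irrefl refl)
packing-arithmetic (suc (suc zero)) c m N n 1≤m c≤m N≥ N≤ h
  with refl ← ≤-antisym c≤m (+-cancelʳ-≤ c m c (≤-trans N≥ (≤-trans N≤ (≤-reflexive (cong (c +_) (+-identityʳ c)))))) =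
  +-cancelʳ-≤ (2 * c) (5 * c) n (≤-trans (≤-reflexive (eq c)) (≤-trans (+-monoˡ-≤ (2 * c) (+-monoʳ-≤ c (*-monoʳ-≤ 2 N≥))) h))
  where
  eq : ∀ c → 5 * c + 2 * c ≡ c + 2 * (c + c) + 2 * c
  eq = solve-∀
packing-arithmetic (suc (suc (suc d))) c m N n 1≤m c≤m N≥ N≤ h =
  +-cancelʳ-≤ (3 * c + d * m) (5 * m) n (begin
    5 * m + (3 * c + d * m)                 ≡⟨ eq c m (d * m) ⟩
    c + 2 * (m + c) + (m + (m + (m + d * m))) ≤⟨ +-monoˡ-≤ _ (+-monoʳ-≤ c (*-monoʳ-≤ 2 N≥)) ⟩
    c + 2 * N + (m + (m + (m + d * m)))     ≤⟨ h ⟩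
    n + (c + (c + (c + d * c)))             ≤⟨ +-monoʳ-≤ n (≤-trans (≤-reflexive (eq′ c (d * c))) (+-monoʳ-≤ (3 * c) (*-monoʳ-≤ d c≤m))) ⟩
    n + (3 * c + d * m)                     ∎)
  where
  open ≤-Reasoning
  eq : ∀ c m x → 5 * m + (3 * c + x) ≡ c + 2 * (m + c) + (m + (m + (m + x)))
  eq = solve-∀
  eq′ : ∀ c x → c + (c + (c + x)) ≡ 3 * c + x
  eq′ = solve-∀

allLabels? : {Q : Label → Set} → (∀ L → Dec (Q L)) → Dec (∀ L → Q L)
allLabels? Q? = Dec.map′ (λ { (x , y , z) neg → x ; (x , y , z) nul → y ; (x , y , z) pos → z })
  (λ h → h neg , h nul , h pos) (Q? neg Dec.×-dec (Q? nul Dec.×-dec Q? pos))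

rank : Label → ℕ
rank neg = 0
rank nul = 1
rank pos = 2

Triangle : Label → Label → Label → Set
Triangle L₁ L₂ L₃ = ¬ (L₁ ≡ pos × L₂ ≡ pos × L₃ ≡ pos)

-- The first four arguments are the sides of a 4-cycle and the last two its diagonals.
Square : (L₁ L₂ L₃ L₄ D D′ : Label) → Set
Square L₁ L₂ L₃ L₄ D D′ = ¬ (L₁ ≡ pos × L₂ ≡ pos × L₃ ≡ pos × L₄ ≡ pos × D ≢ neg × D′ ≢ neg)

triangle? : ∀ L₁ L₂ L₃ → Dec (Triangle L₁ L₂ L₃)
triangle? L₁ L₂ L₃ = Dec.¬? ((L₁ ≟ᴸ pos) Dec.×-dec ((L₂ ≟ᴸ pos) Dec.×-dec (L₃ ≟ᴸ pos)))

square? : ∀ L₁ L₂ L₃ L₄ D D′ → Dec (Square L₁ L₂ L₃ L₄ D D′)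
square? L₁ L₂ L₃ L₄ D D′ = Dec.¬? ((L₁ ≟ᴸ pos) Dec.×-dec ((L₂ ≟ᴸ pos) Dec.×-dec ((L₃ ≟ᴸ pos) Dec.×-dec ((L₄ ≟ᴸ pos)
  Dec.×-dec (Dec.¬? (D ≟ᴸ neg) Dec.×-dec Dec.¬? (D′ ≟ᴸ neg))))))

-- b, c, d, e, f, g are the labels of the pairs 01, 02, 03, 12, 13, 23.
rank-sum : ∀ b c d e f g → Triangle b c e → Triangle b d f → Triangle c d g → Triangle e f g →
  Square b d e g c f → Square b c f g d e → Square c d e f b g →
  rank b + rank c + rank d + rank e + rank f + rank g ≤ 9
rank-sum = Dec.from-yes (allLabels? λ b → allLabels? λ c → allLabels? λ d → allLabels? λ e → allLabels? λ f → allLabels? λ g →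
  triangle? b c e Dec.→-dec (triangle? b d f Dec.→-dec (triangle? c d g Dec.→-dec (triangle? e f g Dec.→-dec
  (square? b d e g c f Dec.→-dec (square? b c f g d e Dec.→-dec (square? c d e f b g Dec.→-dec
  (rank b + rank c + rank d + rank e + rank f + rank g ≤? 9))))))))

-- Two-colourings, and sums over vertex subsets

is0 is1 : Fin 2 → Bool
is0 0F = true
is0 1F = false
is1 0F = false
is1 1F = true

zeros ones : (Fin n → Fin 2) → ℕ
zeros c = # (is0 ∘ c)
ones c = # (is1 ∘ c)

zeros+ones : (c : Fin n → Fin 2) → zeros c + ones c ≡ n
zeros+ones {n} c = trans (sym (∑-+ (⟦_⟧ ∘ is0 ∘ c) (⟦_⟧ ∘ is1 ∘ c))) (trans (∑-cong (λ i → one (c i))) (#-all n))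
  where
  one : ∀ i → ⟦ is0 i ⟧ + ⟦ is1 i ⟧ ≡ 1
  one 0F = refl
  one 1F = refl

indicator-punchIn : ∀ {s} (χ : Fin (suc n) → Bool) (x : Fin (suc s) → Fin (suc n)) → Inj x →
  (∀ k → χ (x k) ≡ true) → (∀ i → χ i ≡ true → ∃ λ k → i ≡ x k) →
  ∃ λ (x′ : Fin s → Fin n) → Inj x′ × (∀ k → punchIn (x zero) (x′ k) ≡ x (suc k)) ×
    (∀ k → χ (punchIn (x zero) (x′ k)) ≡ true) × (∀ i → χ (punchIn (x zero) i) ≡ true → ∃ λ k → i ≡ x′ k)
indicator-punchIn χ x x-inj χx χ⇒ = x′ , x′-inj , agree , (λ k → trans (cong χ (agree k)) (χx (suc k))) , onto
  where
  apart : ∀ k → x zero ≢ x (suc k)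
  apart k eq with () ← x-inj eq
  x′ = λ k → punchOut (apart k)
  x′-inj : Inj x′
  x′-inj {i} {j} eq = Fin.suc-injective (x-inj (punchOut-injective (apart i) (apart j) eq))
  agree : ∀ k → punchIn (x zero) (x′ k) ≡ x (suc k)
  agree k = punchIn-punchOut (apart k)
  onto : ∀ i → χ (punchIn (x zero) i) ≡ true → ∃ λ k → i ≡ x′ k
  onto i χi with χ⇒ (punchIn (x zero) i) χi
  ... | zero  , eq = contradiction eq (punchInᵢ≢i (x zero) i)
  ... | suc k , eq = k , punchIn-injective (x zero) i (x′ k) (trans eq (sym (agree k)))

∑-indicator : ∀ s (χ : Fin n → Bool) (x : Fin s → Fin n) → Inj x →
  (∀ k → χ (x k) ≡ true) → (∀ i → χ i ≡ true → ∃ λ k → i ≡ x k) →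
  ∀ f → ∑ (λ i → if χ i then f i else 0) ≡ ∑ (f ∘ x)
∑-indicator {n} zero χ x _ _ χ⇒ f = trans (∑-cong empty) (trans (∑-const n 0) (*-zeroʳ n))
  where
  empty : ∀ i → (if χ i then f i else 0) ≡ 0
  empty i with χ i | χ⇒ i
  ... | false | _ = refl
  ... | true  | none with () ← proj₁ (none refl)
∑-indicator {zero} (suc s) χ x _ _ _ f with () ← x zero
∑-indicator {suc n} (suc s) χ x x-inj χx χ⇒ f with indicator-punchIn χ x x-inj χx χ⇒
... | x′ , x′-inj , agree , χx′ , χ⇒′ = trans (∑-punchIn (x zero) (λ i → if χ i then f i else 0))
  (cong₂ _+_ (cong (if_then f (x zero) else 0) (χx zero))
    (trans (∑-indicator s (χ ∘ punchIn (x zero)) x′ x′-inj χx′ χ⇒′ (f ∘ punchIn (x zero))) (∑-cong (λ k → cong f (agree k)))))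

-- The recursion deletes `x zero` whenever `x` is non-empty, so `x` need not be increasing; symmetry
-- of `w` absorbs the change of order.
ΣPairs-indicator : ∀ s (χ : Fin n → Bool) (x : Fin s → Fin n) → Inj x →
  (∀ k → χ (x k) ≡ true) → (∀ i → χ i ≡ true → ∃ λ k → i ≡ x k) →
  ∀ w → Symmetric w → ΣPairs n (λ i j → if χ i ∧ χ j then w i j else 0) ≡ ΣPairs s (λ i j → w (x i) (x j))
ΣPairs-indicator {zero}  zero    χ x _ _ _ w sym′ = refl
ΣPairs-indicator {zero}  (suc s) χ x _ _ _ w sym′ with () ← x zero
ΣPairs-indicator {suc n} zero    χ x x-inj χx χ⇒ w sym′ = cong₂ _+_
  (trans (∑-cong (λ j → cong (λ b → if b ∧ χ (suc j) then w zero (suc j) else 0) (never zero))) (trans (∑-const n 0) (*-zeroʳ n)))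
  (ΣPairs-indicator {n} zero (χ ∘ suc) (λ ()) (λ { {()} }) (λ ()) (λ i χi → contradiction (trans (sym χi) (never (suc i))) λ ()) (λ i j → w (suc i) (suc j)) (λ i j → sym′ (suc i) (suc j)))
  where
  never : ∀ i → χ i ≡ false
  never i with χ i | χ⇒ i
  ... | false | _ = refl
  ... | true  | none with () ← proj₁ (none refl)
ΣPairs-indicator {suc n} (suc s) χ x x-inj χx χ⇒ w sym′ with indicator-punchIn χ x x-inj χx χ⇒
... | x′ , x′-inj , agree , χx′ , χ⇒′ = trans (ΣPairs-punchIn (λ i j → if χ i ∧ χ j then w i j else 0) symmetric′ u)
  (cong₂ _+_
    (trans (∑-cong (λ j → cong (λ b → if b ∧ χ (punchIn u j) then w u (punchIn u j) else 0) (χx zero)))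
      (trans (∑-indicator s (χ ∘ punchIn u) x′ x′-inj χx′ χ⇒′ (λ j → w u (punchIn u j))) (∑-cong (λ k → cong (w u) (agree k)))))
    (trans (ΣPairs-indicator s (χ ∘ punchIn u) x′ x′-inj χx′ χ⇒′ (λ i j → w (punchIn u i) (punchIn u j)) (λ i j → sym′ _ _))
      (ΣPairs-cong (λ i j → cong₂ w (agree i) (agree j)))))
  where
  u : Fin (suc n)
  u = x zero
  symmetric′ : Symmetric (λ i j → if χ i ∧ χ j then w i j else 0)
  symmetric′ i j with χ i | χ j
  ... | true  | true  = sym′ i j
  ... | true  | false = refl
  ... | false | true  = refl
  ... | false | false = refl

does-∈?-tabulate : (χ : Fin n → Bool) → ∀ i → does (i ∈? Vec.tabulate χ) ≡ χ i
does-∈?-tabulate χ zero with χ zero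
... | true  = refl
... | false = refl
does-∈?-tabulate χ (suc i) = does-∈?-tabulate (χ ∘ suc) i

∣tabulate∣ : (χ : Fin n → Bool) → ∣ Vec.tabulate χ ∣ ≡ # χ
∣tabulate∣ {zero}  χ = refl
∣tabulate∣ {suc n} χ with χ zero
... | true  = cong suc (∣tabulate∣ (χ ∘ suc))
... | false = ∣tabulate∣ (χ ∘ suc)

-- Only entries with i < j carry meaning in a `Multigraph`, whereas deleting and relabelling
-- vertices reads both orders.
symmetrisation : Multigraph n → Multigraph n
symmetrisation w i j = if does (i <ᶠ? j) then w i j else w j i

symmetrisation-< : (w : Multigraph n) → ∀ i j → i <ᶠ j → symmetrisation w i j ≡ w i j
symmetrisation-< w i j i<j = cong (if_then w i j else w j i) (Dec.dec-true (i <ᶠ? j) i<j)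

symmetrisation-≮ : (w : Multigraph n) → ∀ i j → ¬ (i <ᶠ j) → symmetrisation w i j ≡ w j i
symmetrisation-≮ w i j i≮j = cong (if_then w i j else w j i) (Dec.dec-false (i <ᶠ? j) i≮j)

symmetrisation-symmetric : (w : Multigraph n) → Symmetric (symmetrisation w)
symmetrisation-symmetric w i j with Fin.<-cmp i j
... | tri< i<j _ j≮i  = trans (symmetrisation-< w i j i<j) (sym (symmetrisation-≮ w j i j≮i))
... | tri≈ _ refl _   = refl
... | tri> i≮j _ j<i  = trans (symmetrisation-≮ w i j i≮j) (sym (symmetrisation-< w j i j<i))

does⇒ : {A : Set} (A? : Dec A) → does A? ≡ true → A
does⇒ (yes h) _ = h

InF⇒Sparse : ∀ {s Q} (w : Multigraph n) → InF n s Q w → Sparse s Q (symmetrisation w)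
InF⇒Sparse {n} {s} {Q} w w∈F x x-inj = begin
  ΣPairs s (λ i j → w′ (x i) (x j))                 ≡⟨ ΣPairs-indicator s χ x x-inj χx χ⇒ w′ (symmetrisation-symmetric w) ⟨
  ΣPairs n (λ i j → if χ i ∧ χ j then w′ i j else 0) ≡⟨ ΣPairs-cong-< (λ i j i<j → cong₂ (λ b z → if b then z else 0)
      (sym (cong₂ _∧_ (does-∈?-tabulate χ i) (does-∈?-tabulate χ j))) (symmetrisation-< w i j i<j)) ⟩
  eIn w (Vec.tabulate χ)                            ≤⟨ w∈F (Vec.tabulate χ) size ⟩
  Q                                                 ∎
  where
  open ≤-Reasoning
  w′ : Multigraph n
  w′ = symmetrisation w
  χ : Fin n → Bool
  χ i = does (any? (λ k → i ≟ᶠ x k))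
  χx : ∀ k → χ (x k) ≡ true
  χx k = Dec.dec-true (any? (λ k′ → x k ≟ᶠ x k′)) (k , refl)
  χ⇒ : ∀ i → χ i ≡ true → ∃ λ k → i ≡ x k
  χ⇒ i = does⇒ (any? (λ k → i ≟ᶠ x k))
  size : ∣ Vec.tabulate χ ∣ ≡ s
  size = trans (∣tabulate∣ χ) (trans (∑-cong count) (trans (∑-indicator s χ x x-inj χx χ⇒ (λ _ → 1)) (trans (∑-const s 1) (*-identityʳ s))))
    where
    count : ∀ i → ⟦ χ i ⟧ ≡ (if χ i then 1 else 0)
    count i with χ i
    ... | true  = refl
    ... | false = refl

first : ∀ m l → Fin (m + l) → Fin 2
first zero    l _       = 1F
first (suc m) l zero    = 0F
first (suc m) l (suc i) = first m l i

zeros-first : ∀ m l → zeros (first m l) ≡ m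
zeros-first zero    l = trans (∑-const l 0) (*-zeroʳ l)
zeros-first (suc m) l = cong suc (zeros-first m l)

ones-first : ∀ m l → ones (first m l) ≡ l
ones-first m l = +-cancelˡ-≡ m _ _ (trans (cong (_+ ones (first m l)) (sym (zeros-first m l))) (zeros+ones (first m l)))

-- Exponents of the weights a - 1, a, a + 1

module Weights (p a q : ℕ) (a≡1+p : a ≡ suc p) (q≡1+a : q ≡ suc a) (0<p : 0 < p) where

  instance
    p≢0 : NonZero p
    p≢0 = >-nonZero 0<p
    a≢0 : NonZero a
    a≢0 = subst NonZero (sym a≡1+p) _
    q≢0 : NonZero q
    q≢0 = subst NonZero (sym q≡1+a) _

  p≤a : p ≤ a
  p≤a = ≤-trans (n≤1+n p) (≤-reflexive (sym a≡1+p))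

  a<q : a < q
  a<q = ≤-reflexive (sym q≡1+a)

  a≤q : a ≤ q
  a≤q = <⇒≤ a<q

  opaque
    -- Its logarithm is x α - y β + (x + y + z) log a, so for a fixed number of factors only x α - y
    -- β matters.
    W : ℕ → ℕ → ℕ → ℕ
    W x y z = q ^ x * (p ^ y * a ^ z)

  private
    variable
      x y z x′ y′ z′ : ℕ

  opaque
    unfolding W
    W≢0 : ∀ x y z → NonZero (W x y z)
    W≢0 x y z = m*n≢0 _ _ {{m^n≢0 q x}} {{m*n≢0 _ _ {{m^n≢0 p y}} {{m^n≢0 a z}}}}

  W-cong : x ≡ x′ → y ≡ y′ → z ≡ z′ → W x y z ≡ W x′ y′ z′
  W-cong refl refl refl = refl

  opaque
    unfolding W
    W-* : ∀ x y z x′ y′ z′ → W x y z * W x′ y′ z′ ≡ W (x + x′) (y + y′) (z + z′)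
    W-* x y z x′ y′ z′ = begin
      W x y z * W x′ y′ z′
        ≡⟨ rearrange (q ^ x) (p ^ y) (a ^ z) (q ^ x′) (p ^ y′) (a ^ z′) ⟩
      (q ^ x * q ^ x′) * ((p ^ y * p ^ y′) * (a ^ z * a ^ z′))
        ≡⟨ cong₂ _*_ (^-distribˡ-+-* q x x′) (cong₂ _*_ (^-distribˡ-+-* p y y′) (^-distribˡ-+-* a z z′)) ⟨
      W (x + x′) (y + y′) (z + z′) ∎
      where
      open ≡-Reasoning
      rearrange : ∀ a b c d e f → (a * (b * c)) * (d * (e * f)) ≡ (a * d) * ((b * e) * (c * f))
      rearrange = solve-∀

  opaque
    unfolding W
    W-a : ∀ z → W 0 0 z ≡ a ^ z
    W-a z = trans (*-identityˡ _) (*-identityˡ _)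

  opaque
    unfolding W
    W-q : ∀ x → W x 0 0 ≡ q ^ x
    W-q x = *-identityʳ _

  W-shift : ∀ x₀ y₀ z₀ → W x y z ≤ W x′ y′ z′ → W (x + x₀) (y + y₀) (z + z₀) ≤ W (x′ + x₀) (y′ + y₀) (z′ + z₀)
  W-shift x₀ y₀ z₀ le = subst₂ _≤_ (W-* _ _ _ x₀ y₀ z₀) (W-* _ _ _ x₀ y₀ z₀) (*-monoˡ-≤ (W x₀ y₀ z₀) le)

  a≤q^ : ∀ i → W 0 0 i ≤ W i 0 0
  a≤q^ i = subst₂ _≤_ (sym (W-a i)) (sym (W-q i)) (^-monoˡ-≤ i a≤q)

  opaque
    unfolding W
    p≤a^ : ∀ j → W 0 j 0 ≤ W 0 0 j
    p≤a^ j = *-monoʳ-≤ 1 (subst₂ _≤_ (sym (*-identityʳ _)) (sym (*-identityˡ _)) (^-monoˡ-≤ j p≤a))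

  W-raise : x ≤ x′ → y′ ≤ y → x + y + z ≡ x′ + y′ + z′ → W x y z ≤ W x′ y′ z′
  W-raise {x} {x′} {y′} {y} {z} {z′} x≤ y≤ eq with m≤n⇒∃[o]m+o≡n x≤ | m≤n⇒∃[o]m+o≡n y≤
  ... | i , refl | j , refl = begin
    W x (y′ + j) z          ≡⟨ W-cong refl (+-comm y′ j) refl ⟩
    W (0 + x) (j + y′) (0 + z) ≤⟨ W-shift x y′ z (p≤a^ j) ⟩
    W x y′ (j + z)          ≡⟨ W-cong refl refl (+-cancelˡ-≡ (x + y′) (j + z) (i + z′) (trans (eq₁ x y′ j z) (trans eq (eq₂ x y′ i z′)))) ⟩
    W (0 + x) (0 + y′) (i + z′) ≤⟨ W-shift x y′ z′ (a≤q^ i) ⟩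
    W (i + x) y′ z′         ≡⟨ W-cong (+-comm i x) refl refl ⟩
    W (x + i) y′ z′ ∎
    where
    open ≤-Reasoning
    eq₁ : ∀ x y j z → x + y + (j + z) ≡ x + (y + j) + z
    eq₁ = solve-∀
    eq₂ : ∀ x y i z → x + i + y + z ≡ x + y + (i + z)
    eq₂ = solve-∀

  opaque
    unfolding W
    -- This is α ≤ β.
    pq≤aa : W 1 1 0 ≤ W 0 0 2
    pq≤aa rewrite q≡1+a | a≡1+p = ≤-trans (m≤m+n _ 1) (≤-reflexive (identity p))
      where
      identity : ∀ p → (2 + p) * 1 * (p * 1 * 1) + 1 ≡ 1 * (1 * ((1 + p) * ((1 + p) * 1)))
      identity = solve-∀

  opaque
    unfolding W
    -- This is β < 2 α. With a = t + 2 the two sides differ by t² + 3 t + 1.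
    aaa<pqq : W 0 0 3 < W 2 1 0
    aaa<pqq = step p 0<p a≡1+p q≡1+a
      where
      identity : ∀ t → 1 * (1 * ((2 + t) * ((2 + t) * ((2 + t) * 1)))) + (t * t + 3 * t + 1)
        ≡ (3 + t) * ((3 + t) * 1) * ((1 + t) * 1 * 1)
      identity = solve-∀
      step : ∀ p₀ → 0 < p₀ → a ≡ suc p₀ → q ≡ suc a → 1 * (1 * (a ^ 3)) < q ^ 2 * (p₀ ^ 1 * 1)
      step (suc t) _ refl refl = <-≤-trans (m<m+n _ (≤-trans (s≤s z≤n) (m≤n+m 1 (t * t + 3 * t)))) (≤-reflexive (identity t))

  -- Stands for y β ≤ x α.
  Exceeds : ℕ → ℕ → Set
  Exceeds x y = W 0 0 (x + y) ≤ W x y 0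

  Exceeds-+ : Exceeds x y → Exceeds x′ y′ → Exceeds (x + x′) (y + y′)
  Exceeds-+ {x} {y} {x′} {y′} h h′ = begin
    W 0 0 (x + x′ + (y + y′))     ≡⟨ W-cong refl refl (rearrange x x′ y y′) ⟩
    W 0 0 ((x + y) + (x′ + y′))   ≡⟨ W-* 0 0 (x + y) 0 0 (x′ + y′) ⟨
    W 0 0 (x + y) * W 0 0 (x′ + y′) ≤⟨ *-mono-≤ h h′ ⟩
    W x y 0 * W x′ y′ 0           ≡⟨ W-* x y 0 x′ y′ 0 ⟩
    W (x + x′) (y + y′) 0         ∎
    where
    open ≤-Reasoning
    rearrange : ∀ x x′ y y′ → x + x′ + (y + y′) ≡ (x + y) + (x′ + y′)
    rearrange = solve-∀

  Exceeds-2 : ∀ m → Exceeds (2 * m) m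
  Exceeds-2 zero    = ≤-refl
  Exceeds-2 (suc m) = subst (λ x → Exceeds x (suc m)) (eq m) (Exceeds-+ {2} {1} {2 * m} {m} (<⇒≤ aaa<pqq) (Exceeds-2 m))
    where
    eq : ∀ m → 2 + 2 * m ≡ 2 * suc m
    eq = solve-∀

  -- Bernoulli: with p q² = a³ + y one has (a³ + y)⁴ ≥ a¹² + 4 a⁹ y, and 4 y ≥ a² because a ≥ 2.
  opaque
    unfolding W
    Exceeds-7-4 : Exceeds 7 4
    Exceeds-7-4 = *-cancelˡ-≤ q (begin
      q * W 0 0 11              ≡⟨ cong (q *_) (W-a 11) ⟩
      q * a ^ 11                ≤⟨ core p 0<p a≡1+p q≡1+a ⟩
      (q * q * p) * (q * q * p) * ((q * q * p) * (q * q * p)) ≡⟨ regroup p q ⟩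
      q * W 7 4 0               ∎)
      where
      open ≤-Reasoning
      regroup : ∀ p q → (q * q * p) * (q * q * p) * ((q * q * p) * (q * q * p))
        ≡ q * ((q * (q * (q * (q * (q * (q * (q * 1))))))) * (p * (p * (p * (p * 1))) * 1))
      regroup = solve-∀
      cube : ∀ t → (3 + t) * (3 + t) * (1 + t) ≡ (2 + t) * (2 + t) * (2 + t) + (t * t + 3 * t + 1)
      cube = solve-∀
      square : ∀ t → 4 * (t * t + 3 * t + 1) ≡ (2 + t) * (2 + t) + (3 * (t * t) + 8 * t)
      square = solve-∀
      fourth : ∀ x y → x * x * (x * x) + x * x * x * (4 * y) + y * y * (6 * (x * x) + 4 * (x * y) + y * y)
        ≡ (x + y) * (x + y) * ((x + y) * (x + y))
      fourth = solve-∀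
      split : ∀ a → (1 + a) * (a * (a * (a * (a * (a * (a * (a * (a * (a * (a * (a * 1)))))))))))
        ≡ (a * a * a) * (a * a * a) * ((a * a * a) * (a * a * a)) + (a * a * a) * (a * a * a) * (a * a * a) * (a * a)
      split = solve-∀
      core : ∀ p₀ → 0 < p₀ → a ≡ suc p₀ → q ≡ suc a →
        q * a ^ 11 ≤ (q * q * p₀) * (q * q * p₀) * ((q * q * p₀) * (q * q * p₀))
      core (suc t) _ refl refl = begin
        q * a ^ 11 ≡⟨ split a ⟩
        c * c * (c * c) + c * c * c * (a * a)
          ≤⟨ +-monoʳ-≤ (c * c * (c * c)) (*-monoʳ-≤ (c * c * c) (≤-trans (m≤m+n (a * a) _) (≤-reflexive (sym (square t))))) ⟩
        c * c * (c * c) + c * c * c * (4 * d) ≤⟨ m≤m+n _ _ ⟩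
        c * c * (c * c) + c * c * c * (4 * d) + d * d * (6 * (c * c) + 4 * (c * d) + d * d) ≡⟨ fourth c d ⟩
        (c + d) * (c + d) * ((c + d) * (c + d)) ≡⟨ cong (λ z → z * z * (z * z)) (cube t) ⟨
        _ ∎
        where
        c d : ℕ
        c = a * a * a
        d = t * t + 3 * t + 1

  -- Eight copies of β, bounded by 7 α / 4 each, save 2 α against the bound 2 α per copy; the other
  -- `m` copies save nothing.
  Exceeds-8 : ∀ m → Exceeds (14 + 2 * m) (8 + m)
  Exceeds-8 m = Exceeds-+ {14} {8} {2 * m} {m} (Exceeds-+ {7} {4} {7} {4} Exceeds-7-4 Exceeds-7-4) (Exceeds-2 m)

  -- Balanced products

  -- The ratios (a + d + 1) / (a + d) are at most (a + 1) / a, and they telescope.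
  above : ∀ d → (a + d) * a ^ d ≤ a * q ^ d
  above zero    = ≤-reflexive (cong (_* 1) (+-identityʳ a))
  above (suc d) = begin
    (a + suc d) * (a * a ^ d)      ≡⟨ *-assoc (a + suc d) a (a ^ d) ⟨
    (a + suc d) * a * a ^ d        ≤⟨ *-monoˡ-≤ (a ^ d) (subst (λ z → (a + suc d) * a ≤ (a + d) * z) (sym q≡1+a) (≤-trans (m≤m+n _ d) (≤-reflexive (identity a d)))) ⟩
    (a + d) * q * a ^ d            ≡⟨ swap (a + d) q (a ^ d) ⟩
    q * ((a + d) * a ^ d)          ≤⟨ *-monoʳ-≤ q (above d) ⟩
    q * (a * q ^ d)                ≡⟨ swap′ q a (q ^ d) ⟩
    a * (q * q ^ d)                ∎
    where
    open ≤-Reasoning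
    identity : ∀ a d → (a + suc d) * a + d ≡ (a + d) * suc a
    identity = solve-∀
    swap : ∀ x y z → x * y * z ≡ y * (x * z)
    swap = solve-∀
    swap′ : ∀ x y z → x * (y * z) ≡ y * (x * z)
    swap′ = solve-∀

  -- The same telescoping below `a`, where x / (x + 1) ≤ a / (a + 1).
  below : ∀ d x → x + d ≡ a → x * q ^ d ≤ a * a ^ d
  below zero    x eq = ≤-reflexive (cong (_* 1) (trans (sym (+-identityʳ x)) eq))
  below (suc d) x eq = begin
    x * (q * q ^ d)       ≡⟨ *-assoc x q (q ^ d) ⟨
    x * q * q ^ d         ≤⟨ *-monoˡ-≤ (q ^ d) step ⟩
    suc x * a * q ^ d     ≡⟨ swap (suc x) a (q ^ d) ⟩
    a * (suc x * q ^ d)   ≤⟨ *-monoʳ-≤ a (below d (suc x) (trans (sym (+-suc x d)) eq)) ⟩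
    a * (a * a ^ d)       ∎
    where
    open ≤-Reasoning
    swap : ∀ x y z → x * y * z ≡ y * (x * z)
    swap = solve-∀
    step : x * q ≤ suc x * a
    step = begin
      x * q       ≡⟨ cong (x *_) q≡1+a ⟩
      x * suc a   ≡⟨ *-suc x a ⟩
      x + x * a   ≤⟨ +-monoˡ-≤ (x * a) (≤-trans (m≤m+n x (suc d)) (≤-reflexive eq)) ⟩
      a + x * a   ∎

  -- The chord of the logarithm through a and a + 1 lies above it at all integers.
  Chord : ℕ → ℕ → ℕ → Set
  Chord k s π = π * W (k * a) 0 s ≤ W s 0 (k + k * a)

  Chord-* : ∀ {k s π k′ s′ π′} → Chord k s π → Chord k′ s′ π′ → Chord (k + k′) (s + s′) (π * π′)
  Chord-* {k} {s} {π} {k′} {s′} {π′} h h′ = begin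
    π * π′ * W ((k + k′) * a) 0 (s + s′)              ≡⟨ cong (π * π′ *_) (trans (W-cong (*-distribʳ-+ a k k′) refl refl) (sym (W-* (k * a) 0 s (k′ * a) 0 s′))) ⟩
    π * π′ * (W (k * a) 0 s * W (k′ * a) 0 s′)        ≡⟨ *-interchange π π′ _ _ ⟩
    π * W (k * a) 0 s * (π′ * W (k′ * a) 0 s′)        ≤⟨ *-mono-≤ h h′ ⟩
    W s 0 (k + k * a) * W s′ 0 (k′ + k′ * a)          ≡⟨ W-* s 0 _ s′ 0 _ ⟩
    W (s + s′) 0 (k + k * a + (k′ + k′ * a))          ≡⟨ W-cong refl refl (eq a k k′) ⟩
    W (s + s′) 0 (k + k′ + (k + k′) * a)              ∎
    where
    open ≤-Reasoning
    eq : ∀ a k k′ → k + k * a + (k′ + k′ * a) ≡ k + k′ + (k + k′) * a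
    eq = solve-∀

  Chord-1 : ∀ x → Chord 1 x x
  Chord-1 x with ≤-total a x
  ... | inj₁ a≤x with d , refl ← m≤n⇒∃[o]m+o≡n a≤x = begin
    (a + d) * W (1 * a) 0 (a + d)            ≡⟨ cong ((a + d) *_) (trans (W-cong (*-identityˡ a) refl (+-comm a d)) (sym (W-* 0 0 d a 0 a))) ⟩
    (a + d) * (W 0 0 d * W a 0 a)            ≡⟨ *-assoc (a + d) _ _ ⟨
    (a + d) * W 0 0 d * W a 0 a              ≤⟨ *-monoˡ-≤ (W a 0 a) (subst₂ _≤_ (cong ((a + d) *_) (sym (W-a d))) (cong (a *_) (sym (W-q d))) (above d)) ⟩
    a * W d 0 0 * W a 0 a                    ≡⟨ cong (λ z → z * W d 0 0 * W a 0 a) (trans (sym (*-identityʳ a)) (sym (W-a 1))) ⟩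
    W 0 0 1 * W d 0 0 * W a 0 a              ≡⟨ cong (_* W a 0 a) (W-* 0 0 1 d 0 0) ⟩
    W d 0 1 * W a 0 a                        ≡⟨ W-* d 0 1 a 0 a ⟩
    W (d + a) 0 (1 + a)                      ≡⟨ W-cong (+-comm d a) refl (cong suc (sym (*-identityˡ a))) ⟩
    W (a + d) 0 (1 + 1 * a)                  ∎
    where open ≤-Reasoning
  ... | inj₂ x≤a with d , eq ← m≤n⇒∃[o]m+o≡n x≤a = begin
    x * W (1 * a) 0 x             ≡⟨ cong (x *_) (trans (W-cong (trans (*-identityˡ a) (trans (sym eq) (+-comm x d))) refl refl) (sym (W-* d 0 0 x 0 x))) ⟩
    x * (W d 0 0 * W x 0 x)       ≡⟨ *-assoc x _ _ ⟨
    x * W d 0 0 * W x 0 x         ≤⟨ *-monoˡ-≤ (W x 0 x) (subst₂ _≤_ (cong (x *_) (sym (W-q d))) (sym (W-a (suc d))) (below d x eq)) ⟩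
    W 0 0 (suc d) * W x 0 x       ≡⟨ W-* 0 0 (suc d) x 0 x ⟩
    W x 0 (suc d + x)             ≡⟨ W-cong refl refl (cong suc (trans (+-comm d x) (trans eq (sym (*-identityˡ a))))) ⟩
    W x 0 (1 + 1 * a)             ∎
    where open ≤-Reasoning

  -- `Chord` sees only the number of factors and their sum, hence is multiplicative, and single
  -- factors may be arbitrarily large or 0.
  Chord-∏ : ∀ {n} (f : Fin n → ℕ) → Chord n (∑ f) (∏ f)
  Chord-∏ {zero}  f = ≤-reflexive (*-identityˡ _)
  Chord-∏ {suc n} f = Chord-* {1} {f zero} {f zero} {n} (Chord-1 (f zero)) (Chord-∏ (f ∘ suc))

  Chord-ΠPairs : ∀ {n} (w : Fin n → Fin n → ℕ) → Chord (tri n) (ΣPairs n w) (ΠPairs n w)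
  Chord-ΠPairs {zero}  w = ≤-reflexive (*-identityˡ _)
  Chord-ΠPairs {suc n} w = Chord-* {n} {∑ (λ j → w zero (suc j))} {∏ (λ j → w zero (suc j))} {tri n}
    (Chord-∏ (λ j → w zero (suc j))) (Chord-ΠPairs (λ i j → w (suc i) (suc j)))

  -- log π ≤ k log a + r α
  Balanced : ℕ → ℕ → ℕ → Set
  Balanced k r π = π * W 0 0 r ≤ W r 0 k

  -- A sum of at most k a + r over `k` factors is worth no more than `r` factors `q` and k - r
  -- factors `a`. Since `r` may exceed `k`, the power of `a` stays on the left of `Balanced`. The
  -- missing amount `δ` is filled up by a ≤ q.
  Chord⇒Balanced : ∀ {k s π r} → Chord k s π → s ≤ k * a + r → Balanced k r π
  Chord⇒Balanced {k} {s} {π} {r} h s≤ with δ , eq ← m≤n⇒∃[o]m+o≡n s≤ =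
    *-cancelʳ-≤ _ _ (W (k * a) 0 (k * a)) {{W≢0 (k * a) 0 (k * a)}} (begin
    π * W 0 0 r * W (k * a) 0 (k * a)    ≡⟨ trans (*-assoc π _ _) (cong (π *_) (W-* 0 0 r (k * a) 0 (k * a))) ⟩
    π * W (k * a) 0 (r + k * a)          ≡⟨ cong (π *_) (trans (W-cong (sym (+-identityʳ _)) refl (trans (+-comm r (k * a)) (sym eq))) (sym (W-* (k * a) 0 s 0 0 δ))) ⟩
    π * (W (k * a) 0 s * W 0 0 δ)        ≡⟨ *-assoc π _ _ ⟨
    π * W (k * a) 0 s * W 0 0 δ          ≤⟨ *-mono-≤ h (a≤q^ δ) ⟩
    W s 0 (k + k * a) * W δ 0 0          ≡⟨ W-* s 0 _ δ 0 0 ⟩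
    W (s + δ) 0 (k + k * a + 0)          ≡⟨ W-cong (trans eq (+-comm (k * a) r)) refl (+-identityʳ _) ⟩
    W (r + k * a) 0 (k + k * a)          ≡⟨ W-* r 0 k (k * a) 0 (k * a) ⟨
    W r 0 k * W (k * a) 0 (k * a)        ∎)
    where open ≤-Reasoning

  Balanced-* : ∀ {k r π k′ r′ π′} → Balanced k r π → Balanced k′ r′ π′ → Balanced (k + k′) (r + r′) (π * π′)
  Balanced-* {k} {r} {π} {k′} {r′} {π′} h h′ = begin
    π * π′ * W 0 0 (r + r′)            ≡⟨ cong (π * π′ *_) (W-* 0 0 r 0 0 r′) ⟨
    π * π′ * (W 0 0 r * W 0 0 r′)      ≡⟨ *-interchange π π′ _ _ ⟩
    π * W 0 0 r * (π′ * W 0 0 r′)      ≤⟨ *-mono-≤ h h′ ⟩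
    W r 0 k * W r′ 0 k′                ≡⟨ W-* r 0 k r′ 0 k′ ⟩
    W (r + r′) 0 (k + k′)              ∎
    where open ≤-Reasoning

  Balanced-∏ : ∀ {n k r} (f : Fin n → ℕ) → (∀ i → Balanced k r (f i)) → Balanced (n * k) (n * r) (∏ f)
  Balanced-∏ {zero}  f h = ≤-reflexive (*-identityˡ _)
  Balanced-∏ {suc n} {k} {r} f h = Balanced-* {k} {r} {f zero} {n * k} {n * r} (h zero) (Balanced-∏ (f ∘ suc) (h ∘ suc))

  -- Stars

  Star : ℕ → ℕ → ℕ
  Star m l = W (m * l) (tri m) (tri l)

  Star-suc-leaf : ∀ m l → Star m (suc l) ≡ Star m l * W m 0 l
  Star-suc-leaf m l = sym (trans (W-* (m * l) (tri m) (tri l) m 0 l)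
    (W-cong (trans (+-comm (m * l) m) (sym (*-suc m l))) (+-identityʳ _) (+-comm (tri l) l)))

  Star-suc-centre : ∀ m l → Star (suc m) l ≡ Star m l * W l m 0
  Star-suc-centre m l = sym (trans (W-* (m * l) (tri m) (tri l) l m 0)
    (W-cong (+-comm (m * l) l) (+-comm (tri m) m) (+-identityʳ _)))

  Optimal : ℕ → ℕ → Set
  Optimal m l = ∀ m′ l′ → m′ + l′ ≡ m + l → Star m′ l′ ≤ Star m l

  optimal : ∀ n → ∃₂ λ m l → m + l ≡ n × Optimal m l
  optimal n with argmax (λ k → Star k (n ∸ k)) n
  ... | m , m≤n , max = m , n ∸ m , m+[n∸m]≡n m≤n , λ m′ l′ eq →
    let eq′ = trans eq (m+[n∸m]≡n m≤n) in
    subst (λ z → Star m′ z ≤ Star m (n ∸ m)) (trans (cong (_∸ m′) (sym eq′)) (m+n∸m≡n m′ l′))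
      (max m′ (≤-trans (m≤m+n m′ l′) (≤-reflexive eq′)))

  -- `Star m l` grows to the given optimum by a leaf and to a competitor by a centre.
  optimal-derivative : ∀ m l → Optimal m (suc l) → W l m 0 ≤ W m 0 l
  optimal-derivative m l opt = *-cancelˡ-≤ (Star m l) {{W≢0 (m * l) (tri m) (tri l)}}
    (subst₂ _≤_ (Star-suc-centre m l) (Star-suc-leaf m l) (opt (suc m) l (sym (+-suc m l))))

  -- If 3 m ≤ l, turning one of the `suc l` leaves into a centre changes the logarithm by (l - m) α
  -- - m β ≥ m (2 α - β), which is positive for m > 0. For m = 0 the change is l α, and 2 ≤ m + l
  -- keeps `l` positive.
  optimal-centre : ∀ m l → Optimal m l → 2 ≤ m + l → m + l ≤ 4 * m
  optimal-centre m zero opt _ = subst (_≤ 4 * m) (sym (+-identityʳ m)) (m≤m+n m (3 * m))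
  optimal-centre m (suc l) opt 2≤ = subst₂ _≤_ (sym (+-suc m l)) refl (+-monoʳ-< m (≰⇒> (λ 3m≤l → absurd m l (optimal-derivative m l opt) 3m≤l 2≤)))
    where
    absurd : ∀ m l → W l m 0 ≤ W m 0 l → 3 * m ≤ l → 2 ≤ m + suc l → ⊥
    absurd zero (suc l) le _ _ = <⇒≱ (subst₂ _<_ (sym (W-a (suc l))) (sym (W-q (suc l))) (^-monoˡ-< (suc l) a<q)) le
    absurd zero zero _ _ (s≤s ())
    absurd (suc m) l le 3m≤l _ with j , refl ← m≤n⇒∃[o]m+o≡n 3m≤l = <⇒≱ gap le
      where
      open ≤-Reasoning
      eq₁ : ∀ m j → 3 * suc m + j ≡ 3 + (2 * m + m + j)
      eq₁ = solve-∀
      eq₂ : ∀ m j → 2 + (2 * m + (j + suc m)) ≡ 3 * suc m + j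
      eq₂ = solve-∀
      gap : W (suc m) 0 (3 * suc m + j) < W (3 * suc m + j) (suc m) 0
      gap = begin-strict
        W (suc m) 0 (3 * suc m + j)                 ≡⟨ W-cong refl refl (eq₁ m j) ⟩
        W (suc m) 0 (3 + (2 * m + m + j))           ≡⟨ W-* 0 0 3 (suc m) 0 (2 * m + m + j) ⟨
        W 0 0 3 * W (suc m) 0 (2 * m + m + j)       <⟨ *-monoˡ-< _ {{W≢0 (suc m) 0 (2 * m + m + j)}} aaa<pqq ⟩
        W 2 1 0 * W (0 + suc m) 0 (2 * m + m + j)   ≤⟨ *-monoʳ-≤ (W 2 1 0) (W-shift (suc m) 0 j (Exceeds-2 m)) ⟩
        W 2 1 0 * W (2 * m + suc m) (m + 0) j       ≤⟨ *-monoʳ-≤ (W 2 1 0) (W-raise {x = 2 * m + suc m} {x′ = 2 * m + (j + suc m)} (+-monoʳ-≤ (2 * m) (m≤n+m (suc m) j)) (≤-reflexive (sym (+-identityʳ m))) (eq₃ m j)) ⟩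
        W 2 1 0 * W (2 * m + (j + suc m)) m 0       ≡⟨ W-* 2 1 0 (2 * m + (j + suc m)) m 0 ⟩
        W (2 + (2 * m + (j + suc m))) (suc m) 0     ≡⟨ W-cong (eq₂ m j) refl refl ⟩
        W (3 * suc m + j) (suc m) 0 ∎
        where
        eq₃ : ∀ m j → 2 * m + suc m + (m + 0) + j ≡ 2 * m + (j + suc m) + m + 0
        eq₃ = solve-∀

  -- log π ≤ log (Star m l) + e α
  Bounded : ℕ → ℕ → ℕ → Set
  Bounded e n π = ∃₂ λ m l → m + l ≡ n × π * W 0 0 e ≤ Star m l * W e 0 0

  Bounded-optimal : ∀ {e n π m l} → Bounded e n π → m + l ≡ n → Optimal m l → π * W 0 0 e ≤ Star m l * W e 0 0
  Bounded-optimal {e} (m′ , l′ , eq′ , h) eq opt = ≤-trans h (*-monoˡ-≤ (W e 0 0) (opt m′ l′ (trans eq′ (sym eq))))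

  Bounded-≤ : ∀ {e n π π′} → π ≤ π′ → Bounded e n π′ → Bounded e n π
  Bounded-≤ {e} π≤ (m , l , eq , h) = m , l , eq , ≤-trans (*-monoˡ-≤ (W 0 0 e) π≤) h

  Bounded-weaken : ∀ {e e′ n π} → e ≤ e′ → Bounded e n π → Bounded e′ n π
  Bounded-weaken {e} {π = π} e≤ (m , l , eq , h) with d , refl ← m≤n⇒∃[o]m+o≡n e≤ = m , l , eq , (begin
    π * W 0 0 (e + d)           ≡⟨ cong (π *_) (W-* 0 0 e 0 0 d) ⟨
    π * (W 0 0 e * W 0 0 d)     ≡⟨ *-assoc π _ _ ⟨
    π * W 0 0 e * W 0 0 d       ≤⟨ *-mono-≤ h (a≤q^ d) ⟩
    Star m l * W e 0 0 * W d 0 0 ≡⟨ *-assoc (Star m l) _ _ ⟩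
    Star m l * (W e 0 0 * W d 0 0) ≡⟨ cong (Star m l *_) (W-* e 0 0 d 0 0) ⟩
    Star m l * W (e + d) 0 0    ∎)
    where open ≤-Reasoning

  -- Removing a dense set and regrowing a star

  -- The outside vertex comes first, so that `ΠPairs` of the extended set unfolds to its row times
  -- the product over the `k`-set.
  extend : ∀ k {r} → Fin r → Fin (suc k) → Fin (k + r)
  extend k     j zero    = k ↑ʳ j
  extend k {r} j (suc i) = i ↑ˡ r

  extend-injective : ∀ k {r} (j : Fin r) → Inj (extend k j)
  extend-injective k {r} j {x} {y} = go x y
    where
    apart : ∀ i → k ↑ʳ j ≢ i ↑ˡ r
    apart i eq with () ← trans (sym (splitAt-↑ʳ k r j)) (trans (cong (splitAt k) eq) (splitAt-↑ˡ k i r))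
    go : ∀ x y → extend k j x ≡ extend k j y → x ≡ y
    go zero    zero    _  = refl
    go zero    (suc i) eq = contradiction eq (apart i)
    go (suc i) zero    eq = contradiction (sym eq) (apart i)
    go (suc i) (suc i′) eq = cong suc (↑ˡ-injective r i i′ eq)

  -- One outside vertex is estimated together with the k-set, so that no bound
  -- on the weight of the k-set itself is needed.
  remove : ∀ k r Q t (w : Multigraph (k + suc r)) → Symmetric w →
    Sparse (suc k) (tri (suc k) * a + Q) w → (x : Fin k → Fin (k + suc r)) → Inj x →
    tri (suc k) * a + Q ≤ k * a + t + ΣPairs k (λ i j → w (x i) (x j)) →
    ∃ λ (e : Fin (suc r) → Fin (k + suc r)) → Inj e ×
      ΠPairs (k + suc r) w * W 0 0 (Q + r * t)
        ≤ ΠPairs (suc r) (λ i j → w (e i) (e j)) * W (Q + r * t) 0 (tri (suc k) + r * k)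
  remove k r Q t w s sparse x x-inj dense =
    to ∘ (k ↑ʳ_) , (λ eq → ↑ʳ-injective k _ _ (to-injective eq)) , (begin
    ΠPairs (k + suc r) w * W 0 0 (Q + r * t)
      ≡⟨ cong (_* W 0 0 (Q + r * t)) (trans (sym (ΠPairs-to w s)) (ΠPairs-↑ k w₁ (λ i j → s _ _))) ⟩
    A * (c zero * ∏ (c ∘ suc) * D) * W 0 0 (Q + r * t)
      ≡⟨ rearrange A (c zero) (∏ (c ∘ suc)) D _ ⟩
    D * (c zero * A * ∏ (c ∘ suc) * W 0 0 (Q + r * t))
      ≤⟨ *-monoʳ-≤ D (Balanced-* {tri (suc k)} {Q} {c zero * A} {r * k} {r * t} inner outer) ⟩
    D * W (Q + r * t) 0 (tri (suc k) + r * k) ∎)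
    where
    open ≤-Reasoning
    open Relabelling (relabel k x x-inj)
    w₁ : Multigraph (k + suc r)
    w₁ i j = w (to i) (to j)
    A D : ℕ
    A = ΠPairs k (λ i j → w₁ (i ↑ˡ suc r) (j ↑ˡ suc r))
    D = ΠPairs (suc r) (λ i j → w₁ (k ↑ʳ i) (k ↑ʳ j))
    c : Fin (suc r) → ℕ
    c j = ∏ (λ i → w₁ (k ↑ʳ j) (i ↑ˡ suc r))
    rearrange : ∀ A K K′ D E → A * (K * K′ * D) * E ≡ D * (K * A * K′ * E)
    rearrange = solve-∀
    sum-extend : ∀ j → ΣPairs (suc k) (λ i i′ → w₁ (extend k j i) (extend k j i′)) ≤ tri (suc k) * a + Q
    sum-extend j = sparse (to ∘ extend k j) (extend-injective k j ∘ to-injective)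
    inner : Balanced (tri (suc k)) Q (c zero * A)
    inner = Chord⇒Balanced {tri (suc k)} {_} {c zero * A} (Chord-ΠPairs (λ i i′ → w₁ (extend k zero i) (extend k zero i′))) (sum-extend zero)
    -- Together with the dense `k`-set an outside vertex obeys the bound for k + 1 vertices;
    -- subtracting the dense part leaves at most k a + t.
    cross : ∀ j → ∑ (λ i → w₁ (k ↑ʳ j) (i ↑ˡ suc r)) ≤ k * a + t
    cross j = +-cancelʳ-≤ _ _ _ (≤-trans (sum-extend j) (≤-trans dense
      (≤-reflexive (cong (k * a + t +_) (ΣPairs-cong (λ i i′ → sym (cong₂ w (to-extends i) (to-extends i′))))))))
    outer : Balanced (r * k) (r * t) (∏ (c ∘ suc))
    outer = Balanced-∏ {r} {k} {t} (c ∘ suc)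
      (λ j → Chord⇒Balanced {k} {_} {c (suc j)} (Chord-∏ (λ i → w₁ (k ↑ʳ suc j) (i ↑ˡ suc r))) (cross (suc j)))

  -- The balance of one removal: `E` is the excess of the removed pairs, `e` the error of the
  -- remainder, `e′` the new error. The growth of the star has to pay for `d`, the rest of E + e.
  descend : ∀ {π π′ E K e m l m′ l′ e′ d} → π * W 0 0 E ≤ π′ * W E 0 K → π′ * W 0 0 e ≤ Star m l * W e 0 0 →
    Star m l * W (E + e) 0 K ≤ Star m′ l′ * W e′ 0 d → e′ + d ≡ E + e → π * W 0 0 e′ ≤ Star m′ l′ * W e′ 0 0
  descend {π} {π′} {E} {K} {e} {m} {l} {m′} {l′} {e′} {d} h₁ h₂ h₃ eq =
    *-cancelʳ-≤ _ _ (W 0 0 d) {{W≢0 0 0 d}} (begin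
    π * W 0 0 e′ * W 0 0 d            ≡⟨ trans (*-assoc π _ _) (cong (π *_) (trans (W-* 0 0 e′ 0 0 d) (trans (W-cong refl refl eq) (sym (W-* 0 0 E 0 0 e))))) ⟩
    π * (W 0 0 E * W 0 0 e)           ≡⟨ *-assoc π _ _ ⟨
    π * W 0 0 E * W 0 0 e             ≤⟨ *-monoˡ-≤ _ h₁ ⟩
    π′ * W E 0 K * W 0 0 e            ≡⟨ swap π′ (W E 0 K) (W 0 0 e) ⟩
    π′ * W 0 0 e * W E 0 K            ≤⟨ *-monoˡ-≤ _ h₂ ⟩
    Star m l * W e 0 0 * W E 0 K      ≡⟨ trans (*-assoc (Star m l) _ _) (cong (Star m l *_) (trans (W-* e 0 0 E 0 K) (W-cong (+-comm e E) refl refl))) ⟩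
    Star m l * W (E + e) 0 K          ≤⟨ h₃ ⟩
    Star m′ l′ * W e′ 0 d             ≡⟨ cong (Star m′ l′ *_) (trans (W-cong (sym (+-identityʳ e′)) refl refl) (sym (W-* e′ 0 0 0 0 d))) ⟩
    Star m′ l′ * (W e′ 0 0 * W 0 0 d) ≡⟨ *-assoc (Star m′ l′) _ _ ⟨
    Star m′ l′ * W e′ 0 0 * W 0 0 d   ∎)
    where
    open ≤-Reasoning
    swap : ∀ x y z → x * y * z ≡ x * z * y
    swap = solve-∀

  Star-grow : ∀ m l m′ l′ {x z x′ z′} i j k → Star m′ l′ ≡ Star m l * W i j k →
    W x 0 z ≤ W (i + x′) j (k + z′) → Star m l * W x 0 z ≤ Star m′ l′ * W x′ 0 z′
  Star-grow m l m′ l′ {x} {z} {x′} {z′} i j k eq h = begin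
    Star m l * W x 0 z                   ≤⟨ *-monoʳ-≤ (Star m l) h ⟩
    Star m l * W (i + x′) j (k + z′)     ≡⟨ cong (Star m l *_) (trans (W-cong refl (sym (+-identityʳ j)) refl) (sym (W-* i j k x′ 0 z′))) ⟩
    Star m l * (W i j k * W x′ 0 z′)     ≡⟨ *-assoc (Star m l) _ _ ⟨
    Star m l * W i j k * W x′ 0 z′       ≡⟨ cong (_* W x′ 0 z′) eq ⟨
    Star m′ l′ * W x′ 0 z′               ∎
    where open ≤-Reasoning

  Star-leaves : ∀ m l j → Star m (j + l) ≡ Star m l * W (j * m) 0 (j * l + tri j)
  Star-leaves m l j = sym (trans (W-* (m * l) (tri m) (tri l) (j * m) 0 (j * l + tri j))
    (W-cong (eq₁ m l j) (+-identityʳ _) (trans (eq₂ (tri l) (j * l) (tri j)) (sym (tri-+ j l)))))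
    where
    eq₁ : ∀ m l j → m * l + j * m ≡ m * (j + l)
    eq₁ = solve-∀
    eq₂ : ∀ x y z → x + (y + z) ≡ z + y + x
    eq₂ = solve-∀
    tri-+ : ∀ j l → tri (j + l) ≡ tri j + j * l + tri l
    tri-+ zero    l = refl
    tri-+ (suc j) l = trans (cong (j + l +_) (tri-+ j l)) (eq₃ j l (tri j) (j * l) (tri l))
      where
      eq₃ : ∀ j l x y z → j + l + (x + y + z) ≡ j + x + (l + y) + z
      eq₃ = solve-∀

  Star-centre-leaves : ∀ m l j → Star (suc m) (j + l) ≡ Star m l * W (j * m + (j + l)) m (j * l + tri j)
  Star-centre-leaves m l j = trans (Star-suc-centre m (j + l)) (trans (cong (_* W (j + l) m 0) (Star-leaves m l j))
    (trans (*-assoc (Star m l) _ _) (cong (Star m l *_) (trans (W-* (j * m) 0 (j * l + tri j) (j + l) m 0)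
      (W-cong refl refl (+-identityʳ _))))))

  W-raise-Exceeds : ∀ {x z x′ i j z′} → Exceeds i j → x ≤ x′ → x + z ≡ x′ + (i + j + z′) → W x 0 z ≤ W (i + x′) j z′
  W-raise-Exceeds {x} {z} {x′} {i} {j} {z′} ex x≤ eq = begin
    W x 0 z                       ≤⟨ W-raise x≤ z≤n (trans (cong (_+ z) (+-identityʳ x)) (trans eq (cong (_+ (i + j + z′)) (sym (+-identityʳ x′))))) ⟩
    W x′ 0 (i + j + z′)           ≤⟨ W-shift x′ 0 z′ ex ⟩
    W (i + x′) (j + 0) z′         ≡⟨ W-cong refl (+-identityʳ j) refl ⟩
    W (i + x′) j z′               ∎
    where open ≤-Reasoning

  -- The star comes from an induction hypothesis and need not be optimal, so every `m` occurs. Two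
  -- leaves gain 2 m α, enough for 3 α when m ≥ 2. For smaller `m` a centre and a leaf are added,
  -- and the many old leaves give at least (l + 1) α or (l + 2) α - β. `Star-grow-3` follows the
  -- same pattern for 4 α.
  Star-grow-2 : ∀ m l N → m + l ≡ N → 4 ≤ N →
    ∃₂ λ m′ l′ → m′ + l′ ≡ 2 + N × Star m l * W 3 0 (1 + N * 2) ≤ Star m′ l′ * W 0 0 3
  Star-grow-2 zero l _ refl 4≤ = 1 , 1 + l , refl ,
    Star-grow 0 l 1 (1 + l) _ 0 _ (Star-centre-leaves 0 l 1)
      (W-raise-Exceeds {i = 0} {0} ≤-refl (≤-trans (m≤n+m 3 1) (≤-trans 4≤ (≤-trans (n≤1+n l) (m≤m+n (suc l) 0)))) (eq l))
    where
    eq : ∀ l → 3 + (1 + l * 2) ≡ 1 + l + 0 + (l + 0 + 0 + 3)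
    eq = solve-∀
  Star-grow-2 (suc zero) l _ refl 4≤ = 2 , 1 + l , refl ,
    Star-grow 1 l 2 (1 + l) _ 1 _ (Star-centre-leaves 1 l 1)
      (≤-trans (W-raise-Exceeds {i = 2} {1} (<⇒≤ aaa<pqq) (s≤s⁻¹ 4≤) (eq l)) (≤-reflexive (W-cong (sym (+-identityʳ _)) refl refl)))
    where
    eq : ∀ l → 3 + (1 + (1 + l) * 2) ≡ l + (3 + (l + 0 + 0 + 3))
    eq = solve-∀
  Star-grow-2 (suc (suc m)) l _ refl 4≤ = 2 + m , 2 + l , eq₁ m l ,
    Star-grow (2 + m) l (2 + m) (2 + l) _ 0 _ (Star-leaves (2 + m) l 2)
      (W-raise-Exceeds {i = 0} {0} ≤-refl (≤-trans (m≤m+n 3 (1 + 2 * m)) (≤-reflexive (eq₂ m))) (eq₃ m l))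
    where
    eq₁ : ∀ m l → 2 + m + (2 + l) ≡ 2 + (2 + m + l)
    eq₁ = solve-∀
    eq₂ : ∀ m → 3 + (1 + 2 * m) ≡ 2 * (2 + m) + 0
    eq₂ = solve-∀
    eq₃ : ∀ m l → 3 + (1 + (2 + m + l) * 2) ≡ 2 * (2 + m) + 0 + (2 * l + 1 + 3)
    eq₃ = solve-∀

  Star-grow-3 : ∀ m l N → m + l ≡ N → 4 ≤ N →
    ∃₂ λ m′ l′ → m′ + l′ ≡ 3 + N × Star m l * W 4 0 (3 + N * 3) ≤ Star m′ l′ * W 0 0 4
  Star-grow-3 zero l _ refl 4≤ = 1 , 2 + l , refl ,
    Star-grow 0 l 1 (2 + l) _ 0 _ (Star-centre-leaves 0 l 2)
      (W-raise-Exceeds {i = 0} {0} ≤-refl (≤-trans 4≤ (≤-trans (m≤n+m l 2) (m≤m+n (2 + l) 0))) (eq l))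
    where
    eq : ∀ l → 4 + (3 + l * 3) ≡ 2 + l + 0 + (2 * l + 1 + 4)
    eq = solve-∀
  Star-grow-3 (suc zero) l _ refl 4≤ = 2 , 2 + l , refl ,
    Star-grow 1 l 2 (2 + l) _ 1 _ (Star-centre-leaves 1 l 2)
      (≤-trans (W-raise-Exceeds {i = 2} {1} (<⇒≤ aaa<pqq) (≤-trans 4≤ (n≤1+n (1 + l))) (eq l)) (≤-reflexive (W-cong (sym (+-identityʳ _)) refl refl)))
    where
    eq : ∀ l → 4 + (3 + (1 + l) * 3) ≡ 2 + l + (3 + (2 * l + 1 + 4))
    eq = solve-∀
  Star-grow-3 (suc (suc m)) l _ refl 4≤ = 2 + m , 3 + l , eq₁ m l ,
    Star-grow (2 + m) l (2 + m) (3 + l) _ 0 _ (Star-leaves (2 + m) l 3)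
      (W-raise-Exceeds {i = 0} {0} ≤-refl (≤-trans (m≤m+n 4 (2 + 3 * m)) (≤-reflexive (eq₂ m))) (eq₃ m l))
    where
    eq₁ : ∀ m l → 2 + m + (3 + l) ≡ 3 + (2 + m + l)
    eq₁ = solve-∀
    eq₂ : ∀ m → 4 + (2 + 3 * m) ≡ 3 * (2 + m) + 0
    eq₂ = solve-∀
    eq₃ : ∀ m l → 4 + (3 + (2 + m + l) * 3) ≡ 3 * (2 + m) + 0 + (3 * l + 3 + 4)
    eq₃ = solve-∀

  -- A new centre and three leaves are worth (3 m + l + 3) α - m β more than constant weight `a`,
  -- the removed pairs at most (m + l + 4) α. The difference (2 m - 1) α - m β is at least -α.
  Star-grow-4 : ∀ m l N e → m + l ≡ N →
    Star m l * W (4 + N * 1 + e) 0 (6 + N * 4) ≤ Star (1 + m) (3 + l) * W (suc e) 0 (3 + N * 1)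
  Star-grow-4 m l _ e refl = Star-grow m l (1 + m) (3 + l) _ m _ (Star-centre-leaves m l 3)
    (≤-trans (W-raise-Exceeds {i = 2 * m} {m} (Exceeds-2 m) ≤-refl (eq₁ m l e)) (≤-reflexive (W-cong (eq₂ m l e) refl refl)))
    where
    eq₁ : ∀ m l e → 4 + (m + l) * 1 + e + (6 + (m + l) * 4) ≡ 4 + (m + l) * 1 + e + (2 * m + m + (3 * l + 3 + (3 + (m + l) * 1)))
    eq₁ = solve-∀
    eq₂ : ∀ m l e → 2 * m + (4 + (m + l) * 1 + e) ≡ 3 * m + (3 + l) + suc e
    eq₂ = solve-∀

  -- The difference is the same as in `Star-grow-4`, now with at least eight centres, and eight is
  -- the first number M with 7 M / 4 ≤ 2 M - 2. Hence α is gained.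
  Star-grow-4-large : ∀ m l N e → 8 + m + l ≡ N →
    Star (8 + m) l * W (4 + N * 1 + suc e) 0 (6 + N * 4) ≤ Star (9 + m) (3 + l) * W e 0 (5 + N * 1)
  Star-grow-4-large m l _ e refl = Star-grow (8 + m) l (9 + m) (3 + l) _ (8 + m) _ (Star-centre-leaves (8 + m) l 3)
    (≤-trans (W-raise-Exceeds {i = 14 + 2 * m} {8 + m} (Exceeds-8 m) ≤-refl (eq₁ m l e)) (≤-reflexive (W-cong (eq₂ m l e) refl refl)))
    where
    eq₁ : ∀ m l e → 4 + (8 + m + l) * 1 + suc e + (6 + (8 + m + l) * 4)
      ≡ 4 + (8 + m + l) * 1 + suc e + (14 + 2 * m + (8 + m) + (3 * l + 3 + (5 + (8 + m + l) * 1)))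
    eq₁ = solve-∀
    eq₂ : ∀ m l e → 14 + 2 * m + (4 + (8 + m + l) * 1 + suc e) ≡ 3 * (8 + m) + (3 + l) + e
    eq₂ = solve-∀

  Balanced-weaken : ∀ {k r r′ π} → r ≤ r′ → Balanced k r π → Balanced k r′ π
  Balanced-weaken {k} {r} {r′} {π} r≤ h with d , refl ← m≤n⇒∃[o]m+o≡n r≤ = begin
    π * W 0 0 (r + d)         ≡⟨ cong (π *_) (W-* 0 0 r 0 0 d) ⟨
    π * (W 0 0 r * W 0 0 d)   ≡⟨ *-assoc π _ _ ⟨
    π * W 0 0 r * W 0 0 d     ≤⟨ *-mono-≤ h (a≤q^ d) ⟩
    W r 0 k * W d 0 0         ≡⟨ W-* r 0 k d 0 0 ⟩
    W (r + d) 0 (k + 0)       ≡⟨ W-cong refl refl (+-identityʳ k) ⟩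
    W (r + d) 0 k             ∎
    where open ≤-Reasoning

  -- On few vertices a star with a single centre suffices for comparison; it lies l α above constant
  -- weight `a`.
  Balanced⇒Bounded : ∀ {r π} l e → r ≤ l + e → Balanced (tri (suc l)) r π → Bounded e (suc l) π
  Balanced⇒Bounded {r} {π} l e r≤ h = 1 , l , refl , *-cancelʳ-≤ _ _ (W 0 0 l) {{W≢0 0 0 l}} (begin
    π * W 0 0 e * W 0 0 l           ≡⟨ trans (*-assoc π _ _) (cong (π *_) (trans (W-* 0 0 e 0 0 l) (W-cong refl refl (+-comm e l)))) ⟩
    π * W 0 0 (l + e)               ≤⟨ Balanced-weaken {π = π} r≤ h ⟩
    W (l + e) 0 (l + tri l)         ≡⟨ W-cong (cong (_+ e) (sym (+-identityʳ l))) refl (+-comm l (tri l)) ⟩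
    W (1 * l + e) 0 (tri l + l)     ≡⟨ W-cong (sym (+-identityʳ _)) refl (cong (_+ l) (sym (+-identityʳ _))) ⟩
    W (1 * l + e + 0) 0 (tri l + 0 + l) ≡⟨ W-* (1 * l + e) 0 (tri l + 0) 0 0 l ⟨
    W (1 * l + e) 0 (tri l + 0) * W 0 0 l ≡⟨ cong (_* W 0 0 l) (W-* (1 * l) 0 (tri l) e 0 0) ⟨
    Star 1 l * W e 0 0 * W 0 0 l    ∎)
    where open ≤-Reasoning

  ΣPairs⇒Bounded : ∀ {r} l e (w : Multigraph (suc l)) → r ≤ l + e →
    ΣPairs (suc l) w ≤ tri (suc l) * a + r → Bounded e (suc l) (ΠPairs (suc l) w)
  ΣPairs⇒Bounded l e w r≤ h = Balanced⇒Bounded {π = ΠPairs (suc l) w} l e r≤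
    (Chord⇒Balanced {π = ΠPairs (suc l) w} (Chord-ΠPairs w) h)

  -- Averaging followed by rounding down: the equation says that `suc B′` strictly exceeds the
  -- averaged bound.
  Sparse-step : ∀ {n s Q} B B′ c (w : Multigraph (3 + n)) → Symmetric w → Sparse s Q w →
    (∀ w′ → Symmetric w′ → Sparse s Q w′ → ΣPairs (2 + n) w′ ≤ B) →
    (1 + n) * suc B′ ≡ suc c + (3 + n) * B → ΣPairs (3 + n) w ≤ B′
  Sparse-step {n} B B′ c w s sparse h eq = s≤s⁻¹ (*-cancelˡ-< (1 + n) _ _ (begin-strict
    (1 + n) * ΣPairs (3 + n) w  ≤⟨ averaging w s B (λ u → h _ (λ i j → s (punchIn u i) (punchIn u j)) (Sparse-∘ {w = w} (punchIn u) (punchIn-injective u _ _) sparse)) ⟩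
    (3 + n) * B                 <⟨ m<n+m ((3 + n) * B) {suc c} (s≤s z≤n) ⟩
    suc c + (3 + n) * B         ≡⟨ eq ⟨
    (1 + n) * suc B′            ∎))
    where open ≤-Reasoning

  Sparse₄-5 : (w : Multigraph 5) → Symmetric w → Sparse 4 (tri 4 * a + 3) w → ΣPairs 5 w ≤ tri 5 * a + 5
  Sparse₄-5 w s sparse = Sparse-step _ _ 2 w s sparse (λ w′ _ h → h id id) (eq a)
    where
    eq : ∀ a → 3 * suc (10 * a + 5) ≡ 3 + 5 * (6 * a + 3)
    eq = solve-∀

  Sparse₅-6 : (w : Multigraph 6) → Symmetric w → Sparse 5 (tri 5 * a + 5) w → ΣPairs 6 w ≤ tri 6 * a + 7
  Sparse₅-6 w s sparse = Sparse-step _ _ 1 w s sparse (λ w′ _ h → h id id) (eq a)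
    where
    eq : ∀ a → 4 * suc (15 * a + 7) ≡ 2 + 6 * (10 * a + 5)
    eq = solve-∀

  Sparse₅-7 : (w : Multigraph 7) → Symmetric w → Sparse 5 (tri 5 * a + 5) w → ΣPairs 7 w ≤ tri 7 * a + 9
  Sparse₅-7 w s sparse = Sparse-step _ _ 0 w s sparse Sparse₅-6 (eq a)
    where
    eq : ∀ a → 5 * suc (21 * a + 9) ≡ 1 + 7 * (15 * a + 7)
    eq = solve-∀

  Sparse₅-8 : (w : Multigraph 8) → Symmetric w → Sparse 5 (tri 5 * a + 5) w → ΣPairs 8 w ≤ tri 8 * a + 12
  Sparse₅-8 w s sparse = Sparse-step _ _ 5 w s sparse Sparse₅-7 (eq a)
    where
    eq : ∀ a → 6 * suc (28 * a + 12) ≡ 6 + 8 * (21 * a + 9)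
    eq = solve-∀

  -- Zykov symmetrisation of labelled graphs

  val : Label → ℕ
  val neg = p
  val nul = a
  val pos = q

  weight : Labelling n → Multigraph n
  weight ℓ i j = val (ℓ i j)

  val-pos : ∀ L → 0 < val L
  val-pos neg = 0<p
  val-pos nul = ≤-trans 0<p p≤a
  val-pos pos = ≤-trans 0<p (≤-trans p≤a a≤q)

  val≤q : ∀ L → val L ≤ q
  val≤q neg = ≤-trans p≤a a≤q
  val≤q nul = a≤q
  val≤q pos = ≤-refl

  p<val : ∀ L → L ≢ neg → p < val L
  p<val neg L≢ = contradiction refl L≢
  p<val nul _ = ≤-reflexive (sym a≡1+p)
  p<val pos _ = ≤-trans (≤-reflexive (sym a≡1+p)) a≤q

  opaque
    unfolding W
    val-W : ∀ L → val L ≡ W ⟦ isPos L ⟧ ⟦ isNeg L ⟧ ⟦ isNul L ⟧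
    val-W neg = sym (trans (*-identityˡ _) (trans (*-identityʳ _) (*-identityʳ p)))
    val-W nul = sym (trans (*-identityˡ _) (trans (*-identityˡ _) (*-identityʳ a)))
    val-W pos = sym (trans (*-identityʳ _) (*-identityʳ q))

  ∏-val : (g : Fin n → Label) → ∏ (val ∘ g) ≡ W (# (isPos ∘ g)) (# (isNeg ∘ g)) (# (isNul ∘ g))
  ∏-val {zero}  g = sym (W-a 0)
  ∏-val {suc n} g = trans (cong₂ _*_ (val-W (g zero)) (∏-val (g ∘ suc))) (W-* ⟦ isPos (g zero) ⟧ _ _ _ _ _)

  -- The diagonal factor `p` is included, which makes the rows of neg-related vertices directly
  -- comparable. Thresholds for a row therefore contain one `p` more than the pairs at the vertex.
  Row : Labelling n → Fin n → ℕ
  Row ℓ v = ∏ (val ∘ ℓ v)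

  Row-W : (ℓ : Labelling n) (v : Fin n) → Row ℓ v ≡ W (#pos ℓ v) (#neg ℓ v) (#nul ℓ v)
  Row-W ℓ v = ∏-val (ℓ v)

  -- The pair `u`, `v` receives the diagonal label of `v`, which is neg. When it was neg before,
  -- cloning changes only the remaining pairs at `u`.
  clone : Labelling n → Fin n → Fin n → Labelling n
  clone ℓ u v x y = ℓ (redirect u v x) (redirect u v y)

  module _ {n : ℕ} {ℓ : Labelling (suc n)} (adm : Admissible ℓ) where

    open Admissible adm

    rest : Fin (suc n) → ℕ
    rest u = ΠPairs n (λ i j → val (ℓ (punchIn u i) (punchIn u j)))

    rest-pos : ∀ u → 0 < rest u
    rest-pos u = ΠPairs-pos (λ i j → val-pos (ℓ (punchIn u i) (punchIn u j)))

    ΠPairs-Row : ∀ u → p * ΠPairs (suc n) (weight ℓ) ≡ Row ℓ u * rest u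
    ΠPairs-Row u = begin
      p * ΠPairs (suc n) (weight ℓ)        ≡⟨ cong₂ _*_ (cong val (sym (diagonal u))) (ΠPairs-punchIn (weight ℓ) (λ i j → cong val (symmetric i j)) u) ⟩
      val (ℓ u u) * (∏ (λ j → val (ℓ u (punchIn u j))) * rest u) ≡⟨ *-assoc (val (ℓ u u)) _ _ ⟨
      val (ℓ u u) * ∏ (λ j → val (ℓ u (punchIn u j))) * rest u   ≡⟨ cong (_* rest u) (∏-punchIn u (val ∘ ℓ u)) ⟨
      Row ℓ u * rest u                     ∎
      where open ≡-Reasoning

    ΠPairs-clone : ∀ u v → ℓ u v ≡ neg → p * ΠPairs (suc n) (weight (clone ℓ u v)) ≡ Row ℓ v * rest u
    ΠPairs-clone u v uv = begin
      p * ΠPairs (suc n) (weight (clone ℓ u v))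
        ≡⟨ cong₂ _*_ (cong val (trans (sym uv) (symmetric u v))) (ΠPairs-punchIn (weight (clone ℓ u v)) (λ i j → cong val (symmetric _ _)) u) ⟩
      val (ℓ v u) * (∏ (λ j → val (clone ℓ u v u (punchIn u j))) * ΠPairs n (λ i j → val (clone ℓ u v (punchIn u i) (punchIn u j))))
        ≡⟨ cong (val (ℓ v u) *_) (cong₂ _*_
             (∏-cong (λ j → cong val (cong₂ ℓ (redirect-≡ u v) (redirect-≢ u v _ (punchInᵢ≢i u j)))))
             (ΠPairs-cong (λ i j _ → cong val (cong₂ ℓ (redirect-≢ u v _ (punchInᵢ≢i u i)) (redirect-≢ u v _ (punchInᵢ≢i u j)))))) ⟩
      val (ℓ v u) * (∏ (λ j → val (ℓ v (punchIn u j))) * rest u) ≡⟨ *-assoc (val (ℓ v u)) _ _ ⟨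
      val (ℓ v u) * ∏ (λ j → val (ℓ v (punchIn u j))) * rest u   ≡⟨ cong (_* rest u) (∏-punchIn u (val ∘ ℓ v)) ⟨
      Row ℓ v * rest u ∎
      where open ≡-Reasoning

    clone-≤ : ∀ u v → ℓ u v ≡ neg → Row ℓ u ≤ Row ℓ v →
      ΠPairs (suc n) (weight ℓ) ≤ ΠPairs (suc n) (weight (clone ℓ u v))
    clone-≤ u v uv le = *-cancelˡ-≤ p (subst₂ _≤_ (sym (ΠPairs-Row u)) (sym (ΠPairs-clone u v uv)) (*-monoˡ-≤ (rest u) le))

    clone-< : ∀ u v → ℓ u v ≡ neg → Row ℓ u < Row ℓ v →
      ΠPairs (suc n) (weight ℓ) < ΠPairs (suc n) (weight (clone ℓ u v))
    clone-< u v uv lt = *-cancelˡ-< p _ _ (subst₂ _<_ (sym (ΠPairs-Row u)) (sym (ΠPairs-clone u v uv))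
      (*-monoˡ-< (rest u) {{>-nonZero (rest-pos u)}} lt))

    Row-clone : ∀ u v x → x ≢ u → Row (clone ℓ u v) x * val (ℓ x u) ≡ Row ℓ x * val (ℓ x v)
    Row-clone u v x x≢u = begin
      Row (clone ℓ u v) x * val (ℓ x u)
        ≡⟨ cong (_* val (ℓ x u)) (trans (∏-punchIn u (val ∘ clone ℓ u v x)) (cong₂ _*_
             (cong val (cong₂ ℓ (redirect-≢ u v x x≢u) (redirect-≡ u v)))
             (∏-cong (λ j → cong val (cong₂ ℓ (redirect-≢ u v x x≢u) (redirect-≢ u v _ (punchInᵢ≢i u j))))))) ⟩
      val (ℓ x v) * R * val (ℓ x u) ≡⟨ swap (val (ℓ x v)) R (val (ℓ x u)) ⟩
      val (ℓ x u) * R * val (ℓ x v) ≡⟨ cong (_* val (ℓ x v)) (∏-punchIn u (val ∘ ℓ x)) ⟨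
      Row ℓ x * val (ℓ x v) ∎
      where
      open ≡-Reasoning
      R : ℕ
      R = ∏ (λ j → val (ℓ x (punchIn u j)))
      swap : ∀ x y z → x * y * z ≡ z * y * x
      swap = solve-∀

  -- If neg is not transitive at u, v, x although neg-related vertices have equal rows, then turning u
  -- into a clone of v lowers the row of x, so that turning x into a clone of v as well is a strict gain.
  improve : {ℓ : Labelling (suc n)} → Admissible ℓ →
    (∃ λ ℓ′ → Admissible ℓ′ × ΠPairs (suc n) (weight ℓ) < ΠPairs (suc n) (weight ℓ′)) ⊎ Transitive ℓ
  improve {n} {ℓ} adm with any? (λ u → any? (λ v → neg? (ℓ u v) Dec.×-dec (Row ℓ u <? Row ℓ v)))
  ... | yes (u , v , uv , lt) = inj₁ (clone ℓ u v , pullback (redirect u v) adm , clone-< adm u v uv lt)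
  ... | no none with any? (λ u → any? (λ v → any? (λ x → neg? (ℓ u v) Dec.×-dec (neg? (ℓ v x) Dec.×-dec Dec.¬? (neg? (ℓ u x))))))
  ...   | no trans′ = inj₂ λ u v x uv vx → Dec.decidable-stable (neg? (ℓ u x)) (λ ux → trans′ (u , v , x , uv , vx , ux))
  ...   | yes (u , v , x , uv , vx , ux) = inj₁ (clone ℓ′ x v , pullback (redirect x v) adm′ ,
    ≤-<-trans (clone-≤ adm u v uv (≮⇒≥ λ lt → none (v , u , trans (symmetric v u) uv , lt))) (clone-< adm′ x v xv Row-xv))
    where
    open Admissible adm
    ℓ′ : Labelling (suc n)
    ℓ′ = clone ℓ u v
    adm′ : Admissible ℓ′
    adm′ = pullback (redirect u v) adm
    x≢u : x ≢ u
    x≢u refl = ux (diagonal u)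
    v≢u : v ≢ u
    v≢u refl = ux vx
    xv : ℓ′ x v ≡ neg
    xv = trans (cong₂ ℓ (redirect-≢ u v x x≢u) (redirect-≢ u v v v≢u)) (trans (symmetric x v) vx)
    Row-v : Row ℓ′ v ≡ Row ℓ v
    Row-v = *-cancelʳ-≡ _ _ p (subst₂ (λ s t → Row ℓ′ v * s ≡ Row ℓ v * t)
      (cong val (trans (symmetric v u) uv)) (cong val (diagonal v)) (Row-clone adm u v v v≢u))
    Row-x : Row ℓ′ x < Row ℓ x
    Row-x = *-cancelʳ-< (val (ℓ x u)) _ _ (subst (_< Row ℓ x * val (ℓ x u)) (sym (Row-clone adm u v x x≢u))
      (*-monoʳ-< (Row ℓ x) {{>-nonZero (∏-pos (λ j → val-pos (ℓ x j)))}}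
        (subst (λ L → val L < val (ℓ x u)) (trans (sym vx) (symmetric v x)) (p<val (ℓ x u) (λ xu → ux (trans (symmetric u x) xu))))))
    Row-xv : Row ℓ′ x < Row ℓ′ v
    Row-xv = <-≤-trans Row-x (subst (Row ℓ x ≤_) (sym Row-v) (≮⇒≥ λ lt → none (v , x , vx , lt)))

  -- Each use of `improve` strictly raises a product that cannot exceed the one with all weights
  -- `q`; `k` counts what is left.
  symmetrise : {ℓ : Labelling (suc n)} → Admissible ℓ →
    ∃ λ ℓ′ → Admissible ℓ′ × Transitive ℓ′ × ΠPairs (suc n) (weight ℓ) ≤ ΠPairs (suc n) (weight ℓ′)
  symmetrise {n} adm = go bound adm (m≤n+m bound _)
    where
    bound : ℕ
    bound = ΠPairs (suc n) (λ _ _ → q)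
    go : ∀ k {ℓ : Labelling (suc n)} → Admissible ℓ → bound ≤ ΠPairs (suc n) (weight ℓ) + k →
      ∃ λ ℓ′ → Admissible ℓ′ × Transitive ℓ′ × ΠPairs (suc n) (weight ℓ) ≤ ΠPairs (suc n) (weight ℓ′)
    go k {ℓ} adm h with improve adm
    ... | inj₂ tr = ℓ , adm , tr , ≤-refl
    go zero {ℓ} adm h | inj₁ (ℓ′ , adm′ , lt) = contradiction
      (≤-trans lt (≤-trans (ΠPairs-mono (λ i j _ → val≤q (ℓ′ i j))) (≤-trans h (≤-reflexive (+-identityʳ _))))) (<-irrefl refl)
    go (suc k) {ℓ} adm h | inj₁ (ℓ′ , adm′ , lt) with go k adm′ (≤-trans h (≤-trans (≤-reflexive (+-suc _ k)) (+-monoˡ-≤ k lt)))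
    ... | ℓ″ , adm″ , tr , le = ℓ″ , adm″ , tr , ≤-trans (<⇒≤ lt) le

  -- Stars as coloured graphs, and row products

  a∸1≡p : a ∸ 1 ≡ p
  a∸1≡p = cong (_∸ 1) a≡1+p

  coloured : (Fin n → Fin 2) → Multigraph n
  coloured c i j = multT a 1 (c i) (c j)

  ∏-multT-0 : (c : Fin n → Fin 2) → ∏ (λ j → multT a 1 0F (c j)) ≡ W (ones c) (zeros c) 0
  ∏-multT-0 {zero} c = sym (W-a 0)
  ∏-multT-0 {suc n} c = trans (cong₂ _*_ (entry (c zero)) (∏-multT-0 (c ∘ suc))) (W-* ⟦ is1 (c zero) ⟧ _ _ _ _ _)
    where
    entry : ∀ i → multT a 1 0F i ≡ W ⟦ is1 i ⟧ ⟦ is0 i ⟧ 0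
    entry 0F = trans a∸1≡p (val-W neg)
    entry 1F = trans (sym q≡1+a) (val-W pos)

  ∏-multT-1 : (c : Fin n → Fin 2) → ∏ (λ j → multT a 1 1F (c j)) ≡ W (zeros c) 0 (ones c)
  ∏-multT-1 {zero} c = sym (W-a 0)
  ∏-multT-1 {suc n} c = trans (cong₂ _*_ (entry (c zero)) (∏-multT-1 (c ∘ suc))) (W-* ⟦ is0 (c zero) ⟧ _ _ _ _ _)
    where
    entry : ∀ i → multT a 1 1F i ≡ W ⟦ is0 i ⟧ 0 ⟦ is1 i ⟧
    entry 0F = trans (sym q≡1+a) (val-W pos)
    entry 1F = val-W nul

  ΠPairs-coloured : (c : Fin n → Fin 2) → ΠPairs n (coloured c) ≡ Star (zeros c) (ones c)
  ΠPairs-coloured {zero} c = sym (W-a 0)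
  ΠPairs-coloured {suc n} c = go (c zero) refl
    where
    c′ : Fin n → Fin 2
    c′ = c ∘ suc
    go : ∀ i → c zero ≡ i → ΠPairs (suc n) (coloured c) ≡ Star (⟦ is0 (c zero) ⟧ + zeros c′) (⟦ is1 (c zero) ⟧ + ones c′)
    go 0F eq rewrite eq = trans (cong₂ _*_ (∏-multT-0 c′) (ΠPairs-coloured c′))
      (trans (*-comm (W (ones c′) (zeros c′) 0) _) (sym (Star-suc-centre (zeros c′) (ones c′))))
    go 1F eq rewrite eq = trans (cong₂ _*_ (∏-multT-1 c′) (ΠPairs-coloured c′))
      (trans (*-comm (W (zeros c′) 0 (ones c′)) _) (sym (Star-suc-leaf (zeros c′) (ones c′))))

  Bounded₀ : ∀ {π} m l → m + l ≡ n → π ≤ Star m l → Bounded 0 n π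
  Bounded₀ m l eq le = m , l , eq , *-monoˡ-≤ (W 0 0 0) le

  Bounded₀-optimal : ∀ {π m l} → Bounded 0 n π → m + l ≡ n → Optimal m l → π ≤ Star m l
  Bounded₀-optimal {π = π} {m} {l} b eq opt = *-cancelʳ-≤ _ _ (W 0 0 0) {{W≢0 0 0 0}} (Bounded-optimal {π = π} {m} {l} b eq opt)

  -- The neg-class of `v` supplies the centres, transitivity making it a class of weight a - 1. All
  -- other vertices are pos-neighbours of `v`, among which `triangle` forbids pos.
  star-bound : {ℓ : Labelling n} → Admissible ℓ → Transitive ℓ → ∀ v → #nul ℓ v ≡ 0 → Bounded 0 n (ΠPairs n (weight ℓ))
  star-bound {n} {ℓ} adm tr v no-nul = Bounded₀ (zeros c) (ones c) (zeros+ones c)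
    (≤-trans (ΠPairs-mono (λ i j _ → entry i j (ℓ v i) (ℓ v j) refl refl)) (≤-reflexive (ΠPairs-coloured c)))
    where
    open Admissible adm
    colour : Label → Fin 2
    colour neg = 0F
    colour _   = 1F
    c : Fin n → Fin 2
    c x = colour (ℓ v x)
    not-nul : ∀ x → ℓ v x ≢ nul
    not-nul x eq = contradiction (≤-trans (#-pos (isNul ∘ ℓ v) x (cong isNul eq)) (≤-reflexive no-nul)) λ ()
    entry : ∀ i j L L′ → ℓ v i ≡ L → ℓ v j ≡ L′ → val (ℓ i j) ≤ multT a 1 (colour (ℓ v i)) (colour (ℓ v j))
    entry i j neg neg vi vj rewrite vi | vj | tr i v j (trans (symmetric i v) vi) vj = ≤-reflexive (sym a∸1≡p)
    entry i j neg pos vi vj rewrite vi | vj = ≤-trans (val≤q (ℓ i j)) (≤-reflexive q≡1+a)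
    entry i j pos neg vi vj rewrite vi | vj = ≤-trans (val≤q (ℓ i j)) (≤-reflexive q≡1+a)
    entry i j pos pos vi vj rewrite vi | vj = leaf (ℓ i j) (triangle i v j (trans (symmetric i v) vi) vj)
      where
      leaf : ∀ L → L ≢ pos → val L ≤ a
      leaf neg _ = p≤a
      leaf nul _ = ≤-refl
      leaf pos L≢ = contradiction refl L≢
    entry i j nul _ vi _ = contradiction vi (not-nul i)
    entry i j neg nul _ vj = contradiction vj (not-nul j)
    entry i j pos nul _ vj = contradiction vj (not-nul j)

  -- The way back from labels to weights, so that the induction hypothesis applies after
  -- symmetrisation. Four vertices weigh 6 (a - 1) plus the ranks, and `rank-sum` allows 9.
  Sparse-weight : {ℓ : Labelling n} → Admissible ℓ → Sparse 4 (tri 4 * a + 3) (weight ℓ)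
  Sparse-weight {ℓ = ℓ} adm x _ = begin
    ΣPairs 4 (λ i j → val (ℓ (x i) (x j)))
      ≡⟨ ΣPairs-cong (λ i j → val-rank (ℓ (x i) (x j))) ⟩
    ΣPairs 4 (λ i j → p + rank (ℓ (x i) (x j)))
      ≡⟨ collect p (ρ 0F 1F) (ρ 0F 2F) (ρ 0F 3F) (ρ 1F 2F) (ρ 1F 3F) (ρ 2F 3F) ⟩
    6 * p + (ρ 0F 1F + ρ 0F 2F + ρ 0F 3F + ρ 1F 2F + ρ 1F 3F + ρ 2F 3F)
      ≤⟨ +-monoʳ-≤ (6 * p) (rank-sum _ _ _ _ _ _ (△ 0F 1F 2F) (△ 0F 1F 3F) (△ 0F 2F 3F) (△ 1F 2F 3F)
           (λ { (h₁ , h₂ , h₃ , h₄ , d , d′) → d′ (square (x 0F) (x 2F) (x 1F) (x 3F) h₁ h₂ (flip h₃) h₄ d) })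
           (λ { (h₁ , h₂ , h₃ , h₄ , d , d′) → d′ (square (x 0F) (x 3F) (x 1F) (x 2F) h₁ h₂ (flip h₃) (flip h₄) d) })
           (λ { (h₁ , h₂ , h₃ , h₄ , d , d′) → d′ (square (x 0F) (x 1F) (x 2F) (x 3F) h₁ h₂ h₃ h₄ d) })) ⟩
    6 * p + 9 ≡⟨ shift p ⟩
    6 * suc p + 3 ≡⟨ cong (λ z → 6 * z + 3) a≡1+p ⟨
    6 * a + 3 ∎
    where
    open ≤-Reasoning
    open Admissible adm
    ρ : Fin 4 → Fin 4 → ℕ
    ρ i j = rank (ℓ (x i) (x j))
    flip : ∀ {i j} → ℓ i j ≡ pos → ℓ j i ≡ pos
    flip {i} {j} = trans (symmetric j i)
    △ : ∀ i j k → Triangle (ℓ (x i) (x j)) (ℓ (x i) (x k)) (ℓ (x j) (x k))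
    △ i j k (ij , ik , jk) = triangle (x i) (x j) (x k) ij jk ik
    val-rank : ∀ L → val L ≡ p + rank L
    val-rank neg = sym (+-identityʳ p)
    val-rank nul = trans a≡1+p (+-comm 1 p)
    val-rank pos = trans q≡1+a (trans (cong suc a≡1+p) (+-comm 2 p))
    collect : ∀ p b c d e f g → p + b + (p + c + (p + d + 0)) + (p + e + (p + f + 0) + (p + g + 0 + (0 + 0)))
      ≡ 6 * p + (b + c + d + e + f + g)
    collect = solve-∀
    shift : ∀ p → 6 * p + 9 ≡ 6 * suc p + 3
    shift = solve-∀

  pq≤aa^ : ∀ j → W j j 0 ≤ W 0 0 (2 * j)
  pq≤aa^ zero    = ≤-refl
  pq≤aa^ (suc j) = begin
    W (suc j) (suc j) 0     ≡⟨ W-* 1 1 0 j j 0 ⟨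
    W 1 1 0 * W j j 0       ≤⟨ *-mono-≤ pq≤aa (pq≤aa^ j) ⟩
    W 0 0 2 * W 0 0 (2 * j) ≡⟨ W-* 0 0 2 0 0 (2 * j) ⟩
    W 0 0 (2 + 2 * j)       ≡⟨ W-cong refl refl (sym (*-suc 2 j)) ⟩
    W 0 0 (2 * suc j)       ∎
    where open ≤-Reasoning

  -- Every `q` beyond the first `m` is paired with one of the `c` spare factors `p`, and p q ≤ a².
  W-few-pos : ∀ {d c z m l} → d + suc c + z ≡ suc (m + l) → d ≤ m + c → W d (suc c) z ≤ W m 1 l
  W-few-pos {d} {c} {z} {m} {l} eq d≤ with ≤-total d m
  ... | inj₁ d≤m = W-raise d≤m (s≤s z≤n) (trans eq (trans (sym (+-suc m l)) (sym (trans (+-assoc m 1 l) refl))))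
  ... | inj₂ m≤d with j , refl ← m≤n⇒∃[o]m+o≡n m≤d with h , refl ← m≤n⇒∃[o]m+o≡n (+-cancelˡ-≤ m j c d≤) = begin
    W (m + j) (suc (j + h)) z         ≡⟨ W-cong (+-comm m j) (sym (+-suc j h)) refl ⟩
    W (j + m) (j + suc h) (0 + z)     ≤⟨ W-shift m (suc h) z (pq≤aa^ j) ⟩
    W m (suc h) (2 * j + z)           ≤⟨ W-raise ≤-refl (s≤s z≤n) (trans (eq′ m j h z) (trans eq (trans (sym (+-suc m l)) (sym (+-assoc m 1 l))))) ⟩
    W m 1 l                           ∎
    where
    open ≤-Reasoning
    eq′ : ∀ m j h z → m + suc h + (2 * j + z) ≡ m + j + suc (j + h) + z
    eq′ = solve-∀

  module _ {k : ℕ} (ℓ : Labelling (suc k)) (adm : Admissible ℓ) where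

    open Admissible adm

    #labels : ∀ v → #pos ℓ v + #neg ℓ v + #nul ℓ v ≡ suc k
    #labels v = #-labels (ℓ v)

    1≤#neg : ∀ v → 1 ≤ #neg ℓ v
    1≤#neg v = #-pos (isNeg ∘ ℓ v) v (cong isNeg (diagonal v))

    few-pos : ∀ {m l} v → m + l ≡ k → W m 1 l < Row ℓ v → m + #neg ℓ v ≤ #pos ℓ v
    few-pos {m} {l} v refl high with #neg ℓ v in eq | 1≤#neg v
    ... | suc c | _ = ≮⇒≥ λ lt → <⇒≱ high (≤-trans (≤-reflexive (trans (Row-W ℓ v) (W-cong refl eq refl)))
      (W-few-pos (subst (λ y → #pos ℓ v + y + #nul ℓ v ≡ suc (m + l)) eq (#labels v)) (s≤s⁻¹ (≤-trans lt (≤-reflexive (+-suc m c))))))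

    -- With more than `m` factors `p` and at least one `a`, the row has at most l - 1 factors `q`.
    -- Optimality of the star then pushes it below the threshold.
    many-neg : ∀ {m l} v → m + l ≡ k → Optimal m l → W m 1 l < Row ℓ v → m < #neg ℓ v → #nul ℓ v ≡ 0
    many-neg {m} {l} v refl opt high m< with #nul ℓ v in eq
    ... | zero  = refl
    ... | suc z = contradiction (≤-trans (≤-reflexive (Row-W ℓ v)) (go l refl opt)) (<⇒≱ high)
      where
      d c : ℕ
      d = #pos ℓ v
      c = #neg ℓ v
      total : d + c + suc z ≡ suc (m + l)
      total = subst (λ y → d + c + y ≡ suc (m + l)) eq (#labels v)
      go : ∀ l₀ → l ≡ l₀ → Optimal m l₀ → W d c (#nul ℓ v) ≤ W m 1 l
      go zero refl _ = contradiction (begin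
        suc (suc m)   ≤⟨ s≤s (≤-trans m< (≤-trans (m≤n+m c d) (m≤m+n (d + c) z))) ⟩
        suc (d + c + z) ≡⟨ trans (sym (+-suc (d + c) z)) (trans total (cong suc (+-identityʳ m))) ⟩
        suc m         ∎) (<-irrefl refl)
        where open ≤-Reasoning
      go (suc l′) refl opt′ = begin
        W d c (#nul ℓ v) ≡⟨ W-cong refl refl eq ⟩
        W d c (suc z)    ≤⟨ W-raise d≤ m< (trans total (eq₁ m l′)) ⟩
        W l′ (suc m) 1   ≡⟨ W-cong (sym (+-identityʳ l′)) (+-comm 1 m) refl ⟩
        W (l′ + 0) (m + 1) (0 + 1) ≤⟨ W-shift 0 1 1 (optimal-derivative m l′ opt′) ⟩
        W (m + 0) 1 (l′ + 1) ≡⟨ W-cong (+-identityʳ m) refl (+-comm l′ 1) ⟩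
        W m 1 (suc l′)   ∎
        where
        open ≤-Reasoning
        eq₁ : ∀ m l → suc (m + suc l) ≡ l + suc m + 1
        eq₁ = solve-∀
        d≤ : d ≤ l′
        d≤ = +-cancelʳ-≤ (suc m + 1) d l′ (≤-trans (+-monoʳ-≤ d (+-mono-≤ m< (s≤s z≤n)))
          (≤-reflexive (trans (sym (+-assoc d c (suc z))) (trans total (trans (eq₁ m l′) (+-assoc l′ (suc m) 1))))))

  p≡W : p ≡ W 0 1 0
  p≡W = val-W neg

  q≡W : q ≡ W 1 0 0
  q≡W = val-W pos

  ΠPairs-Row-≤ : {ℓ : Labelling (suc n)} (adm : Admissible ℓ) → ∀ u {x y z x′ y′ z′} →
    Row ℓ u ≤ W x (suc y) z → rest adm u ≤ W x′ y′ z′ → ΠPairs (suc n) (weight ℓ) ≤ W (x + x′) (y + y′) (z + z′)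
  ΠPairs-Row-≤ {n} {ℓ} adm u {x} {y} {z} {x′} {y′} {z′} h h′ = *-cancelˡ-≤ p (begin
    p * ΠPairs (suc n) (weight ℓ)                 ≡⟨ ΠPairs-Row adm u ⟩
    Row ℓ u * rest adm u                          ≤⟨ *-mono-≤ h h′ ⟩
    W x (suc y) z * W x′ y′ z′                    ≡⟨ W-* x (suc y) z x′ y′ z′ ⟩
    W (x + x′) (suc (y + y′)) (z + z′)            ≡⟨ W-* 0 1 0 (x + x′) (y + y′) (z + z′) ⟨
    W 0 1 0 * W (x + x′) (y + y′) (z + z′)        ≡⟨ cong (_* W (x + x′) (y + y′) (z + z′)) p≡W ⟨
    p * W (x + x′) (y + y′) (z + z′)              ∎)
    where open ≤-Reasoning

  -- 4-sets

  Theorem₄ : ℕ → ℕ → Set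
  Theorem₄ e n = ∀ (w : Multigraph n) → Symmetric w → Sparse 4 (tri 4 * a + 3) w → Bounded e n (ΠPairs n w)

  weight-symmetric : (ℓ : Labelling n) → Admissible ℓ → Symmetric (weight ℓ)
  weight-symmetric ℓ adm i j = cong val (Admissible.symmetric adm i j)

  labelled : ∀ {k} → 6 ≤ k → Theorem₄ 0 k → (ℓ : Labelling (suc k)) → Admissible ℓ → Transitive ℓ →
    Bounded 0 (suc k) (ΠPairs (suc k) (weight ℓ))
  labelled {k} 6≤k ih ℓ adm tr with optimal k
  ... | m , l , eq , opt with any? (λ v → Row ℓ v ≤? W m 1 l)
  ...   | yes (v , low) = Bounded₀ m (suc l) (trans (+-suc m l) (cong suc eq))
    (≤-trans (ΠPairs-Row-≤ adm v low rest≤) (≤-reflexive (trans (sym (W-* m 0 l _ _ _)) (trans (*-comm (W m 0 l) _) (sym (Star-suc-leaf m l))))))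
    where
    adm′ : Admissible (λ i j → ℓ (punchIn v i) (punchIn v j))
    adm′ = pullback (punchIn v) adm
    rest≤ : rest adm v ≤ Star m l
    rest≤ = Bounded₀-optimal {m = m} {l} (ih _ (weight-symmetric _ adm′) (Sparse-weight adm′)) eq opt
  ...   | no ¬low with any? (λ v → suc m ≤? #neg ℓ v)
  ...     | yes (v , m<) = star-bound adm tr v (many-neg ℓ adm v eq opt (≰⇒> λ le → ¬low (v , le)) m<)
  ...     | no ¬large = contradiction (≤-trans (s≤s 6≤k) (≤-trans k≤ (s≤s (*-monoʳ-≤ 4 m≤1)))) (λ { (s≤s (s≤s (s≤s (s≤s (s≤s ()))))) })
    where
    high : ∀ v → W m 1 l < Row ℓ v
    high v = ≰⇒> λ le → ¬low (v , le)
    #neg≤m : ∀ v → #neg ℓ v ≤ m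
    #neg≤m v = ≮⇒≥ λ lt → ¬large (v , lt)
    k≤ : suc k ≤ suc (4 * m)
    k≤ = s≤s (≤-trans (≤-reflexive (sym eq)) (optimal-centre m l opt (≤-trans (s≤s (s≤s z≤n)) (≤-trans 6≤k (≤-reflexive (sym eq))))))
    5m≤ : 5 * m ≤ suc k
    5m≤ with maximal (#neg ℓ)
    -- The packing starts at a vertex of the largest neg-class, whose size is the common bound `c`.
    ... | v , max with Packing.packing ℓ adm m (#neg ℓ v) max (λ u → few-pos ℓ adm u eq (high u)) v
    ...   | d , h₁ , h₂ = packing-arithmetic d (#neg ℓ v) m (#pos ℓ v) (suc k) (≤-trans (1≤#neg ℓ adm v) (#neg≤m v)) (#neg≤m v) (few-pos ℓ adm v eq (high v)) h₁ h₂
    -- From 5 m ≤ k + 1 and k ≤ 4 m; then k ≤ 4, against 6 ≤ k.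
    m≤1 : m ≤ 1
    m≤1 = +-cancelʳ-≤ (4 * m) m 1 (≤-trans 5m≤ k≤)

  Theorem₄-4 : Theorem₄ 0 4
  Theorem₄-4 w s sparse = ΣPairs⇒Bounded 3 0 w ≤-refl (sparse id id)

  -- The slack is needed: the pentagon with weights a + 1 on its sides and a on its diagonals beats every star.
  Theorem₄-5 : Theorem₄ 1 5
  Theorem₄-5 w s sparse = ΣPairs⇒Bounded 4 1 w ≤-refl (Sparse₄-5 w s sparse)

  ΣPairs⇒W : ∀ {k r z} (w : Multigraph k) → tri k ≡ r + z → ΣPairs k w ≤ tri k * a + r → ΠPairs k w ≤ W r 0 z
  ΣPairs⇒W {k} {r} {z} w eq h = *-cancelʳ-≤ _ _ (W 0 0 r) {{W≢0 0 0 r}} (begin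
    ΠPairs k w * W 0 0 r ≤⟨ Chord⇒Balanced {π = ΠPairs k w} (Chord-ΠPairs w) h ⟩
    W r 0 (tri k)        ≡⟨ W-cong (sym (+-identityʳ r)) refl (trans eq (+-comm r z)) ⟩
    W (r + 0) 0 (z + r)  ≡⟨ W-* r 0 z 0 0 r ⟨
    W r 0 z * W 0 0 r    ∎)
    where open ≤-Reasoning

  ΠPairs-weight-4 : (ℓ : Labelling 4) → Admissible ℓ → ΠPairs 4 (weight ℓ) ≤ W 3 0 3
  ΠPairs-weight-4 ℓ adm = ΣPairs⇒W (weight ℓ) refl (Sparse-weight adm id id)

  ΠPairs-weight-5 : (ℓ : Labelling 5) → Admissible ℓ → ΠPairs 5 (weight ℓ) ≤ W 5 0 5
  ΠPairs-weight-5 ℓ adm = ΣPairs⇒W (weight ℓ) refl (Sparse₄-5 (weight ℓ) (weight-symmetric ℓ adm) (Sparse-weight adm))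

  -- `Star 2 4` is `W 8 1 6`, which differs from `W 6 0 9` by a single use of a³ < p q².
  Bounded-six : ∀ {π} → π ≤ W 6 0 9 → Bounded 0 6 π
  Bounded-six le = Bounded₀ 2 4 refl (≤-trans le (W-shift 6 0 6 (<⇒≤ aaa<pqq)))

  -- There is no exact bound on five vertices to induct on. Deleting a vertex leaves at most
  -- `W 5 0 5`, so a row of at most `W 3 2 1` (one `p` being diagonal) gives `Star 2 4`. If no row
  -- is that small, a neg-class with two vertices leads to a star. With singleton classes, packing
  -- excludes three pos-neighbours, and pos-degrees of at most two give `W 6 0 9`.
  labelled-six : (ℓ : Labelling 6) → Admissible ℓ → Transitive ℓ → Bounded 0 6 (ΠPairs 6 (weight ℓ))
  labelled-six ℓ adm tr with any? (λ v → Row ℓ v ≤? W 3 2 1)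
  ... | yes (v , low) = Bounded₀ 2 4 refl (ΠPairs-Row-≤ adm v {3} {1} {1} {5} {0} {5} low (ΠPairs-weight-5 _ (pullback (punchIn v) adm)))
  ... | no ¬low with any? (λ v → 2 ≤? #neg ℓ v)
  ...   | yes (v , 2≤) = star-bound adm tr v (n≤0⇒n≡0 (+-cancelˡ-≤ 6 _ _ (≤-trans (+-monoˡ-≤ (#nul ℓ v) (+-mono-≤ 4≤ 2≤)) (≤-reflexive (#labels ℓ adm v)))))
    where
    4≤ : 4 ≤ #pos ℓ v
    4≤ = ≰⇒> λ ≤3 → ¬low (v , ≤-trans (≤-reflexive (Row-W ℓ v)) (W-raise ≤3 2≤ (#labels ℓ adm v)))
  ...   | no ¬large with any? (λ v → 3 ≤? #pos ℓ v)
  ...     | yes (v , 3≤) = contradiction (packed (Packing.packing ℓ adm 1 1 #neg≤1 2≤#pos v)) (<-irrefl refl)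
    where
    #neg≤1 : ∀ u → #neg ℓ u ≤ 1
    #neg≤1 u = ≮⇒≥ λ lt → ¬large (u , lt)
    2≤#pos : ∀ u → 1 + #neg ℓ u ≤ #pos ℓ u
    2≤#pos u = ≤-trans (s≤s (#neg≤1 u)) (≰⇒> λ ≤1 → ¬low (u , ≤-trans (≤-reflexive (Row-W ℓ u))
      (≤-trans (W-raise ≤1 (1≤#neg ℓ adm u) (#labels ℓ adm u)) (W-shift 1 1 1 (<⇒≤ aaa<pqq)))))
    packed : (∃ λ d → #pos ℓ v ≤ d * 1 × #neg ℓ v + 2 * #pos ℓ v + d * 1 ≤ 6 + d * 1) → 7 ≤ 6
    packed (d , _ , h) = ≤-trans (+-mono-≤ (1≤#neg ℓ adm v) (*-monoʳ-≤ 2 3≤)) (+-cancelʳ-≤ (d * 1) _ _ h)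
  ...     | no ¬three with any? (λ y → ℓ zero y ≟ᴸ pos)
  ...       | no ¬pos = Bounded-six (≤-trans (ΠPairs-Row-≤ adm zero {0} {0} {5} {5} {0} {5} Row₀ rest₀) (W-raise {5} {6} {0} {0} {10} {9} (n≤1+n 5) z≤n refl))
    where
    Row₀ : Row ℓ zero ≤ W 0 1 5
    Row₀ = ≤-trans (≤-reflexive (Row-W ℓ zero)) (W-raise (≤-reflexive (#-zero (isPos ∘ ℓ zero) (λ y eq → ¬pos (y , isPos⇒ eq)))) (1≤#neg ℓ adm zero) (#labels ℓ adm zero))
    rest₀ : rest adm zero ≤ W 5 0 5
    rest₀ = ΠPairs-weight-5 _ (pullback suc adm)
  ...       | yes (zero , eq) = contradiction (trans (sym eq) (Admissible.diagonal adm zero)) λ ()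
  ...       | yes (suc y , eq) = Bounded-six (ΠPairs-Row-≤ adm zero {2} {0} {3} {4} {0} {6} (Row≤ zero) rest₀)
    where
    Row≤ : ∀ u → Row ℓ u ≤ W 2 1 3
    Row≤ u = ≤-trans (≤-reflexive (Row-W ℓ u)) (W-raise (≮⇒≥ λ lt → ¬three (u , lt)) (1≤#neg ℓ adm u) (#labels ℓ adm u))
    adm′ : Admissible (λ i j → ℓ (suc i) (suc j))
    adm′ = pullback suc adm
    -- After deletion of `zero` its pos-neighbour `y` has one factor `q` less.
    Row′ : Row (λ i j → ℓ (suc i) (suc j)) y ≤ W 1 1 3
    Row′ = *-cancelˡ-≤ q (begin
      q * ∏ (λ j → val (ℓ (suc y) (suc j)))              ≡⟨ cong (λ L → val L * ∏ (λ j → val (ℓ (suc y) (suc j)))) (trans (Admissible.symmetric adm (suc y) zero) eq) ⟨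
      Row ℓ (suc y)                                      ≤⟨ Row≤ (suc y) ⟩
      W 2 1 3                                            ≡⟨ W-* 1 0 0 1 1 3 ⟨
      W 1 0 0 * W 1 1 3                                  ≡⟨ cong (_* W 1 1 3) q≡W ⟨
      q * W 1 1 3 ∎)
      where open ≤-Reasoning
    rest₀ : rest adm zero ≤ W 4 0 6
    rest₀ = ΠPairs-Row-≤ adm′ y {1} {0} {3} {3} {0} {3} Row′ (ΠPairs-weight-4 _ (pullback (punchIn y) adm′))

  -- From weights to labels

  classify : ∀ {x} {A : Set} → Dec A → Tri (x < a) (x ≡ a) (a < x) → Label
  classify (yes _) _            = neg
  classify (no _)  (tri< _ _ _) = neg
  classify (no _)  (tri≈ _ _ _) = nul
  classify (no _)  (tri> _ _ _) = pos

  label : Multigraph n → Labelling n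
  label w i j = classify (i ≟ᶠ j) (<-cmp (w i j) a)

  label-pos : (w : Multigraph n) → ∀ i j → label w i j ≡ pos → i ≢ j × suc a ≤ w i j
  label-pos w i j eq with i ≟ᶠ j | <-cmp (w i j) a
  ... | no i≢j | tri> _ _ lt = i≢j , lt

  label-≢neg : (w : Multigraph n) → ∀ i j → label w i j ≢ neg → i ≢ j × a ≤ w i j
  label-≢neg w i j ≢neg with i ≟ᶠ j | <-cmp (w i j) a
  ... | yes _  | _            = contradiction refl ≢neg
  ... | no _   | tri< _ _ _   = contradiction refl ≢neg
  ... | no i≢j | tri≈ _ eq _  = i≢j , ≤-reflexive (sym eq)
  ... | no i≢j | tri> _ _ lt  = i≢j , <⇒≤ lt

  label-symmetric : (w : Multigraph n) → Symmetric w → Symmetric (label w)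
  label-symmetric w s i j rewrite s i j with i ≟ᶠ j | j ≟ᶠ i | <-cmp (w j i) a
  ... | yes _   | yes _   | _          = refl
  ... | no _    | no _    | tri< _ _ _ = refl
  ... | no _    | no _    | tri≈ _ _ _ = refl
  ... | no _    | no _    | tri> _ _ _ = refl
  ... | yes i≡j | no j≢i  | _          = contradiction (sym i≡j) j≢i
  ... | no i≢j  | yes j≡i | _          = contradiction (sym j≡i) i≢j

  label-diagonal : (w : Multigraph n) → ∀ i → label w i i ≡ neg
  label-diagonal w i with i ≟ᶠ i
  ... | yes _  = refl
  ... | no i≢i = contradiction refl i≢i

  label-≥ : (w : Multigraph n) → ∀ i j → i ≢ j → w i j ≤ q → w i j ≤ val (label w i j)
  label-≥ w i j i≢j le with i ≟ᶠ j | <-cmp (w i j) a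
  ... | yes i≡j | _           = contradiction i≡j i≢j
  ... | no _    | tri< lt _ _ = s≤s⁻¹ (≤-trans lt (≤-reflexive a≡1+p))
  ... | no _    | tri≈ _ eq _ = ≤-reflexive eq
  ... | no _    | tri> _ _ _  = le

  -- Three pos pairs on a triple weigh at least 3 a + 3. Four pos sides with two diagonals of weight
  -- at least `a` weigh at least 6 a + 4.
  label-admissible : (w : Multigraph n) → Symmetric w → Sparse 3 (tri 3 * a + 2) w → Sparse 4 (tri 4 * a + 3) w →
    Admissible (label w)
  label-admissible w s sparse₃ sparse₄ = record
    { symmetric = label-symmetric w s
    ; diagonal  = label-diagonal w
    ; triangle  = λ x y z xy yz xz →
        let x≢y , wxy = label-pos w x y xy
            y≢z , wyz = label-pos w y z yz
            x≢z , wxz = label-pos w x z xz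
        in contradiction (≤-trans (≤-trans (≤-reflexive (eq₃ a))
             (+-mono-≤ (+-mono-≤ wxy (+-mono-≤ wxz z≤n)) (+-mono-≤ (+-mono-≤ wyz z≤n) z≤n)))
             (sparse₃ (x ◂ y ◂ z ◂ ⟨⟩) (◂-injective (λ { 0F → x≢y ; 1F → x≢z }) (◂-injective (λ { 0F → y≢z }) (◂-injective (λ ()) ⟨⟩-injective)))))
             (<-irrefl refl)
    ; square    = λ v x y z vy vz xy xz vx → Dec.decidable-stable (neg? (label w y z)) λ yz →
        let v≢y , wvy = label-pos w v y vy
            v≢z , wvz = label-pos w v z vz
            x≢y , wxy = label-pos w x y xy
            x≢z , wxz = label-pos w x z xz
            v≢x , wvx = label-≢neg w v x vx
            y≢z , wyz = label-≢neg w y z yz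
        in contradiction (≤-trans (≤-trans (≤-reflexive (eq₄ a))
             (+-mono-≤ (+-mono-≤ wvx (+-mono-≤ wvy (+-mono-≤ wvz z≤n))) (+-mono-≤ (+-mono-≤ wxy (+-mono-≤ wxz z≤n)) (+-mono-≤ (+-mono-≤ wyz z≤n) z≤n))))
             (sparse₄ (v ◂ x ◂ y ◂ z ◂ ⟨⟩) (◂-injective (λ { 0F → v≢x ; 1F → v≢y ; 2F → v≢z })
               (◂-injective (λ { 0F → x≢y ; 1F → x≢z }) (◂-injective (λ { 0F → y≢z }) (◂-injective (λ ()) ⟨⟩-injective))))))
             (<-irrefl refl)
    }
    where
    eq₃ : ∀ a → suc (3 * a + 2) ≡ suc a + (suc a + 0) + (suc a + 0 + 0)
    eq₃ = solve-∀
    eq₄ : ∀ a → suc (6 * a + 3) ≡ a + (suc a + (suc a + 0)) + (suc a + (suc a + 0) + (a + 0 + 0))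
    eq₄ = solve-∀

  -- Add the three 4-sets containing the dense triple twice and those containing the complementary
  -- triple once. Each cross pair and each pair of the complementary triple is then counted three
  -- times, and each pair of the dense triple six times. The surplus of the dense triple is
  -- subtracted in the end. Deleting the triple would be useless here, as three vertices contain no
  -- 4-set.
  dense-first-triple : (w : Multigraph 6) → Sparse 4 (tri 4 * a + 3) w →
    tri 3 * a + 2 < ΣPairs 3 (λ i j → w (i ↑ˡ 3) (j ↑ˡ 3)) → ΣPairs 6 w ≤ tri 6 * a + 6
  dense-first-triple w sparse dense = +-cancelʳ-≤ (suc (3 * a + 2)) _ _ (begin
    ΣPairs 6 w + suc (3 * a + 2)  ≤⟨ +-monoʳ-≤ (ΣPairs 6 w) dense ⟩
    ΣPairs 6 w + T                ≤⟨ *-cancelˡ-≤ 3 thrice ⟩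
    3 * Q                         ≡⟨ eq₁ a ⟩
    15 * a + 6 + suc (3 * a + 2)  ∎)
    where
    open ≤-Reasoning
    T Q : ℕ
    T = ΣPairs 3 (λ i j → w (i ↑ˡ 3) (j ↑ˡ 3))
    Q = 6 * a + 3
    quad : (v : Vec (Fin 6) 4) → (∀ i j → lookup v i ≡ lookup v j → i ≡ j) →
      ΣPairs 4 (λ i j → w (lookup v i) (lookup v j)) ≤ Q
    quad v v-inj = sparse (lookup v) (v-inj _ _)
    quad₁ : ∀ (j : Fin 3) → ΣPairs 4 (λ i i′ → w (lookup (0F ∷ 1F ∷ 2F ∷ (3 ↑ʳ j) ∷ []) i) (lookup (0F ∷ 1F ∷ 2F ∷ (3 ↑ʳ j) ∷ []) i′)) ≤ Q
    quad₁ j = quad (0F ∷ 1F ∷ 2F ∷ (3 ↑ʳ j) ∷ []) (Dec.from-yes (all? (λ (j : Fin 3) → inj? (lookup (0F ∷ 1F ∷ 2F ∷ (3 ↑ʳ j) ∷ [])))) j)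
    quad₂ : ∀ (i : Fin 3) → ΣPairs 4 (λ j j′ → w (lookup ((i ↑ˡ 3) ∷ 3F ∷ 4F ∷ 5F ∷ []) j) (lookup ((i ↑ˡ 3) ∷ 3F ∷ 4F ∷ 5F ∷ []) j′)) ≤ Q
    quad₂ i = quad ((i ↑ˡ 3) ∷ 3F ∷ 4F ∷ 5F ∷ []) (Dec.from-yes (all? (λ (i : Fin 3) → inj? (lookup ((i ↑ˡ 3) ∷ 3F ∷ 4F ∷ 5F ∷ [])))) i)
    eq₁ : ∀ a → 3 * (6 * a + 3) ≡ 15 * a + 6 + suc (3 * a + 2)
    eq₁ = solve-∀
    eq₂ : ∀ a01 a02 a03 a04 a05 a12 a13 a14 a15 a23 a24 a25 a34 a35 a45 →
      3 * (a01 + (a02 + (a03 + (a04 + (a05 + 0)))) + (a12 + (a13 + (a14 + (a15 + 0))) + (a23 + (a24 + (a25 + 0)) + (a34 + (a35 + 0) + (a45 + 0 + (0 + 0)))))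
        + (a01 + (a02 + 0) + (a12 + 0 + (0 + 0))))
      ≡ 2 * (a01 + (a02 + (a03 + 0)) + (a12 + (a13 + 0) + (a23 + 0 + (0 + 0)))
        + (a01 + (a02 + (a04 + 0)) + (a12 + (a14 + 0) + (a24 + 0 + (0 + 0))))
        + (a01 + (a02 + (a05 + 0)) + (a12 + (a15 + 0) + (a25 + 0 + (0 + 0)))))
        + (a03 + (a04 + (a05 + 0)) + (a34 + (a35 + 0) + (a45 + 0 + (0 + 0)))
        + (a13 + (a14 + (a15 + 0)) + (a34 + (a35 + 0) + (a45 + 0 + (0 + 0))))
        + (a23 + (a24 + (a25 + 0)) + (a34 + (a35 + 0) + (a45 + 0 + (0 + 0)))))
    eq₂ = solve-∀
    eq₃ : ∀ Q → 2 * (Q + Q + Q) + (Q + Q + Q) ≡ 3 * (3 * Q)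
    eq₃ = solve-∀
    thrice : 3 * (ΣPairs 6 w + T) ≤ 3 * (3 * Q)
    thrice = begin
      3 * (ΣPairs 6 w + T)
        ≡⟨ eq₂ (w 0F 1F) (w 0F 2F) (w 0F 3F) (w 0F 4F) (w 0F 5F) (w 1F 2F) (w 1F 3F) (w 1F 4F) (w 1F 5F)
             (w 2F 3F) (w 2F 4F) (w 2F 5F) (w 3F 4F) (w 3F 5F) (w 4F 5F) ⟩
      _ ≤⟨ +-mono-≤ (*-monoʳ-≤ 2 (+-mono-≤ (+-mono-≤ (quad₁ 0F) (quad₁ 1F)) (quad₁ 2F))) (+-mono-≤ (+-mono-≤ (quad₂ 0F) (quad₂ 1F)) (quad₂ 2F)) ⟩
      2 * (Q + Q + Q) + (Q + Q + Q) ≡⟨ eq₃ Q ⟩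
      3 * (3 * Q) ∎

  dense-triple-six : (w : Multigraph 6) → Symmetric w → Sparse 4 (tri 4 * a + 3) w →
    (x : Fin 3 → Fin 6) → Inj x → tri 3 * a + 2 < ΣPairs 3 (λ i j → w (x i) (x j)) → Bounded 0 6 (ΠPairs 6 w)
  dense-triple-six w s sparse x x-inj dense = with-relabelling (relabel 3 {3} x x-inj)
    where
    with-relabelling : Relabelling {3} {3} x → Bounded 0 6 (ΠPairs 6 w)
    with-relabelling R = Bounded-six (≤-trans (≤-reflexive (sym (ΠPairs-to w s)))
      (ΣPairs⇒W (λ i j → w (to i) (to j)) refl (dense-first-triple (λ i j → w (to i) (to j)) (Sparse-∘ {w = w} to to-injective sparse)
        (≤-trans dense (≤-reflexive (ΣPairs-cong (λ i j → sym (cong₂ w (to-extends i) (to-extends j)))))))))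
      where open Relabelling R

  -- A removal may land on five vertices, where slack is unavoidable. Granting slack one everywhere
  -- keeps the removals uniform; `Star-grow-2` and `Star-grow-3` gain enough to absorb it.
  Theorem₄-weak : ∀ k → (∀ {j} → j < k → Theorem₄ 0 (6 + j)) → ∀ i → i ≤ suc k → Theorem₄ 1 (4 + i)
  Theorem₄-weak k ih zero          _  w s sparse = Bounded-weaken {π = ΠPairs 4 w} z≤n (Theorem₄-4 w s sparse)
  Theorem₄-weak k ih (suc zero)    _  w s sparse = Theorem₄-5 w s sparse
  Theorem₄-weak k ih (suc (suc i)) i≤ w s sparse = Bounded-weaken {π = ΠPairs (6 + i) w} z≤n (ih (s≤s⁻¹ i≤) w s sparse)

  remove-triple : ∀ k → Theorem₄ 1 (4 + k) → (w : Multigraph (7 + k)) → Symmetric w → Sparse 4 (tri 4 * a + 3) w →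
    (x : Fin 3 → Fin (7 + k)) → Inj x → tri 3 * a + 2 < ΣPairs 3 (λ i j → w (x i) (x j)) → Bounded 0 (7 + k) (ΠPairs (7 + k) w)
  remove-triple k ih w s sparse x x-inj dense =
    conclude (remove 3 (3 + k) 3 0 w s sparse x x-inj (≤-trans (≤-reflexive (eq a)) (+-monoʳ-≤ (3 * a + 0) dense)))
    where
    eq : ∀ a → 6 * a + 3 ≡ 3 * a + 0 + suc (3 * a + 2)
    eq = solve-∀
    conclude : (∃ λ (e : Fin (4 + k) → Fin (7 + k)) → Inj e × ΠPairs (7 + k) w * W 0 0 (3 + (3 + k) * 0)
      ≤ ΠPairs (4 + k) (λ i j → w (e i) (e j)) * W (3 + (3 + k) * 0) 0 (6 + (3 + k) * 3)) → Bounded 0 (7 + k) (ΠPairs (7 + k) w)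
    conclude (e , e-inj , removed) with ih (λ i j → w (e i) (e j)) (λ i j → s (e i) (e j)) (Sparse-∘ {w = w} e e-inj sparse)
    ... | m , l , m+l≡ , bound with Star-grow-3 m l (4 + k) m+l≡ (m≤m+n 4 k)
    ...   | m′ , l′ , m′+l′≡ , grown = m′ , l′ , m′+l′≡ , descend {ΠPairs (7 + k) w} {ΠPairs (4 + k) (λ i j → w (e i) (e j))} {3} {6 + (3 + k) * 3} {1} {m} {l} {m′} {l′} {0} {4}
      (subst (λ E → ΠPairs (7 + k) w * W 0 0 (3 + E) ≤ ΠPairs (4 + k) (λ i j → w (e i) (e j)) * W (3 + E) 0 (6 + (3 + k) * 3)) (*-zeroʳ (3 + k)) removed)
      bound grown refl

  -- Triples of weight at most 3 a + 2 leave at most 2 a from an outside vertex to a pair heavier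
  -- than a + 1.
  remove-edge : ∀ k → Theorem₄ 1 (4 + k) → (w : Multigraph (6 + k)) → Symmetric w → Sparse 4 (tri 4 * a + 3) w → Sparse 3 (tri 3 * a + 2) w →
    (x : Fin 2 → Fin (6 + k)) → Inj x → tri 2 * a + 1 < ΣPairs 2 (λ i j → w (x i) (x j)) → Bounded 0 (6 + k) (ΠPairs (6 + k) w)
  remove-edge k ih w s sparse sparse₃ x x-inj dense =
    conclude (remove 2 (3 + k) 2 0 w s sparse₃ x x-inj (≤-trans (≤-reflexive (eq a)) (+-monoʳ-≤ (2 * a + 0) dense)))
    where
    eq : ∀ a → 3 * a + 2 ≡ 2 * a + 0 + suc (1 * a + 1)
    eq = solve-∀
    conclude : (∃ λ (e : Fin (4 + k) → Fin (6 + k)) → Inj e × ΠPairs (6 + k) w * W 0 0 (2 + (3 + k) * 0)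
      ≤ ΠPairs (4 + k) (λ i j → w (e i) (e j)) * W (2 + (3 + k) * 0) 0 (3 + (3 + k) * 2)) → Bounded 0 (6 + k) (ΠPairs (6 + k) w)
    conclude (e , e-inj , removed) with ih (λ i j → w (e i) (e j)) (λ i j → s (e i) (e j)) (Sparse-∘ {w = w} e e-inj sparse)
    ... | m , l , m+l≡ , bound with Star-grow-2 m l (4 + k) m+l≡ (m≤m+n 4 k)
    ...   | m′ , l′ , m′+l′≡ , grown = m′ , l′ , m′+l′≡ , descend {ΠPairs (6 + k) w} {ΠPairs (4 + k) (λ i j → w (e i) (e j))} {2} {3 + (3 + k) * 2} {1} {m} {l} {m′} {l′} {0} {3}
      (subst (λ E → ΠPairs (6 + k) w * W 0 0 (2 + E) ≤ ΠPairs (4 + k) (λ i j → w (e i) (e j)) * W (2 + E) 0 (3 + (3 + k) * 2)) (*-zeroʳ (3 + k)) removed)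
      bound grown refl

  label-step : ∀ k → (∀ {j} → j < k → Theorem₄ 0 (6 + j)) → (w : Multigraph (6 + k)) → Symmetric w →
    Sparse 4 (tri 4 * a + 3) w → Sparse 3 (tri 3 * a + 2) w → Sparse 2 (tri 2 * a + 1) w → Bounded 0 (6 + k) (ΠPairs (6 + k) w)
  label-step k ih w s sparse sparse₃ sparse₂ = conclude (symmetrise (label-admissible w s sparse₃ sparse))
    where
    eq : ∀ a → 1 * a + 1 ≡ suc a
    eq = solve-∀
    w≤q : ∀ i j → i ≢ j → w i j ≤ q
    w≤q i j i≢j = begin
      w i j              ≡⟨ trans (+-identityʳ (w i j + 0)) (+-identityʳ (w i j)) ⟨
      w i j + 0 + 0      ≤⟨ sparse₂ (i ◂ j ◂ ⟨⟩) (◂-injective (λ { 0F → i≢j }) (◂-injective (λ ()) ⟨⟩-injective)) ⟩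
      1 * a + 1          ≡⟨ trans (eq a) (sym q≡1+a) ⟩
      q                  ∎
      where open ≤-Reasoning
    w≤ : ∀ i j → i <ᶠ j → w i j ≤ weight (label w) i j
    w≤ i j i<j = label-≥ w i j i≢j (w≤q i j i≢j)
      where
      i≢j : i ≢ j
      i≢j i≡j = <-irrefl (cong toℕ i≡j) i<j
    finish : ∀ k → (∀ {j} → j < k → Theorem₄ 0 (6 + j)) → (ℓ : Labelling (6 + k)) → Admissible ℓ → Transitive ℓ → Bounded 0 (6 + k) (ΠPairs (6 + k) (weight ℓ))
    finish zero    _  = labelled-six
    finish (suc k) ih = labelled (m≤m+n 6 k) (ih ≤-refl)
    conclude : (∃ λ ℓ → Admissible ℓ × Transitive ℓ × ΠPairs (6 + k) (weight (label w)) ≤ ΠPairs (6 + k) (weight ℓ)) →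
      Bounded 0 (6 + k) (ΠPairs (6 + k) w)
    conclude (ℓ , adm , tr , le) = Bounded-≤ {0} {6 + k} {ΠPairs (6 + k) w} {ΠPairs (6 + k) (weight ℓ)}
      (≤-trans (ΠPairs-mono {6 + k} {w} {weight (label w)} w≤) le) (finish k ih ℓ adm tr)

  Theorem₄-step : ∀ k → (∀ {j} → j < k → Theorem₄ 0 (6 + j)) → Theorem₄ 0 (6 + k)
  Theorem₄-step k ih w s sparse = triples (dense⊎Sparse 3 (tri 3 * a + 2) w)
    where
    triple : ∀ k → (∀ {j} → j < k → Theorem₄ 0 (6 + j)) → (w : Multigraph (6 + k)) → Symmetric w → Sparse 4 (tri 4 * a + 3) w →
      (x : Fin 3 → Fin (6 + k)) → Inj x → tri 3 * a + 2 < ΣPairs 3 (λ i j → w (x i) (x j)) → Bounded 0 (6 + k) (ΠPairs (6 + k) w)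
    triple zero    ih = dense-triple-six
    triple (suc k) ih = remove-triple k (Theorem₄-weak (suc k) ih k (≤-trans (n≤1+n k) (n≤1+n (suc k))))
    edges : Sparse 3 (tri 3 * a + 2) w →
      (∃ λ (x : Fin 2 → Fin (6 + k)) → Inj x × tri 2 * a + 1 < ΣPairs 2 (λ i j → w (x i) (x j))) ⊎ Sparse 2 (tri 2 * a + 1) w →
      Bounded 0 (6 + k) (ΠPairs (6 + k) w)
    edges sparse₃ (inj₁ (x , x-inj , dense)) = remove-edge k (Theorem₄-weak k ih k (n≤1+n k)) w s sparse sparse₃ x x-inj dense
    edges sparse₃ (inj₂ sparse₂) = label-step k ih w s sparse sparse₃ sparse₂
    triples : (∃ λ (x : Fin 3 → Fin (6 + k)) → Inj x × tri 3 * a + 2 < ΣPairs 3 (λ i j → w (x i) (x j))) ⊎ Sparse 3 (tri 3 * a + 2) w →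
      Bounded 0 (6 + k) (ΠPairs (6 + k) w)
    triples (inj₁ (x , x-inj , dense)) = triple k ih w s sparse x x-inj dense
    triples (inj₂ sparse₃) = edges sparse₃ (dense⊎Sparse 2 (tri 2 * a + 1) w)

  theorem₄ : ∀ k → Theorem₄ 0 (6 + k)
  theorem₄ = <-rec (λ k → Theorem₄ 0 (6 + k)) Theorem₄-step

  -- 5-sets

  Theorem₅ : ℕ → ℕ → Set
  Theorem₅ e n = ∀ (w : Multigraph n) → Symmetric w → Sparse 5 (tri 5 * a + 5) w → Bounded e n (ΠPairs n w)

  weaken₅ : ∀ {e e′} → e ≤ e′ → Theorem₅ e n → Theorem₅ e′ n
  weaken₅ {n} e≤ h w s sparse = Bounded-weaken {π = ΠPairs n w} e≤ (h w s sparse)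

  -- The deficit 5 is dictated by eight vertices, where averaging gives an excess of 12 and the
  -- one-centre star has 7.
  Theorem₅-base : ∀ n → 5 ≤ n → n ≤ 8 → Theorem₅ 5 n
  Theorem₅-base 5 _ _ w s sparse = ΣPairs⇒Bounded 4 5 w (m≤m+n 5 4) (sparse id id)
  Theorem₅-base 6 _ _ w s sparse = ΣPairs⇒Bounded 5 5 w (m≤m+n 7 3) (Sparse₅-6 w s sparse)
  Theorem₅-base 7 _ _ w s sparse = ΣPairs⇒Bounded 6 5 w (m≤m+n 9 2) (Sparse₅-7 w s sparse)
  Theorem₅-base 8 _ _ w s sparse = ΣPairs⇒Bounded 7 5 w ≤-refl (Sparse₅-8 w s sparse)
  Theorem₅-base 0 () _
  Theorem₅-base 1 (s≤s ()) _
  Theorem₅-base 2 (s≤s (s≤s ())) _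
  Theorem₅-base 3 (s≤s (s≤s (s≤s ()))) _
  Theorem₅-base 4 (s≤s (s≤s (s≤s (s≤s ())))) _
  Theorem₅-base (suc (suc (suc (suc (suc (suc (suc (suc (suc n))))))))) _ (s≤s (s≤s (s≤s (s≤s (s≤s (s≤s (s≤s (s≤s ()))))))))

  remove-quadruple : ∀ r e (w : Multigraph (4 + suc (suc r))) → Symmetric w → Sparse 5 (tri 5 * a + 5) w →
    (∀ (f : Fin (2 + r) → Fin (6 + r)) → Inj f →
      ΠPairs (6 + r) w * W 0 0 (4 + (2 + r) * 1) ≤ ΠPairs (2 + r) (λ i j → w (f i) (f j)) * W (4 + (2 + r) * 1) 0 (6 + (2 + r) * 4) →
      Bounded e (6 + r) (ΠPairs (6 + r) w)) → Bounded e (6 + r) (ΠPairs (6 + r) w)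
  remove-quadruple r e w s sparse continue = quadruples (dense⊎Sparse 4 (tri 4 * a + 3) w)
    where
    eq : ∀ a → 10 * a + 5 ≡ 4 * a + 1 + suc (6 * a + 3)
    eq = solve-∀
    removed : (∃ λ (f : Fin (2 + r) → Fin (6 + r)) → Inj f ×
      ΠPairs (6 + r) w * W 0 0 (5 + (1 + r) * 1) ≤ ΠPairs (2 + r) (λ i j → w (f i) (f j)) * W (5 + (1 + r) * 1) 0 (10 + (1 + r) * 4)) →
      Bounded e (6 + r) (ΠPairs (6 + r) w)
    -- The outside vertex that was grouped with the 4-set is counted with the others again: 5 + (1 +
    -- r) and 4 + (2 + r) agree by computation, as do 10 + 4 (1 + r) and 6 + 4 (2 + r).
    removed (f , f-inj , h) = continue f f-inj h
    quadruples : (∃ λ (x : Fin 4 → Fin (6 + r)) → Inj x × tri 4 * a + 3 < ΣPairs 4 (λ i j → w (x i) (x j))) ⊎ Sparse 4 (tri 4 * a + 3) w →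
      Bounded e (6 + r) (ΠPairs (6 + r) w)
    quadruples (inj₁ (x , x-inj , dense)) = removed (remove 4 (suc r) 5 1 w s sparse x x-inj (≤-trans (≤-reflexive (eq a)) (+-monoʳ-≤ (4 * a + 1) dense)))
    quadruples (inj₂ sparse₄) = Bounded-weaken {π = ΠPairs (6 + r) w} z≤n (theorem₄ r w s sparse₄)

  Theorem₅-loss : ∀ r e → Theorem₅ e (2 + r) → Theorem₅ (suc e) (6 + r)
  Theorem₅-loss r e ih w s sparse = remove-quadruple r (suc e) w s sparse λ f f-inj removed →
    conclude f removed (ih (λ i j → w (f i) (f j)) (λ i j → s (f i) (f j)) (Sparse-∘ {w = w} f f-inj sparse))
    where
    eq₁ : ∀ m l → 1 + m + (3 + l) ≡ 4 + (m + l)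
    eq₁ = solve-∀
    eq₂ : ∀ e N → suc e + (3 + N) ≡ 4 + N + e
    eq₂ = solve-∀
    conclude : ∀ (f : Fin (2 + r) → Fin (6 + r)) →
      ΠPairs (6 + r) w * W 0 0 (4 + (2 + r) * 1) ≤ ΠPairs (2 + r) (λ i j → w (f i) (f j)) * W (4 + (2 + r) * 1) 0 (6 + (2 + r) * 4) →
      Bounded e (2 + r) (ΠPairs (2 + r) (λ i j → w (f i) (f j))) → Bounded (suc e) (6 + r) (ΠPairs (6 + r) w)
    conclude f removed (m , l , m+l≡ , bound) = 1 + m , 3 + l , trans (eq₁ m l) (cong (4 +_) m+l≡) ,
      descend {ΠPairs (6 + r) w} {ΠPairs (2 + r) (λ i j → w (f i) (f j))} {4 + (2 + r) * 1} {6 + (2 + r) * 4} {e} {m} {l} {1 + m} {3 + l} {suc e} {3 + (2 + r) * 1}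
        removed bound (Star-grow-4 m l (2 + r) e m+l≡) (eq₂ e ((2 + r) * 1))

  -- Whereas `Theorem₅-loss` grows whatever star it is given, the star here is first replaced by an
  -- optimal one: on at least 29 vertices it has more than 7 centres by `optimal-centre`.
  Theorem₅-gain : ∀ r e → 29 ≤ 2 + r → Theorem₅ (suc e) (2 + r) → Theorem₅ e (6 + r)
  Theorem₅-gain r e 29≤ ih w s sparse = remove-quadruple r e w s sparse λ f f-inj removed →
    conclude f removed (ih (λ i j → w (f i) (f j)) (λ i j → s (f i) (f j)) (Sparse-∘ {w = w} f f-inj sparse)) (optimal (2 + r))
    where
    eq₁ : ∀ m l → 9 + m + (3 + l) ≡ 4 + (8 + m + l)
    eq₁ = solve-∀
    eq₂ : ∀ e N → e + (5 + N) ≡ 4 + N + suc e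
    eq₂ = solve-∀
    large : ∀ m l → m + l ≡ 2 + r → Optimal m l → 8 ≤ m
    large m l m+l≡ opt = ≮⇒≥ λ m<8 → contradiction (begin
      29      ≤⟨ 29≤ ⟩
      2 + r   ≡⟨ m+l≡ ⟨
      m + l   ≤⟨ optimal-centre m l opt (≤-trans (m≤m+n 2 r) (≤-reflexive (sym m+l≡))) ⟩
      4 * m   ≤⟨ *-monoʳ-≤ 4 (s≤s⁻¹ m<8) ⟩
      28      ∎) (<-irrefl refl)
      where open ≤-Reasoning
    conclude : ∀ (f : Fin (2 + r) → Fin (6 + r)) →
      ΠPairs (6 + r) w * W 0 0 (4 + (2 + r) * 1) ≤ ΠPairs (2 + r) (λ i j → w (f i) (f j)) * W (4 + (2 + r) * 1) 0 (6 + (2 + r) * 4) →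
      Bounded (suc e) (2 + r) (ΠPairs (2 + r) (λ i j → w (f i) (f j))) →
      (∃₂ λ m l → m + l ≡ 2 + r × Optimal m l) → Bounded e (6 + r) (ΠPairs (6 + r) w)
    conclude f removed bound (m , l , m+l≡ , opt) with m₀ , refl ← m≤n⇒∃[o]m+o≡n (large m l m+l≡ opt) =
      9 + m₀ , 3 + l , trans (eq₁ m₀ l) (cong (4 +_) m+l≡) ,
      descend {ΠPairs (6 + r) w} {ΠPairs (2 + r) (λ i j → w (f i) (f j))} {4 + (2 + r) * 1} {6 + (2 + r) * 4} {suc e} {8 + m₀} {l} {9 + m₀} {3 + l} {e} {5 + (2 + r) * 1}
        removed (Bounded-optimal {π = ΠPairs (2 + r) (λ i j → w (f i) (f j))} {8 + m₀} {l} bound m+l≡ opt) (Star-grow-4-large m₀ l (2 + r) e m+l≡) (eq₂ e ((2 + r) * 1))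

  -- One unit of α is lost for every four vertices.
  Theorem₅-low : ∀ j n → 5 ≤ n → n ≤ 8 + j * 4 → Theorem₅ (5 + j) n
  Theorem₅-low zero    n 5≤ n≤ = Theorem₅-base n 5≤ n≤
  Theorem₅-low (suc j) n 5≤ n≤ with n ≤? 8
  ... | yes n≤8 = weaken₅ (m≤m+n 5 (suc j)) (Theorem₅-base n 5≤ n≤8)
  ... | no n≰8 with r , refl ← m≤n⇒∃[o]m+o≡n (≰⇒> n≰8) =
    subst (λ e → Theorem₅ e (9 + r)) (sym (+-suc 5 j)) (Theorem₅-loss (3 + r) (5 + j) (Theorem₅-low j (5 + r) (m≤m+n 5 r) (+-cancelˡ-≤ 4 (5 + r) (8 + j * 4) n≤)))

  -- Gains need 29 vertices after the removal, that is 33 before it. The four sizes 33 to 36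
  -- represent all residues modulo 4 and lie below 8 + 7 · 4, so their deficit is 5 + 7 = 12. Beyond
  -- them it is merely kept, which gives a uniform start for the descent.
  Theorem₅-plateau : ∀ j n → 33 ≤ n → n ≤ 36 + j * 4 → Theorem₅ 12 n
  Theorem₅-plateau zero    n 33≤ n≤ = Theorem₅-low 7 n (≤-trans (m≤m+n 5 28) 33≤) n≤
  Theorem₅-plateau (suc j) n 33≤ n≤ with n ≤? 36
  ... | yes n≤36 = Theorem₅-low 7 n (≤-trans (m≤m+n 5 28) 33≤) n≤36
  ... | no n≰36 with r , refl ← m≤n⇒∃[o]m+o≡n (≤-trans (m≤m+n 6 27) 33≤) =
    Theorem₅-gain r 12 (≤-trans (m≤m+n 29 4) 33≤′) (weaken₅ (n≤1+n 12) (Theorem₅-plateau j (2 + r) 33≤′ (+-cancelˡ-≤ 4 (2 + r) (36 + j * 4) n≤)))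
    where
    33≤′ : 33 ≤ 2 + r
    33≤′ = +-cancelˡ-≤ 4 33 (2 + r) (≰⇒> n≰36)

  -- Each of the 12 units is regained by one removal of four vertices, whence 33 + 4 i.
  Theorem₅-high : ∀ i e → e + i ≡ 12 → ∀ n → 33 + i * 4 ≤ n → Theorem₅ e n
  Theorem₅-high zero e e+0≡12 n 33≤ = subst (λ e → Theorem₅ e n) (trans (sym e+0≡12) (+-identityʳ e))
    (Theorem₅-plateau n n 33≤ (≤-trans (m≤m*n n 4) (m≤n+m (n * 4) 36)))
  Theorem₅-high (suc i) e e+i≡12 n 37≤ with r , refl ← m≤n⇒∃[o]m+o≡n (≤-trans (m≤m+n 6 (31 + i * 4)) 37≤) =
    Theorem₅-gain r e (≤-trans (m≤m+n 29 (4 + i * 4)) 33≤) (Theorem₅-high i (suc e) (trans (sym (+-suc e i)) e+i≡12) (2 + r) 33≤)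
    where
    33≤ : 33 + i * 4 ≤ 2 + r
    33≤ = +-cancelˡ-≤ 4 (33 + i * 4) (2 + r) 37≤

  theorem₅ : ∀ n → 124 ≤ n → Theorem₅ 0 n
  theorem₅ n 124≤ = Theorem₅-high 12 0 refl n (≤-trans (m≤m+n 81 43) 124≤)

  -- Stars satisfy the 5-set condition

  ∑-inside-0 : (X : Subset n) (c : Fin n → Fin 2) →
    ∑ (λ j → if does (j ∈? X) then multT a 1 0F (c j) else 0)
      ≡ # (λ j → does (j ∈? X) ∧ is0 (c j)) * p + # (λ j → does (j ∈? X) ∧ is1 (c j)) * q
  ∑-inside-0 Vec.[] c = refl
  ∑-inside-0 (outside Vec.∷ X) c = ∑-inside-0 X (c ∘ suc)
  ∑-inside-0 (inside Vec.∷ X) c = trans (cong₂ _+_ (entry (c zero)) (∑-inside-0 X (c ∘ suc)))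
    (rearrange p q ⟦ is0 (c zero) ⟧ ⟦ is1 (c zero) ⟧ (# (λ j → does (j ∈? X) ∧ is0 (c (suc j)))) (# (λ j → does (j ∈? X) ∧ is1 (c (suc j)))))
    where
    entry : ∀ i → multT a 1 0F i ≡ ⟦ is0 i ⟧ * p + ⟦ is1 i ⟧ * q
    entry 0F = trans a∸1≡p (sym (trans (+-identityʳ _) (+-identityʳ p)))
    entry 1F = trans (sym q≡1+a) (sym (+-identityʳ q))
    rearrange : ∀ p q x y z t → x * p + y * q + (z * p + t * q) ≡ (x + z) * p + (y + t) * q
    rearrange = solve-∀

  ∑-inside-1 : (X : Subset n) (c : Fin n → Fin 2) →
    ∑ (λ j → if does (j ∈? X) then multT a 1 1F (c j) else 0)
      ≡ # (λ j → does (j ∈? X) ∧ is0 (c j)) * q + # (λ j → does (j ∈? X) ∧ is1 (c j)) * a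
  ∑-inside-1 Vec.[] c = refl
  ∑-inside-1 (outside Vec.∷ X) c = ∑-inside-1 X (c ∘ suc)
  ∑-inside-1 (inside Vec.∷ X) c = trans (cong₂ _+_ (entry (c zero)) (∑-inside-1 X (c ∘ suc)))
    (rearrange q a ⟦ is0 (c zero) ⟧ ⟦ is1 (c zero) ⟧ (# (λ j → does (j ∈? X) ∧ is0 (c (suc j)))) (# (λ j → does (j ∈? X) ∧ is1 (c (suc j)))))
    where
    entry : ∀ i → multT a 1 1F i ≡ ⟦ is0 i ⟧ * q + ⟦ is1 i ⟧ * a
    entry 0F = trans (sym q≡1+a) (sym (trans (+-identityʳ _) (+-identityʳ q)))
    entry 1F = sym (+-identityʳ a)
    rearrange : ∀ p q x y z t → x * p + y * q + (z * p + t * q) ≡ (x + z) * p + (y + t) * q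
    rearrange = solve-∀

  eIn-coloured : (X : Subset n) (c : Fin n → Fin 2) → let k = # (λ j → does (j ∈? X) ∧ is0 (c j)); l = # (λ j → does (j ∈? X) ∧ is1 (c j)) in
    eIn (coloured c) X ≡ tri k * p + (tri l * a + k * l * q)
  eIn-coloured Vec.[] c = refl
  eIn-coloured {suc n} (outside Vec.∷ X) c = trans (cong (_+ eIn (coloured (c ∘ suc)) X) (trans (∑-const n 0) (*-zeroʳ n))) (eIn-coloured X (c ∘ suc))
  eIn-coloured {suc n} (inside Vec.∷ X) c = go (c zero) refl
    where
    k₀ l₀ : ℕ
    k₀ = # (λ j → does (j ∈? X) ∧ is0 (c (suc j)))
    l₀ = # (λ j → does (j ∈? X) ∧ is1 (c (suc j)))
    eq₀ : ∀ k l tk tl p q a → k * p + l * q + (tk * p + (tl * a + k * l * q)) ≡ (k + tk) * p + (tl * a + (l + k * l) * q)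
    eq₀ = solve-∀
    eq₁ : ∀ k l tk tl p q a → k * q + l * a + (tk * p + (tl * a + k * l * q)) ≡ tk * p + ((l + tl) * a + k * suc l * q)
    eq₁ = solve-∀
    go : ∀ i → c zero ≡ i → eIn (coloured c) (inside Vec.∷ X)
      ≡ tri (⟦ is0 (c zero) ⟧ + k₀) * p + (tri (⟦ is1 (c zero) ⟧ + l₀) * a + (⟦ is0 (c zero) ⟧ + k₀) * (⟦ is1 (c zero) ⟧ + l₀) * q)
    go 0F eq rewrite eq = trans (cong₂ _+_ (∑-inside-0 X (c ∘ suc)) (eIn-coloured X (c ∘ suc))) (eq₀ k₀ l₀ (tri k₀) (tri l₀) p q a)
    go 1F eq rewrite eq = trans (cong₂ _+_ (∑-inside-1 X (c ∘ suc)) (eIn-coloured X (c ∘ suc))) (eq₁ k₀ l₀ (tri k₀) (tri l₀) p q a)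

  ∣∣-colours : (X : Subset n) (c : Fin n → Fin 2) → # (λ j → does (j ∈? X) ∧ is0 (c j)) + # (λ j → does (j ∈? X) ∧ is1 (c j)) ≡ ∣ X ∣
  ∣∣-colours Vec.[] c = refl
  ∣∣-colours (outside Vec.∷ X) c = ∣∣-colours X (c ∘ suc)
  ∣∣-colours (inside Vec.∷ X) c with c zero
  ... | 0F = cong suc (∣∣-colours X (c ∘ suc))
  ... | 1F = trans (+-suc _ _) (cong suc (∣∣-colours X (c ∘ suc)))

  -- The third argument of `bound` is the distance to 10 a + 5. It vanishes only for two centres and
  -- three leaves, with six pairs of weight a + 1 and one of weight a - 1.
  coloured-InF : (c : Fin n → Fin 2) → InF n 5 (10 * a + 5) (coloured c)
  coloured-InF c X ∣X∣≡5 = ≤-trans (≤-reflexive (eIn-coloured X c)) (cases (# (λ j → does (j ∈? X) ∧ is0 (c j))) (# (λ j → does (j ∈? X) ∧ is1 (c j))) (trans (∣∣-colours X c) ∣X∣≡5))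
    where
    bound : ∀ k l s → tri k * p + (tri l * suc p + k * l * (2 + p)) + s ≡ 10 * suc p + 5 →
      tri k * p + (tri l * a + k * l * q) ≤ 10 * a + 5
    bound k l s eq = m+n≤o⇒m≤o _ {s} (≤-reflexive (subst (λ q → tri k * p + (tri l * a + k * l * q) + s ≡ 10 * a + 5) (sym q≡1+a)
      (subst (λ a → tri k * p + (tri l * a + k * l * suc a) + s ≡ 10 * a + 5) (sym a≡1+p) eq)))
    cases : ∀ k l → k + l ≡ 5 → tri k * p + (tri l * a + k * l * q) ≤ 10 * a + 5
    cases 0 _ refl = bound 0 5 5 (eq p)
      where
      eq : ∀ p → 0 * p + (10 * suc p + 0 * (2 + p)) + 5 ≡ 10 * suc p + 5
      eq = solve-∀
    cases 1 _ refl = bound 1 4 1 (eq p)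
      where
      eq : ∀ p → 0 * p + (6 * suc p + 4 * (2 + p)) + 1 ≡ 10 * suc p + 5
      eq = solve-∀
    cases 2 _ refl = bound 2 3 0 (eq p)
      where
      eq : ∀ p → 1 * p + (3 * suc p + 6 * (2 + p)) + 0 ≡ 10 * suc p + 5
      eq = solve-∀
    cases 3 _ refl = bound 3 2 2 (eq p)
      where
      eq : ∀ p → 3 * p + (1 * suc p + 6 * (2 + p)) + 2 ≡ 10 * suc p + 5
      eq = solve-∀
    cases 4 _ refl = bound 4 1 7 (eq p)
      where
      eq : ∀ p → 6 * p + (0 * suc p + 4 * (2 + p)) + 7 ≡ 10 * suc p + 5
      eq = solve-∀
    cases 5 _ refl = bound 5 0 15 (eq p)
      where
      eq : ∀ p → 10 * p + (0 * suc p + 0 * (2 + p)) + 15 ≡ 10 * suc p + 5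
      eq = solve-∀

theorem3p6 : (a n : ℕ) → 2 ≤ a → 124 ≤ n →
    Σ ℕ λ m → IsMaxP (InF n 5 ((5 C 2) * a + 5)) m × IsMaxP (InT 2 1 a n) m
theorem3p6 (suc zero) n (s≤s ()) 124≤n
theorem3p6 a@(suc (suc t)) n 2≤a 124≤n = conclude (optimal n)
  where
  open Weights (suc t) a (suc a) refl refl (s≤s z≤n)
  conclude : (∃₂ λ m l → m + l ≡ n × Optimal m l) → Σ ℕ λ m → IsMaxP (InF n 5 ((5 C 2) * a + 5)) m × IsMaxP (InT 2 1 a n) m
  -- The optimal star attains both maxima; `5 C 2` computes to 10, so `coloured-InF` fits as it
  -- stands.
  conclude (m , l , refl , opt) = Star m l ,
    ((star , coloured-InF (first m l) , P-star) , upper) ,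
    ((star , ((first m l) , λ _ _ _ → refl) , P-star) , λ { w (c , w≡) →
      ≤-trans (≤-reflexive (trans (ΠPairs-cong w≡) (ΠPairs-coloured c))) (opt (zeros c) (ones c) (zeros+ones c)) })
    where
    star : Multigraph (m + l)
    star = coloured (first m l)
    P-star : P star ≡ Star m l
    P-star = trans (ΠPairs-coloured (first m l)) (cong₂ Star (zeros-first m l) (ones-first m l))
    upper : (w : Multigraph (m + l)) → InF (m + l) 5 ((5 C 2) * a + 5) w → P w ≤ Star m l
    upper w w∈F = ≤-trans (≤-reflexive (ΠPairs-cong (λ i j i<j → sym (symmetrisation-< w i j i<j))))
      (Bounded₀-optimal {m = m} {l} (theorem₅ (m + l) 124≤n (symmetrisation w) (symmetrisation-symmetric w) (InF⇒Sparse w w∈F)) refl opt)
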